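{- Let $\delta\in\{1,2\}$. Then every nonnegative integer $n$ can be written as $n=p_5(w)+p_5(x)+2p_5(y)+3\delta\, p_5(z)$ with $w,x,y,z$ nonnegative integers, where $p_5(m)=m(3m-1)/2$.
   Context: The pentagonal numbers are $p_5(m)=m(3m-1)/2$ for $m\in\{0,1,2,\ldots\}$. -}

module Defs where

open import Data.Nat using (ℕ; _*_; _∸_; _/_)

-- pentagonal number p₅(m) = m(3m-1)/2 ; m(3m-1) is always even, and for m = 0
-- truncated subtraction gives 0 * 0 = 0, so this is exact.
p5 : ℕ → ℕ
p5 m = (m * (3 * m ∸ 1)) / 2

{-# OPTIONS --safe #-}

-- With a = w² + x² + 2y² + 3δz² and b = w + x + 2y + 3δz the equation reads 2n = 3a - b. As in Cauchy's
-- proof of Fermat's polygonal number theorem, the coordinates of an integral solution are nonnegative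
-- once (3 + 3δ) a < b² + 2b + 4 + 3δ, and for large n there is an interval of possible b, so that b
-- may be chosen in suitable residue classes. What remains is to represent (4 + 3δ) a - b² by a ternary
-- form, and this amounts to representing p M, for some M ≡ 3 mod 4, by a positive ternary form of
-- discriminant p, where p = 7 for δ = 1 and p = 5 for δ = 2. Hermite reduction shows that this form is
-- unique up to equivalence, so any form of discriminant p representing p M will do. Such a form is
-- written down from a positive P with -M a square modulo P and P ≡ -p times a square modulo M.
--
-- Instead of Dirichlet's theorem on primes, P is found by counting. Let χ be the quadratic character
-- belonging to -M and G(n) = Σ_{d|n} χ(d) ≥ 0. By the hyperbola method the sums of G(n) over n ≤ Y² in
-- two residue classes modulo 2M on which χ = 1 differ by at most 2Y, whereas in the class of 1 the
-- values u² + M v² make the sum larger than any multiple of Y. So G(n) > 0 for some n ≡ -p, and then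
-- n is a square times a number P of the required kind.
--
-- The finitely many small n are checked by computation.

module Submission where

open import Defs
open import Algebra.Structures using (IsCommutativeMonoid)
open import Data.Bool using (Bool; true; false; _∧_; _∨_)
open import Data.Empty using (⊥-elim)
open import Data.List using (List; []; _∷_; replicate; drop)
open import Data.List.Relation.Unary.All using ([]; _∷_)
open import Data.Nat as ℕ using (ℕ; zero; suc; _∸_; _%_; _/_; s≤s; z≤n)
import Data.Nat.Divisibility as ℕ
import Data.Nat.DivMod as ℕ
import Data.Nat.Properties as ℕ
import Data.Nat.Tactic.RingSolver as ℕ
open import Data.Nat.Coprimality using (Coprime; coprime?; coprime-Bézout; coprime-divisor; prime⇒coprime; 1-coprimeTo)
import Data.Nat.Coprimality as Coprimality
open import Data.Nat.GCD using (module Bézout)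
open import Data.Nat.Induction using (<-rec; <-wellFounded)
open import Data.Nat.Primality using (Prime; prime?; euclidsLemma; prime⇒nonTrivial; prime⇒nonZero; prime⇒irreducible; ¬prime[1])
open import Data.Nat.Primality.Factorisation using (factorise)
open import Data.Product using (∃-syntax; Σ-syntax; _×_; _,_; proj₁; proj₂)
open import Data.Sum using (_⊎_; inj₁; inj₂; [_,_]′)
open import Data.Vec using (Vec; []; _∷_)
open import Induction.WellFounded using (Acc; acc)
open import Relation.Binary using (tri<; tri≈; tri>)
open import Relation.Binary.PropositionalEquality hiding (J)
open import Relation.Nullary using (Dec; yes; no; ¬_; contradiction)
open import Relation.Nullary.Decidable using (from-yes; from-no; map′; ¬?; _→-dec_; _×-dec_; _⊎-dec_)

-- The value of M depends on b through 2M = 14n + 7b - 3b² or 9M = 20n + 10b - 3b², so modulo p it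
-- is a constant times b²: 2b² for p = 7 and 3b² for p = 5, a square in the first case and a
-- nonsquare in the second. As M ≡ 3 mod 4, reciprocity turns both into (p/M) = -1, hence (-p/M) =
-- 1, as soon as p does not divide b. So the condition under which a suitable P can be expected
-- becomes a congruence for b. Nothing is known about the prime factors of M. All symbols are
-- therefore Jacobi symbols, defined by a sign product that gives multiplicativity and reciprocity
-- without factoring the modulus. P need not be prime: a square factor may be split off, and the
-- positivity of one term of a finite sum suffices, so that no value of an L-function has to be
-- bounded away from zero. The ternary form represents p M and not M. The factor p is removed again
-- because the part of the form that survives modulo p is an anisotropic binary form, so its two
-- variables are divisible by p.

module BigOperators where

  open import Data.Nat using (_+_; _<_; _≟_)
  open import Data.Nat.Properties
  open import Data.Integer using (ℤ)

  -- Finite sums and products over a commutative monoid.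

  module BigOp (_∙_ : ℤ → ℤ → ℤ) (ε : ℤ) (cm : IsCommutativeMonoid _≡_ _∙_ ε) where
    open IsCommutativeMonoid cm using (assoc; comm; identityˡ; identityʳ)
    open ≡-Reasoning

    big : ℕ → (ℕ → ℤ) → ℤ
    big zero    f = ε
    big (suc n) f = big n f ∙ f n

    big-cong : ∀ n {f g : ℕ → ℤ} → (∀ i → i < n → f i ≡ g i) → big n f ≡ big n g
    big-cong zero    h = refl
    big-cong (suc n) h = cong₂ _∙_ (big-cong n (λ i i<n → h i (m<n⇒m<1+n i<n))) (h n ≤-refl)

    big-ε : ∀ n {f : ℕ → ℤ} → (∀ i → i < n → f i ≡ ε) → big n f ≡ ε
    big-ε zero    h = refl
    big-ε (suc n) h = trans (cong₂ _∙_ (big-ε n (λ i i<n → h i (m<n⇒m<1+n i<n))) (h n ≤-refl)) (identityˡ ε)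

    interchange : ∀ a b c d → (a ∙ b) ∙ (c ∙ d) ≡ (a ∙ c) ∙ (b ∙ d)
    interchange a b c d = begin
      (a ∙ b) ∙ (c ∙ d) ≡⟨ assoc a b (c ∙ d) ⟩
      a ∙ (b ∙ (c ∙ d)) ≡⟨ cong (a ∙_) (sym (assoc b c d)) ⟩
      a ∙ ((b ∙ c) ∙ d) ≡⟨ cong (λ t → a ∙ (t ∙ d)) (comm b c) ⟩
      a ∙ ((c ∙ b) ∙ d) ≡⟨ cong (a ∙_) (assoc c b d) ⟩
      a ∙ (c ∙ (b ∙ d)) ≡⟨ sym (assoc a c (b ∙ d)) ⟩
      (a ∙ c) ∙ (b ∙ d) ∎

    big-∙ : ∀ n (f g : ℕ → ℤ) → big n (λ i → f i ∙ g i) ≡ big n f ∙ big n g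
    big-∙ zero    f g = sym (identityˡ ε)
    big-∙ (suc n) f g = trans (cong (_∙ (f n ∙ g n)) (big-∙ n f g))
                              (interchange (big n f) (big n g) (f n) (g n))

    big-swap : ∀ m n (f : ℕ → ℕ → ℤ) →
               big m (λ i → big n (λ j → f i j)) ≡ big n (λ j → big m (λ i → f i j))
    big-swap zero    n f = sym (big-ε n (λ _ _ → refl))
    big-swap (suc m) n f = trans (cong (_∙ big n (f m)) (big-swap m n f))
                                 (sym (big-∙ n (λ j → big m (λ i → f i j)) (f m)))

    big-split : ∀ m n (f : ℕ → ℤ) → big (m + n) f ≡ big m f ∙ big n (λ i → f (m + i))
    big-split m zero    f = trans (cong (λ k → big k f) (+-identityʳ m)) (sym (identityʳ _))
    big-split m (suc n) f = begin
      big (m + suc n) f                              ≡⟨ cong (λ k → big k f) (+-suc m n) ⟩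
      big (m + n) f ∙ f (m + n)                      ≡⟨ cong (_∙ f (m + n)) (big-split m n f) ⟩
      (big m f ∙ big n (λ i → f (m + i))) ∙ f (m + n) ≡⟨ assoc _ _ _ ⟩
      big m f ∙ big (suc n) (λ i → f (m + i))        ∎

    big-single : ∀ n k {f : ℕ → ℤ} → k < n → (∀ i → i < n → i ≢ k → f i ≡ ε) → big n f ≡ f k
    big-single (suc n) k {f} k<1+n h with k ≟ n
    ... | yes refl = trans (cong (_∙ f n) (big-ε n (λ i i<n → h i (m<n⇒m<1+n i<n) (<⇒≢ i<n)))) (identityˡ _)
    ... | no k≢n = trans (cong₂ _∙_ (big-single n k (≤∧≢⇒< (≤-pred k<1+n) k≢n) (λ i i<n → h i (m<n⇒m<1+n i<n)))
                                    (h n ≤-refl (λ n≡k → k≢n (sym n≡k))))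
                         (identityʳ _)

    private
      at : ℕ → ℕ → ℤ → ℤ
      at i j x with i ≟ j
      ... | yes _ = x
      ... | no  _ = ε

      at-refl : ∀ i x → at i i x ≡ x
      at-refl i x with i ≟ i
      ... | yes _ = refl
      ... | no ¬p = contradiction refl ¬p

      at-≢ : ∀ {i j} x → i ≢ j → at i j x ≡ ε
      at-≢ {i} {j} x ne with i ≟ j
      ... | yes p = contradiction p ne
      ... | no  _ = refl

    -- A Kronecker delta for π i = j turns the left side into a double product. After the two
    -- indices are exchanged, the inner product over i has a single nontrivial factor, at i = ρ j.
    big-reindex : ∀ n (π ρ : ℕ → ℕ) →
                  (∀ i → i < n → π i < n) → (∀ i → i < n → ρ i < n) →
                  (∀ i → i < n → ρ (π i) ≡ i) → (∀ i → i < n → π (ρ i) ≡ i) →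
                  (f : ℕ → ℤ) → big n (λ i → f (π i)) ≡ big n f
    big-reindex n π ρ π< ρ< ρπ πρ f = begin
      big n (λ i → f (π i))
        ≡⟨ big-cong n (λ i i<n → sym (trans (big-single n (π i) {λ j → at (π i) j (f j)} (π< i i<n)
             (λ j _ j≢ → at-≢ (f j) (λ e → j≢ (sym e)))) (at-refl (π i) _))) ⟩
      big n (λ i → big n (λ j → at (π i) j (f j)))
        ≡⟨ big-swap n n (λ i j → at (π i) j (f j)) ⟩
      big n (λ j → big n (λ i → at (π i) j (f j)))
        ≡⟨ big-cong n (λ j j<n → trans (big-single n (ρ j) {λ i → at (π i) j (f j)} (ρ< j j<n)
             (λ i i<n i≢ → at-≢ (f j) (λ e → i≢ (trans (sym (ρπ i i<n)) (cong ρ e)))))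
             (trans (cong (λ t → at t j (f j)) (πρ j j<n)) (at-refl j _))) ⟩
      big n f ∎

    big-reverse : ∀ n (f : ℕ → ℤ) → big n (λ i → f (n ∸ suc i)) ≡ big n f
    big-reverse n f = big-reindex n (λ i → n ∸ suc i) (λ i → n ∸ suc i) r r rr rr f
      where
      r : ∀ i → i < n → n ∸ suc i < n
      r i i<n = ∸-monoʳ-< {o = 0} (s≤s z≤n) i<n
      rr : ∀ i → i < n → n ∸ suc (n ∸ suc i) ≡ i
      rr i i<n = begin
        n ∸ suc (n ∸ suc i) ≡⟨ cong (n ∸_) (sym (+-∸-assoc 1 i<n)) ⟩
        n ∸ (n ∸ i)         ≡⟨ m∸[m∸n]≡n (<⇒≤ i<n) ⟩
        i ∎

-- Congruences between integers.

module Congruences where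

  open import Data.Integer hiding (suc; _/_; _%_)
  open import Data.Integer.Properties
  open import Data.Integer.Divisibility.Signed
  open import Data.Integer.Tactic.RingSolver using (solve-∀)

  infix 4 _≈_[_]
  record _≈_[_] (x y m : ℤ) : Set where
    constructor cong-mod
    field difference : m ∣ x - y
  open _≈_[_] public

  module _ {m : ℤ} where
    ≈-reflexive : ∀ {x y} → x ≡ y → x ≈ y [ m ]
    ≈-reflexive {x} refl = cong-mod (divides 0ℤ (+-inverseʳ x))

    ≈-refl : ∀ {x} → x ≈ x [ m ]
    ≈-refl = ≈-reflexive refl

    ≈-sym : ∀ {x y} → x ≈ y [ m ] → y ≈ x [ m ]
    ≈-sym {x} {y} (cong-mod p) = cong-mod (subst (m ∣_) (e x y) (∣m⇒∣-m p))
      where e : ∀ x y → - (x - y) ≡ y - x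
            e = solve-∀

    ≈-trans : ∀ {x y z} → x ≈ y [ m ] → y ≈ z [ m ] → x ≈ z [ m ]
    ≈-trans {x} {y} {z} (cong-mod p) (cong-mod q) = cong-mod (subst (m ∣_) (e x y z) (∣m∣n⇒∣m+n p q))
      where e : ∀ x y z → (x - y) + (y - z) ≡ x - z
            e = solve-∀

    ≈-+ : ∀ {x y u v} → x ≈ y [ m ] → u ≈ v [ m ] → x + u ≈ y + v [ m ]
    ≈-+ {x} {y} {u} {v} (cong-mod p) (cong-mod q) = cong-mod (subst (m ∣_) (e x y u v) (∣m∣n⇒∣m+n p q))
      where e : ∀ x y u v → (x - y) + (u - v) ≡ (x + u) - (y + v)
            e = solve-∀

    ≈-* : ∀ {x y u v} → x ≈ y [ m ] → u ≈ v [ m ] → x * u ≈ y * v [ m ]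
    ≈-* {x} {y} {u} {v} (cong-mod p) (cong-mod q) =
      cong-mod (subst (m ∣_) (e x y u v) (∣m∣n⇒∣m+n (∣m⇒∣m*n u p) (∣n⇒∣m*n y q)))
      where e : ∀ x y u v → (x - y) * u + y * (u - v) ≡ x * u - y * v
            e = solve-∀

    ≈-*ˡ : ∀ {x y} c → x ≈ y [ m ] → c * x ≈ c * y [ m ]
    ≈-*ˡ c p = ≈-* (≈-refl {c}) p

    ≈-*ʳ : ∀ {x y} c → x ≈ y [ m ] → x * c ≈ y * c [ m ]
    ≈-*ʳ c p = ≈-* p (≈-refl {c})

    ≈-neg : ∀ {x y} → x ≈ y [ m ] → - x ≈ - y [ m ]
    ≈-neg {x} {y} (cong-mod p) = cong-mod (subst (m ∣_) (e x y) (∣m⇒∣-m p))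
      where e : ∀ x y → - (x - y) ≡ - x - - y
            e = solve-∀

    ∣⇒≈0 : ∀ {x} → m ∣ x → x ≈ 0ℤ [ m ]
    ∣⇒≈0 {x} p = cong-mod (subst (m ∣_) (e x) p)
      where e : ∀ x → x ≡ x - 0ℤ
            e = solve-∀

    ≈0⇒∣ : ∀ {x} → x ≈ 0ℤ [ m ] → m ∣ x
    ≈0⇒∣ {x} (cong-mod p) = subst (m ∣_) (e x) p
      where e : ∀ x → x - 0ℤ ≡ x
            e = solve-∀

    ≈-∣ : ∀ {x y} → x ≈ y [ m ] → m ∣ x → m ∣ y
    ≈-∣ p d = ≈0⇒∣ (≈-trans (≈-sym p) (∣⇒≈0 d))

  ∣ℕ⇒∣ : ∀ {m n} → m ℕ.∣ n → + m ∣ + n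
  ∣ℕ⇒∣ = ∣ᵤ⇒∣

  ∣⇒∣ℕ : ∀ {m n} → + m ∣ + n → m ℕ.∣ n
  ∣⇒∣ℕ = ∣⇒∣ᵤ

  small-multiple : ∀ {m x} → + m ∣ x → ∣ x ∣ ℕ.< m → x ≡ 0ℤ
  small-multiple {m} {x} m∣x lt with ∣ x ∣ in eq | ∣⇒∣ᵤ m∣x
  ... | zero  | _ = ∣i∣≡0⇒i≡0 eq
  ... | suc n | d = contradiction (ℕ.∣⇒≤ d) (ℕ.<⇒≱ lt)

  inverse-mod : ∀ a m → Coprime a (suc m) → ∃[ b ] + a * + b ≈ 1ℤ [ + suc m ]
  inverse-mod a m cop with coprime-Bézout cop
  ... | Bézout.+- x y eq = x , cong-mod (divides (+ y) (trans (cong (λ t → t - 1ℤ) e₁) (e₂ (+ y) (+ suc m))))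
    where
    e₁ : + a * + x ≡ 1ℤ + + y * + suc m
    e₁ = trans (sym (pos-* a x)) (trans (cong +_ (trans (ℕ.*-comm a x) (sym eq)))
           (trans (pos-+ 1 (y ℕ.* suc m)) (cong (λ t → 1ℤ + t) (pos-* y (suc m)))))
    e₂ : ∀ y m → (1ℤ + y * m) - 1ℤ ≡ y * m
    e₂ = solve-∀
  -- Here a x ≡ -1. The inverse -x becomes a natural number because m, the predecessor of the
  -- modulus, stands for -1.
  ... | Bézout.-+ x y eq = x ℕ.* m , cong-mod (divides (+ y * + m - 1ℤ)
      (trans (cong (λ t → + a * t - 1ℤ) (pos-* x m)) (trans (e₂ (+ a) (+ x) (+ m))
          (trans (cong (λ t → (t - 1ℤ) * + m - 1ℤ) e₁)
        (e₃ (+ y) (+ m))))))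
    where
    e₁ : 1ℤ + + x * + a ≡ + y * + suc m
    e₁ = trans (sym (trans (pos-+ 1 (x ℕ.* a)) (cong (λ t → 1ℤ + t) (pos-* x a)))) (trans (cong +_ eq)
        (pos-* y (suc m)))
    e₂ : ∀ a x m → a * (x * m) - 1ℤ ≡ ((1ℤ + x * a) - 1ℤ) * m - 1ℤ
    e₂ = solve-∀
    e₃ : ∀ y m → (y * (1ℤ + m) - 1ℤ) * m - 1ℤ ≡ (y * m - 1ℤ) * (1ℤ + m)
    e₃ = solve-∀

  coprime-∣ : ∀ {m n x} → Coprime m n → + m ∣ + n * x → + m ∣ x
  coprime-∣ {m} {n} {x} c d = ∣ᵤ⇒∣ (coprime-divisor c (subst (m ℕ.∣_) (abs-* (+ n) x) (∣⇒∣ᵤ d)))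

-- The Jacobi symbol and its multiplicativity.

module ResidueSymbol where

  open import Data.Integer hiding (suc; _/_; _%_)
  open import Data.Integer.Properties
  open import Data.Integer.Divisibility.Signed
  open import Data.Integer.Tactic.RingSolver using (solve-∀)
  open BigOperators
  open Congruences

  open BigOp _*_ 1ℤ *-1-isCommutativeMonoid public using () renaming
    ( big to ∏; big-cong to ∏-cong; big-ε to ∏-1; big-∙ to ∏-*; big-swap to ∏-swap
    ; big-single to ∏-single; big-reindex to ∏-reindex; big-reverse to ∏-reverse)

  odd : ℕ → ℕ
  odd h = suc (h ℕ.+ h)

  sg : ∀ {P : Set} → Dec P → ℤ
  sg (yes _) = -1ℤ
  sg (no  _) = 1ℤ

  IsSign : ℤ → Set
  IsSign s = s ≡ 1ℤ ⊎ s ≡ -1ℤ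

  sg-isSign : ∀ {P : Set} (d : Dec P) → IsSign (sg d)
  sg-isSign (yes _) = inj₂ refl
  sg-isSign (no  _) = inj₁ refl

  *-isSign : ∀ {s t} → IsSign s → IsSign t → IsSign (s * t)
  *-isSign (inj₁ refl) (inj₁ refl) = inj₁ refl
  *-isSign (inj₁ refl) (inj₂ refl) = inj₂ refl
  *-isSign (inj₂ refl) (inj₁ refl) = inj₂ refl
  *-isSign (inj₂ refl) (inj₂ refl) = inj₁ refl

  sign² : ∀ {s} → IsSign s → s * s ≡ 1ℤ
  sign² (inj₁ refl) = refl
  sign² (inj₂ refl) = refl

  ∏-isSign : ∀ n {f : ℕ → ℤ} → (∀ i → IsSign (f i)) → IsSign (∏ n f)
  ∏-isSign zero    h = inj₁ refl
  ∏-isSign (suc n) h = *-isSign (∏-isSign n h) (h n)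

  -- The residue of x of least absolute value modulo odd h is sgn h x * mag h x.
  sgn : ℕ → ℕ → ℤ
  sgn h x = sg (h ℕ.<? x % odd h)

  mag : ℕ → ℕ → ℕ
  mag h x with h ℕ.<? x % odd h
  ... | yes _ = odd h ∸ x % odd h
  ... | no  _ = x % odd h

  sgn-isSign : ∀ h x → IsSign (sgn h x)
  sgn-isSign h x = sg-isSign (h ℕ.<? x % odd h)

  mag≤ : ∀ h x → mag h x ℕ.≤ h
  mag≤ h x with h ℕ.<? x % odd h
  ... | yes h<r = ℕ.m≤n+o⇒m∸n≤o (odd h) (x % odd h) (ℕ.+-monoˡ-≤ h h<r)
  ... | no ¬h<r = ℕ.≮⇒≥ ¬h<r

  sgn-mag : ∀ h x → + x ≈ sgn h x * + mag h x [ + odd h ]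
  sgn-mag h x with h ℕ.<? x % odd h
  ... | yes _ = cong-mod (divides (+ q + 1ℤ) (trans (cong₂ (λ s t → s - -1ℤ * t) x≡ m-r≡) (e (+ r) (+ q) (+ odd h))))
    where
    r = x % odd h
    q = x / odd h
    x≡ : + x ≡ + r + + q * + odd h
    x≡ = trans (cong +_ (ℕ.m≡m%n+[m/n]*n x (odd h))) (trans (pos-+ r (q ℕ.* odd h)) (cong (λ t → + r + t)
        (pos-* q (odd h))))
    m-r≡ : + (odd h ∸ r) ≡ + odd h - + r
    m-r≡ = sym (trans ([+m]-[+n]≡m⊖n (odd h) r) (⊖-≥ (ℕ.<⇒≤ (ℕ.m%n<n x (odd h)))))
    e : ∀ r q m → (r + q * m) - -1ℤ * (m - r) ≡ (q + 1ℤ) * m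
    e = solve-∀
  ... | no _ = cong-mod (divides (+ q) (trans (cong (λ s → s - 1ℤ * + r) x≡) (e (+ r) (+ q) (+ odd h))))
    where
    r = x % odd h
    q = x / odd h
    x≡ : + x ≡ + r + + q * + odd h
    x≡ = trans (cong +_ (ℕ.m≡m%n+[m/n]*n x (odd h))) (trans (pos-+ r (q ℕ.* odd h)) (cong (λ t → + r + t)
        (pos-* q (odd h))))
    e : ∀ r q m → (r + q * m) - 1ℤ * r ≡ q * m
    e = solve-∀

  -- Both sides are at most h in absolute value, so their difference is a multiple of 2h + 1 of size
  -- at most 2h and vanishes. The bound 1 ≤ t excludes zero, whose sign is ambiguous.
  signed-unique : ∀ h {s s′ t t′} → IsSign s → IsSign s′ → 1 ℕ.≤ t → t ℕ.≤ h → t′ ℕ.≤ h →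
                  s * + t ≈ s′ * + t′ [ + odd h ] → s ≡ s′ × t ≡ t′
  signed-unique h {s} {s′} {t} {t′} ss ss′ 1≤t t≤h t′≤h (cong-mod d) = go ss ss′ st≡
    where
    abs : ∀ {s} → IsSign s → ∀ t → ∣ s * + t ∣ ≡ t
    abs (inj₁ refl) t = cong ∣_∣ (*-identityˡ (+ t))
    abs (inj₂ refl) t = trans (cong ∣_∣ (-1*i≡-i (+ t))) (∣-i∣≡∣i∣ (+ t))
    diff : s * + t - s′ * + t′ ≡ 0ℤ
    diff = small-multiple d (s≤s (ℕ.≤-trans (∣i-j∣≤∣i∣+∣j∣ (s * + t) (s′ * + t′))
             (ℕ.≤-trans (ℕ.≤-reflexive (cong₂ ℕ._+_ (abs ss t) (abs ss′ t′))) (ℕ.+-mono-≤ t≤h t′≤h))))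
    st≡ : s * + t ≡ s′ * + t′
    st≡ = i-j≡0⇒i≡j _ _ diff
    pos≢neg : ∀ {a b} → 1 ℕ.≤ b → + a ≢ -1ℤ * + b
    pos≢neg {a} {suc b} _ ()
    go : IsSign s → IsSign s′ → s * + t ≡ s′ * + t′ → s ≡ s′ × t ≡ t′
    go (inj₁ refl) (inj₁ refl) q = refl , +-injective (trans (sym (*-identityˡ (+ t))) (trans q (*-identityˡ (+ t′))))
    go (inj₁ refl) (inj₂ refl) q = contradiction
      (trans (e (+ t′)) (trans (cong (-1ℤ *_) (sym q)) (cong (-1ℤ *_) (*-identityˡ (+ t))))) (pos≢neg {t′} {t} 1≤t)
      where e : ∀ x → x ≡ -1ℤ * (-1ℤ * x)
            e = solve-∀
    go (inj₂ refl) (inj₁ refl) q = contradiction (trans (sym (*-identityˡ (+ t′))) (sym q)) (pos≢neg {t′} {t} 1≤t)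
    go (inj₂ refl) (inj₂ refl) q = refl ,
      +-injective (neg-injective (trans (sym (-1*i≡-i (+ t))) (trans q (-1*i≡-i (+ t′)))))

  sgn-mag-unique : ∀ h {x s t} → IsSign s → 1 ℕ.≤ t → t ℕ.≤ h → + x ≈ s * + t [ + odd h ] →
                   sgn h x ≡ s × mag h x ≡ t
  sgn-mag-unique h {x} {s} {t} ss 1≤t t≤h p = sym (proj₁ u) , sym (proj₂ u)
    where
    u : s ≡ sgn h x × t ≡ mag h x
    u = signed-unique h ss (sgn-isSign h x) 1≤t t≤h (mag≤ h x) (≈-trans (≈-sym p) (sgn-mag h x))

  -- The Jacobi symbol (a / 2h+1), in the form given to it by the Gauss–Schering lemma.
  J : ℕ → ℕ → ℤ
  J h a = ∏ h (λ j → sgn h (a ℕ.* suc j))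

  J-isSign : ∀ h a → IsSign (J h a)
  J-isSign h a = ∏-isSign h (λ j → sgn-isSign h (a ℕ.* suc j))

  Coprime-* : ∀ {a b m} → Coprime a m → Coprime b m → Coprime (a ℕ.* b) m
  Coprime-* {a} {b} {m} ca cb {d} (d∣ab , d∣m) = cb (coprime-divisor cda d∣ab , d∣m)
    where cda : Coprime d a
          cda (e∣d , e∣a) = ca (e∣a , ℕ.∣-trans e∣d d∣m)

  pred-coprime : ∀ h → Coprime (h ℕ.+ h) (odd h)
  pred-coprime h {d} (d∣2h , d∣1+2h) = ℕ.∣1⇒≡1 (ℕ.∣m+n∣m⇒∣n (subst (d ℕ.∣_) (ℕ.+-comm 1 (h ℕ.+ h)) d∣1+2h) d∣2h)

  mag≥1 : ∀ h a j → Coprime a (odd h) → j ℕ.< h → 1 ℕ.≤ mag h (a ℕ.* suc j)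
  mag≥1 h a j c j<h with mag h (a ℕ.* suc j) in eq
  ... | suc _ = s≤s z≤n
  ... | zero  = contradiction (ℕ.∣⇒≤ (coprime-divisor (Coprimality.sym c) (∣⇒∣ℕ (≈0⇒∣
                  (≈-trans (sgn-mag h (a ℕ.* suc j)) (≈-reflexive (trans (cong (λ t → sgn h (a ℕ.* suc j) * + t) eq)
                      (*-zeroʳ (sgn h (a ℕ.* suc j)))))))) ))
                  (ℕ.<⇒≱ (s≤s (ℕ.≤-trans j<h (ℕ.m≤m+n h h))))

  -- Up to sign, multiplication by a unit a permutes the half system 1, ..., h. Indices start at 0,
  -- hence the shift by one on both sides.
  perm : ℕ → ℕ → ℕ → ℕ
  perm h a j = mag h (a ℕ.* suc j) ∸ 1

  suc-perm : ∀ h a j → Coprime a (odd h) → j ℕ.< h → suc (perm h a j) ≡ mag h (a ℕ.* suc j)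
  suc-perm h a j c j<h = ℕ.m+[n∸m]≡n (mag≥1 h a j c j<h)

  perm< : ∀ h a j → Coprime a (odd h) → j ℕ.< h → perm h a j ℕ.< h
  perm< h a j c j<h = subst (ℕ._≤ h) (sym (suc-perm h a j c j<h)) (mag≤ h (a ℕ.* suc j))

  sgn-perm : ∀ h a j → Coprime a (odd h) → j ℕ.< h →
             + a * + suc j ≈ sgn h (a ℕ.* suc j) * + suc (perm h a j) [ + odd h ]
  sgn-perm h a j c j<h = ≈-trans (≈-reflexive (sym (pos-* a (suc j)))) (≈-trans (sgn-mag h (a ℕ.* suc j))
    (≈-reflexive (cong (λ t → sgn h (a ℕ.* suc j) * + t) (sym (suc-perm h a j c j<h)))))

  perm-inverse : ∀ h a b → Coprime a (odd h) → Coprime b (odd h) → + a * + b ≈ 1ℤ [ + odd h ] →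
                 ∀ j → j ℕ.< h → perm h a (perm h b j) ≡ j
  perm-inverse h a b ca cb ab j j<h = cong (_∸ 1) (proj₂ (sgn-mag-unique h (sgn-isSign h (b ℕ.* suc j)) (s≤s z≤n) j<h
      (≈-trans (≈-reflexive (pos-* a (suc k))) (≈-sym s*≈))))
    where
    k = perm h b j
    s = sgn h (b ℕ.* suc j)
    e₁ : ∀ s x → s * (1ℤ * x) ≡ s * x
    e₁ = solve-∀
    e₂ : ∀ s a b x → s * (a * b * x) ≡ a * (s * (b * x))
    e₂ = solve-∀
    e₃ : ∀ s a x → a * (s * (s * x)) ≡ s * s * (a * x)
    e₃ = solve-∀
    s*≈ : s * + suc j ≈ + a * + suc k [ + odd h ]
    s*≈ = ≈-trans (≈-reflexive (sym (e₁ s (+ suc j))))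
         (≈-trans (≈-*ˡ s (≈-*ʳ (+ suc j) (≈-sym ab)))
         (≈-trans (≈-reflexive (e₂ s (+ a) (+ b) (+ suc j)))
         (≈-trans (≈-*ˡ (+ a) (≈-*ˡ s (sgn-perm h b j cb j<h)))
         (≈-reflexive (trans (e₃ s (+ a) (+ suc k)) (trans (cong (_* (+ a * + suc k))
             (sign² (sgn-isSign h (b ℕ.* suc j)))) (*-identityˡ _)))))))

  inverse-coprime : ∀ {a b h} → + a * + b ≈ 1ℤ [ + odd h ] → Coprime b (odd h)
  inverse-coprime {a} {b} {h} (cong-mod ab) {d} (d∣b , d∣m) = ℕ.∣1⇒≡1 (∣⇒∣ℕ {d} {1}
    (subst (+ d ∣_) (e (+ a * + b)) (∣m∣n⇒∣m-n (∣n⇒∣m*n (+ a) (∣ℕ⇒∣ d∣b)) (∣-trans (∣ℕ⇒∣ d∣m) ab))))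
    where e : ∀ x → x - (x - 1ℤ) ≡ 1ℤ
          e = solve-∀

  ∏-perm : ∀ h a → Coprime a (odd h) → (f : ℕ → ℤ) → ∏ h (λ j → f (perm h a j)) ≡ ∏ h f
  ∏-perm h a ca f =
    ∏-reindex h (perm h a) (perm h b) (λ j → perm< h a j ca) (λ j → perm< h b j cb)
      (perm-inverse h b a cb ca (≈-trans (≈-reflexive (*-comm (+ b) (+ a))) ab)) (perm-inverse h a b ca cb ab) f
    where
    inv = inverse-mod a (h ℕ.+ h) ca
    b = proj₁ inv
    ab = proj₂ inv
    cb : Coprime b (odd h)
    cb = inverse-coprime {a} {b} {h} ab

  -- Reducing b (j+1) first and multiplying the result by a shows that the sign of a b at j is the
  -- sign of b at j times the sign of a at the permuted index. In the product over all j the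
  -- permutation disappears.
  J-* : ∀ h a b → Coprime a (odd h) → Coprime b (odd h) → J h (a ℕ.* b) ≡ J h a * J h b
  J-* h a b ca cb = begin
    J h (a ℕ.* b)
      ≡⟨ ∏-cong h (λ j j<h → proj₁ (sgn-mag-unique h
           (*-isSign (sgn-isSign h (a ℕ.* suc (perm h b j))) (sgn-isSign h (b ℕ.* suc j)))
           (s≤s z≤n) (perm< h a (perm h b j) ca (perm< h b j cb j<h)) (key j j<h))) ⟩
    ∏ h (λ j → sgn h (a ℕ.* suc (perm h b j)) * sgn h (b ℕ.* suc j))
      ≡⟨ ∏-* h (λ j → sgn h (a ℕ.* suc (perm h b j))) (λ j → sgn h (b ℕ.* suc j)) ⟩
    ∏ h (λ j → sgn h (a ℕ.* suc (perm h b j))) * J h b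
      ≡⟨ cong (_* J h b) (∏-perm h b cb (λ j → sgn h (a ℕ.* suc j))) ⟩
    J h a * J h b ∎
    where
    open ≡-Reasoning
    e₁ : ∀ a b x → a * b * x ≡ a * (b * x)
    e₁ = solve-∀
    e₂ : ∀ a s x → a * (s * x) ≡ s * (a * x)
    e₂ = solve-∀
    e₃ : ∀ s t x → s * (t * x) ≡ t * s * x
    e₃ = solve-∀
    key : ∀ j → j ℕ.< h → + (a ℕ.* b ℕ.* suc j) ≈
          sgn h (a ℕ.* suc (perm h b j)) * sgn h (b ℕ.* suc j) * + suc (perm h a (perm h b j)) [ + odd h ]
    key j j<h = ≈-trans (≈-reflexive (trans (pos-* (a ℕ.* b) (suc j)) (trans (cong (_* + suc j) (pos-* a b))
        (e₁ (+ a) (+ b) (+ suc j)))))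
      (≈-trans (≈-*ˡ (+ a) (sgn-perm h b j cb j<h))
      (≈-trans (≈-reflexive (e₂ (+ a) s (+ suc k)))
      (≈-trans (≈-*ˡ s (sgn-perm h a k ca (perm< h b j cb j<h)))
      (≈-reflexive (e₃ s (sgn h (a ℕ.* suc k)) (+ suc (perm h a k)))))))
      where k = perm h b j
            s = sgn h (b ℕ.* suc j)

  J-cong : ∀ h a b → Coprime b (odd h) → + a ≈ + b [ + odd h ] → J h a ≡ J h b
  J-cong h a b cb p = ∏-cong h (λ j j<h → proj₁ (sgn-mag-unique h (sgn-isSign h (b ℕ.* suc j)) (s≤s z≤n)
    (perm< h b j cb j<h) (≈-trans (≈-reflexive (pos-* a (suc j))) (≈-trans (≈-*ʳ (+ suc j) p)
        (sgn-perm h b j cb j<h)))))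

  J-square : ∀ h a → Coprime a (odd h) → J h (a ℕ.* a) ≡ 1ℤ
  J-square h a c = trans (J-* h a a c c) (sign² (J-isSign h a))

-- Quadratic reciprocity by counting lattice points.

module Reciprocity where

  open import Data.Integer hiding (suc; _/_; _%_)
  open import Data.Integer.Properties
  open import Data.Integer.Divisibility.Signed
  open import Data.Integer.Tactic.RingSolver using (solve-∀)
  open Congruences
  open ResidueSymbol

  sg-yes : ∀ {P : Set} (d : Dec P) → P → sg d ≡ -1ℤ
  sg-yes (yes _) p = refl
  sg-yes (no ¬p) p = contradiction p ¬p

  sg-no : ∀ {P : Set} (d : Dec P) → ¬ P → sg d ≡ 1ℤ
  sg-no (yes p) ¬p = contradiction p ¬p
  sg-no (no _)  ¬p = refl

  sg-cong : ∀ {P Q : Set} (d : Dec P) (e : Dec Q) → (P → Q) → (Q → P) → sg d ≡ sg e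
  sg-cong (yes p) e f g = sym (sg-yes e (f p))
  sg-cong (no ¬p) e f g = sym (sg-no e (λ q → ¬p (g q)))

  -- -m < 2(N - m t) < 0
  Near : ℕ → ℕ → ℕ → Set
  Near m N t = N ℕ.< m ℕ.* t × m ℕ.* t ℕ.* 2 ℕ.< N ℕ.* 2 ℕ.+ m

  near? : ∀ m N t → Dec (Near m N t)
  near? m N t = (N ℕ.<? m ℕ.* t) ×-dec (m ℕ.* t ℕ.* 2 ℕ.<? N ℕ.* 2 ℕ.+ m)

  -- 2(N - K) < -m
  Far : ℕ → ℕ → ℕ → Set
  Far m N K = N ℕ.* 2 ℕ.+ m ℕ.< K ℕ.* 2

  far? : ∀ m N K → Dec (Far m N K)
  far? m N K = N ℕ.* 2 ℕ.+ m ℕ.<? K ℕ.* 2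

  module _ (h N : ℕ) where
    private
      m = odd h
      r = N % m
      q = N / m
      N≡ : N ≡ r ℕ.+ q ℕ.* m
      N≡ = ℕ.m≡m%n+[m/n]*n N m
      r<m : r ℕ.< m
      r<m = ℕ.m%n<n N m
      N< : N ℕ.< suc q ℕ.* m
      N< = subst (ℕ._< suc q ℕ.* m) (sym N≡) (ℕ.+-monoˡ-< (q ℕ.* m) r<m)

    near⇒quotient : ∀ t → Near m N t → t ≡ suc (N / odd h)
    near⇒quotient t (N<mt , mt2<) = ℕ.≤-antisym t≤ q<t
      where
      open ℕ.≤-Reasoning
      q<t : q ℕ.< t
      q<t = ℕ.*-cancelʳ-< m q t (begin-strict
        q ℕ.* m           ≤⟨ ℕ.m≤n+m (q ℕ.* m) r ⟩
        r ℕ.+ q ℕ.* m     ≡⟨ N≡ ⟨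
        N                 <⟨ N<mt ⟩
        m ℕ.* t           ≡⟨ ℕ.*-comm m t ⟩
        t ℕ.* m           ∎)
      t≤ : t ℕ.≤ suc q
      t≤ = ℕ.≮⇒≥ (λ 2+q≤t → ℕ.<-irrefl refl (begin-strict
        m ℕ.* t ℕ.* 2                ≡⟨ cong (ℕ._* 2) (ℕ.*-comm m t) ⟩
        t ℕ.* m ℕ.* 2                <⟨ subst (ℕ._< N ℕ.* 2 ℕ.+ m) (cong (ℕ._* 2) (ℕ.*-comm m t)) mt2< ⟩
        N ℕ.* 2 ℕ.+ m                ≤⟨ ℕ.+-mono-≤ (ℕ.*-monoˡ-≤ 2 (ℕ.<⇒≤ N<)) (ℕ.m≤m*n m 2) ⟩
        suc q ℕ.* m ℕ.* 2 ℕ.+ m ℕ.* 2 ≡⟨ e q m ⟩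
        suc (suc q) ℕ.* m ℕ.* 2      ≤⟨ ℕ.*-monoˡ-≤ 2 (ℕ.*-monoˡ-≤ m 2+q≤t) ⟩
        t ℕ.* m ℕ.* 2                ≡⟨ cong (ℕ._* 2) (ℕ.*-comm t m) ⟩
        m ℕ.* t ℕ.* 2                ∎))
        where e : ∀ q m → suc q ℕ.* m ℕ.* 2 ℕ.+ m ℕ.* 2 ≡ suc (suc q) ℕ.* m ℕ.* 2
              e = ℕ.solve-∀

    near⇒large : ∀ t → Near m N t → h ℕ.< N % odd h
    near⇒large t nr@(_ , mt2<) = ℕ.≰⇒> (λ r≤h → ℕ.<-irrefl refl (begin-strict
        m ℕ.* suc q ℕ.* 2                  <⟨ subst (λ z → m ℕ.* z ℕ.* 2 ℕ.< N ℕ.* 2 ℕ.+ m) (near⇒quotient t nr) mt2< ⟩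
        N ℕ.* 2 ℕ.+ m                      ≡⟨ cong (λ z → z ℕ.* 2 ℕ.+ m) N≡ ⟩
        (r ℕ.+ q ℕ.* m) ℕ.* 2 ℕ.+ m        ≤⟨ ℕ.+-monoˡ-≤ m (ℕ.*-monoˡ-≤ 2 (ℕ.+-monoˡ-≤ (q ℕ.* m) r≤h)) ⟩
        (h ℕ.+ q ℕ.* m) ℕ.* 2 ℕ.+ m        ≡⟨ e₁ h (q ℕ.* m) m ⟩
        h ℕ.+ h ℕ.+ (q ℕ.* m ℕ.* 2 ℕ.+ m)  ≤⟨ ℕ.n≤1+n _ ⟩
        m ℕ.+ (q ℕ.* m ℕ.* 2 ℕ.+ m)        ≡⟨ e₂ q m ⟩
        m ℕ.* suc q ℕ.* 2                  ∎))
      where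
      open ℕ.≤-Reasoning
      e₁ : ∀ h x m → (h ℕ.+ x) ℕ.* 2 ℕ.+ m ≡ h ℕ.+ h ℕ.+ (x ℕ.* 2 ℕ.+ m)
      e₁ = ℕ.solve-∀
      e₂ : ∀ q m → m ℕ.+ (q ℕ.* m ℕ.* 2 ℕ.+ m) ≡ m ℕ.* suc q ℕ.* 2
      e₂ = ℕ.solve-∀

    large⇒near : h ℕ.< N % odd h → Near m N (suc (N / odd h))
    large⇒near h<r = subst (N ℕ.<_) (ℕ.*-comm (suc q) m) N< , (begin-strict
        m ℕ.* suc q ℕ.* 2                 ≡⟨ e₂ q m ⟨
        m ℕ.+ (q ℕ.* m ℕ.* 2 ℕ.+ m)       <⟨ ℕ.+-monoˡ-< (q ℕ.* m ℕ.* 2 ℕ.+ m) m<2r ⟩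
        r ℕ.+ r ℕ.+ (q ℕ.* m ℕ.* 2 ℕ.+ m) ≡⟨ e₁ r (q ℕ.* m) m ⟨
        (r ℕ.+ q ℕ.* m) ℕ.* 2 ℕ.+ m       ≡⟨ cong (λ z → z ℕ.* 2 ℕ.+ m) N≡ ⟨
        N ℕ.* 2 ℕ.+ m                     ∎)
      where
      open ℕ.≤-Reasoning
      m<2r : m ℕ.< r ℕ.+ r
      m<2r = ℕ.≤-trans (ℕ.≤-reflexive (cong suc (sym (ℕ.+-suc h h)))) (ℕ.+-mono-≤ h<r h<r)
      e₁ : ∀ h x m → (h ℕ.+ x) ℕ.* 2 ℕ.+ m ≡ h ℕ.+ h ℕ.+ (x ℕ.* 2 ℕ.+ m)
      e₁ = ℕ.solve-∀
      e₂ : ∀ q m → m ℕ.+ (q ℕ.* m ℕ.* 2 ℕ.+ m) ≡ m ℕ.* suc q ℕ.* 2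
      e₂ = ℕ.solve-∀

    quotient-bound : ∀ g → N ℕ.≤ odd g ℕ.* h → h ℕ.< N % odd h → N / odd h ℕ.< g
    quotient-bound g N≤ h<r = ℕ.≰⇒> (λ g≤q → ℕ.<-irrefl refl (begin-strict
        m ℕ.* odd g ℕ.+ m              ≡⟨ e₁ m g ⟩
        m ℕ.* suc g ℕ.* 2              ≤⟨ ℕ.*-monoˡ-≤ 2 (ℕ.*-monoʳ-≤ m (s≤s g≤q)) ⟩
        m ℕ.* suc q ℕ.* 2              <⟨ proj₂ (large⇒near h<r) ⟩
        N ℕ.* 2 ℕ.+ m                  ≤⟨ ℕ.+-monoˡ-≤ m (ℕ.*-monoˡ-≤ 2 N≤) ⟩
        odd g ℕ.* h ℕ.* 2 ℕ.+ m        ≤⟨ ℕ.+-monoˡ-≤ m (ℕ.m≤m+n (odd g ℕ.* h ℕ.* 2) (odd g)) ⟩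
        odd g ℕ.* h ℕ.* 2 ℕ.+ odd g ℕ.+ m ≡⟨ cong (ℕ._+ m) (e₂ h g) ⟩
        m ℕ.* odd g ℕ.+ m              ∎))
      where
      open ℕ.≤-Reasoning
      e₁ : ∀ m g → m ℕ.* suc (g ℕ.+ g) ℕ.+ m ≡ m ℕ.* suc g ℕ.* 2
      e₁ = ℕ.solve-∀
      e₂ : ∀ h g → suc (g ℕ.+ g) ℕ.* h ℕ.* 2 ℕ.+ suc (g ℕ.+ g) ≡ suc (h ℕ.+ h) ℕ.* suc (g ℕ.+ g)
      e₂ = ℕ.solve-∀

    -- The sign is -1 exactly when some multiple m t exceeds N by less than m/2. Such a t is unique,
    -- and the bound on N places it among 1, ..., g, so at most one factor is -1.
    sgn-as-product : ∀ g → N ℕ.≤ odd g ℕ.* h → sgn h N ≡ ∏ g (λ i → sg (near? (odd h) N (suc i)))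
    sgn-as-product g N≤ = go (h ℕ.<? N % odd h)
      where
      go : Dec (h ℕ.< N % odd h) → sgn h N ≡ ∏ g (λ i → sg (near? (odd h) N (suc i)))
      go (yes h<r) = trans (sg-yes (h ℕ.<? N % odd h) h<r) (sym (trans
        (∏-single g q {λ i → sg (near? m N (suc i))} (quotient-bound g N≤ h<r)
          (λ i _ i≢ → sg-no (near? m N (suc i)) (λ nr → i≢ (ℕ.suc-injective (near⇒quotient (suc i) nr)))))
        (sg-yes (near? m N (suc q)) (large⇒near h<r))))
      go (no ¬h<r) = trans (sg-no (h ℕ.<? N % odd h) ¬h<r) (sym
        (∏-1 g (λ i _ → sg-no (near? m N (suc i)) (λ nr → ¬h<r (near⇒large (suc i) nr)))))

  J-grid : ∀ h g → J h (odd g) ≡ ∏ h (λ j → ∏ g (λ i → sg (near? (odd h) (odd g ℕ.* suc j) (suc i))))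
  J-grid h g = ∏-cong h (λ j j<h → sgn-as-product h (odd g ℕ.* suc j) g (ℕ.*-monoʳ-≤ (odd g) j<h))

  *2≢odd : ∀ {x y h} → x ℕ.* 2 ℕ.+ odd h ≢ y ℕ.* 2
  *2≢odd {x} {y} {h} eq = contradiction (trans (sym lhs) (trans (cong (_% 2) eq) (ℕ.m*n%n≡0 y 2))) (λ ())
    where
    e : ∀ x h → x ℕ.* 2 ℕ.+ suc (h ℕ.+ h) ≡ 1 ℕ.+ (x ℕ.+ h) ℕ.* 2
    e = ℕ.solve-∀
    lhs : (x ℕ.* 2 ℕ.+ odd h) % 2 ≡ 1
    lhs = trans (cong (_% 2) (e x h)) (ℕ.[m+kn]%n≡m%n 1 (x ℕ.+ h) 2)

  -- Exactly one of the four conditions holds: x and y are ordered in one way, and the doubled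
  -- distance lies strictly on one side of m or of n, since an even number cannot equal an odd one.
  four-signs : ∀ h g {x y} m s n t → m ≡ odd h → n ≡ odd g → x ≡ n ℕ.* s → y ≡ m ℕ.* t → x ≢ y →
    sg (near? m x t) * sg (near? n y s) * (sg (far? m x y) * sg (far? n y x)) ≡ -1ℤ
  four-signs h g {x} {y} m s n t refl refl refl refl x≢y with ℕ.<-cmp x y
  ... | tri≈ _ x≡y _ = contradiction x≡y x≢y
  ... | tri< x<y _ ¬y<x with ℕ.<-cmp (y ℕ.* 2) (x ℕ.* 2 ℕ.+ m)
  ...   | tri≈ _ eq _ = contradiction (sym eq) (*2≢odd {x} {y} {h})
  ...   | tri< lt _ ¬gt = cong₂ _*_ (cong₂ _*_ (sg-yes (near? m x t) (x<y , lt)) (sg-no (near? n y s) (λ p → ¬y<x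
        (proj₁ p))))
          (cong₂ _*_ (sg-no (far? m x y) ¬gt)
                     (sg-no (far? n y x) (λ p → ¬y<x (ℕ.*-cancelʳ-< 2 y x (ℕ.≤-<-trans (ℕ.m≤m+n _ n) p)))))
  ...   | tri> ¬lt _ gt = cong₂ _*_ (cong₂ _*_ (sg-no (near? m x t) (λ p → ¬lt (proj₂ p))) (sg-no (near? n y s)
        (λ p → ¬y<x (proj₁ p))))
          (cong₂ _*_ (sg-yes (far? m x y) gt)
                     (sg-no (far? n y x) (λ p → ¬y<x (ℕ.*-cancelʳ-< 2 y x (ℕ.≤-<-trans (ℕ.m≤m+n _ n) p)))))
  four-signs h g {x} {y} m s n t refl refl refl refl x≢y | tri> ¬x<y _ y<x with ℕ.<-cmp (x ℕ.* 2) (y ℕ.* 2 ℕ.+ n)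
  ...   | tri≈ _ eq _ = contradiction (sym eq) (*2≢odd {y} {x} {g})
  ...   | tri< lt _ ¬gt = cong₂ _*_ (cong₂ _*_ (sg-no (near? m x t) (λ p → ¬x<y (proj₁ p))) (sg-yes (near? n y s)
        (y<x , lt)))
          (cong₂ _*_ (sg-no (far? m x y) (λ p → ¬x<y (ℕ.*-cancelʳ-< 2 x y (ℕ.≤-<-trans (ℕ.m≤m+n _ m) p))))
                     (sg-no (far? n y x) ¬gt))
  ...   | tri> ¬lt _ gt = cong₂ _*_ (cong₂ _*_ (sg-no (near? m x t) (λ p → ¬x<y (proj₁ p))) (sg-no (near? n y s)
        (λ p → ¬lt (proj₂ p))))
          (cong₂ _*_ (sg-no (far? m x y) (λ p → ¬x<y (ℕ.*-cancelʳ-< 2 x y (ℕ.≤-<-trans (ℕ.m≤m+n _ m) p))))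
                     (sg-yes (far? n y x) gt))

  reflect-< : ∀ {a a′ b b′ m n K} → a ℕ.+ a′ ≡ K ℕ.+ n → b ℕ.+ b′ ≡ K ℕ.+ m → a ℕ.+ m ℕ.< b → b′ ℕ.+ n ℕ.< a′
  reflect-< {a} {a′} {b} {b′} {m} {n} {K} ea eb lt = ℕ.+-cancelʳ-< b (b′ ℕ.+ n) a′ (begin-strict
      b′ ℕ.+ n ℕ.+ b     ≡⟨ e₁ b′ n b ⟩
      b ℕ.+ b′ ℕ.+ n     ≡⟨ cong (ℕ._+ n) eb ⟩
      K ℕ.+ m ℕ.+ n      ≡⟨ e₂ K m n ⟩
      K ℕ.+ n ℕ.+ m      ≡⟨ cong (ℕ._+ m) ea ⟨
      a ℕ.+ a′ ℕ.+ m     ≡⟨ e₃ a a′ m ⟩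
      a′ ℕ.+ (a ℕ.+ m)   <⟨ ℕ.+-monoʳ-< a′ lt ⟩
      a′ ℕ.+ b           ∎)
    where
    open ℕ.≤-Reasoning
    e₁ : ∀ x y z → x ℕ.+ y ℕ.+ z ≡ z ℕ.+ x ℕ.+ y
    e₁ = ℕ.solve-∀
    e₂ : ∀ x y z → x ℕ.+ y ℕ.+ z ≡ x ℕ.+ z ℕ.+ y
    e₂ = ℕ.solve-∀
    e₃ : ∀ x y z → x ℕ.+ y ℕ.+ z ≡ y ℕ.+ (x ℕ.+ z)
    e₃ = ℕ.solve-∀

  reverse-sum : ∀ h j → j ℕ.< h → suc j ℕ.+ suc (h ∸ suc j) ≡ suc h
  reverse-sum h j j<h = trans (ℕ.+-suc (suc j) (h ∸ suc j)) (cong suc (ℕ.m+[n∸m]≡n j<h))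

  doubled-sum : ∀ h g s s′ → s ℕ.+ s′ ≡ suc h →
                odd g ℕ.* s ℕ.* 2 ℕ.+ odd g ℕ.* s′ ℕ.* 2 ≡ odd h ℕ.* odd g ℕ.+ odd g
  doubled-sum h g s s′ eq = trans (e₁ (odd g) s s′) (trans (cong (λ z → odd g ℕ.* z ℕ.* 2) eq) (e₂ (odd g) h))
    where
    e₁ : ∀ n s t → n ℕ.* s ℕ.* 2 ℕ.+ n ℕ.* t ℕ.* 2 ≡ n ℕ.* (s ℕ.+ t) ℕ.* 2
    e₁ = ℕ.solve-∀
    e₂ : ∀ n h → n ℕ.* suc h ℕ.* 2 ≡ suc (h ℕ.+ h) ℕ.* n ℕ.+ n
    e₂ = ℕ.solve-∀

  -- The central reflection (s, t) ↦ (h + 1 - s, g + 1 - t) takes 2ns to mn + n - 2ns and 2mt to mn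
  -- + m - 2mt, where m = 2h + 1 and n = 2g + 1. It thereby interchanges the two far regions.
  far-reflect : ∀ h g s s′ t t′ → s ℕ.+ s′ ≡ suc h → t ℕ.+ t′ ≡ suc g →
                Far (odd h) (odd g ℕ.* s) (odd h ℕ.* t) → Far (odd g) (odd h ℕ.* t′) (odd g ℕ.* s′)
  far-reflect h g s s′ t t′ es et = reflect-< {a = odd g ℕ.* s ℕ.* 2} {odd g ℕ.* s′ ℕ.* 2} {odd h ℕ.* t ℕ.* 2}
      {odd h ℕ.* t′ ℕ.* 2}
    {odd h} {odd g} {odd h ℕ.* odd g} (doubled-sum h g s s′ es)
    (trans (doubled-sum g h t t′ et) (cong (ℕ._+ odd h) (ℕ.*-comm (odd g) (odd h))))

  far-product : ∀ h g →
    ∏ h (λ j → ∏ g (λ i → sg (far? (odd h) (odd g ℕ.* suc j) (odd h ℕ.* suc i)))) ≡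
    ∏ h (λ j → ∏ g (λ i → sg (far? (odd g) (odd h ℕ.* suc i) (odd g ℕ.* suc j))))
  far-product h g = trans (∏-cong h (λ j j<h → trans (∏-cong g (λ i i<g →
        sg-cong (far? (odd h) (odd g ℕ.* suc j) (odd h ℕ.* suc i)) _
          (far-reflect h g (suc j) (suc (h ∸ suc j)) (suc i) (suc (g ∸ suc i)) (reverse-sum h j j<h)
              (reverse-sum g i i<g))
          (far-reflect g h (suc (g ∸ suc i)) (suc i) (suc (h ∸ suc j)) (suc j) (trans (ℕ.+-comm (suc (g ∸ suc i))
              (suc i)) (reverse-sum g i i<g))
                           (trans (ℕ.+-comm (suc (h ∸ suc j)) (suc j)) (reverse-sum h j j<h)))))
      (∏-reverse g (λ i → sg (far? (odd g) (odd h ℕ.* suc i) (odd g ℕ.* suc (h ∸ suc j)))))))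
    (∏-reverse h (λ j → ∏ g (λ i → sg (far? (odd g) (odd h ℕ.* suc i) (odd g ℕ.* suc j)))))

  -- Each symbol is the product of its near signs over the rectangle. The far signs may be
  -- multiplied in, because the two far regions are mirror images of each other and their products
  -- cancel. Then every lattice point contributes -1; coprimality is what excludes points with n s =
  -- m t.
  reciprocity : ∀ h g → Coprime (odd h) (odd g) → J h (odd g) * J g (odd h) ≡ ∏ h (λ _ → ∏ g (λ _ → -1ℤ))
  reciprocity h g cop = begin
    J h (odd g) * J g (odd h)
      ≡⟨ cong₂ _*_ (J-grid h g) (trans (J-grid g h) (∏-swap g h _)) ⟩
    A * B
      ≡⟨ trans (sym (*-identityʳ (A * B))) (cong (A * B *_) (sym (trans (cong (_* E) (far-product h g))
          (sign² E-isSign)))) ⟩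
    A * B * (C * E)
      ≡⟨ cong₂ _*_ (sym (∏-∏-* a b)) (sym (∏-∏-* c e)) ⟩
    ∏ h (λ j → ∏ g (λ i → a j i * b j i)) * ∏ h (λ j → ∏ g (λ i → c j i * e j i))
      ≡⟨ sym (∏-∏-* (λ j i → a j i * b j i) (λ j i → c j i * e j i)) ⟩
    ∏ h (λ j → ∏ g (λ i → a j i * b j i * (c j i * e j i)))
      ≡⟨ ∏-cong h (λ j j<h → ∏-cong g (λ i _ →
           four-signs h g (odd h) (suc j) (odd g) (suc i) refl refl refl refl (λ eq → x≢y j i j<h eq))) ⟩
    ∏ h (λ _ → ∏ g (λ _ → -1ℤ)) ∎
    where
    open ≡-Reasoning
    a b c e : ℕ → ℕ → ℤ
    a j i = sg (near? (odd h) (odd g ℕ.* suc j) (suc i))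
    b j i = sg (near? (odd g) (odd h ℕ.* suc i) (suc j))
    c j i = sg (far? (odd h) (odd g ℕ.* suc j) (odd h ℕ.* suc i))
    e j i = sg (far? (odd g) (odd h ℕ.* suc i) (odd g ℕ.* suc j))
    A = ∏ h (λ j → ∏ g (λ i → a j i))
    B = ∏ h (λ j → ∏ g (λ i → b j i))
    C = ∏ h (λ j → ∏ g (λ i → c j i))
    E = ∏ h (λ j → ∏ g (λ i → e j i))
    E-isSign : IsSign E
    E-isSign = ∏-isSign h (λ j → ∏-isSign g (λ i → sg-isSign (far? (odd g) (odd h ℕ.* suc i) (odd g ℕ.* suc j))))
    ∏-∏-* : ∀ (f k : ℕ → ℕ → ℤ) → ∏ h (λ j → ∏ g (λ i → f j i * k j i)) ≡ ∏ h (λ j → ∏ g (f j)) * ∏ h (λ j → ∏ g (k j))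
    ∏-∏-* f k = trans (∏-cong h (λ j _ → ∏-* g (f j) (k j))) (∏-* h (λ j → ∏ g (f j)) (λ j → ∏ g (k j)))
    x≢y : ∀ j i → j ℕ.< h → odd g ℕ.* suc j ≢ odd h ℕ.* suc i
    x≢y j i j<h eq = ℕ.<⇒≱ (s≤s (ℕ.≤-trans j<h (ℕ.m≤m+n h h)))
      (ℕ.∣⇒≤ (coprime-divisor cop (ℕ.divides (suc i) (trans eq (ℕ.*-comm (odd h) (suc i))))))

  J-minus-one : ∀ h → J h (h ℕ.+ h) ≡ ∏ h (λ _ → -1ℤ)
  J-minus-one h = ∏-cong h (λ j j<h → proj₁ (sgn-mag-unique h (inj₂ refl) (s≤s z≤n) j<h
    (cong-mod (divides (+ suc j) (trans (cong (λ z → z - -1ℤ * + suc j) (pos-* (h ℕ.+ h) (suc j))) (e (+ (h ℕ.+ h))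
        (+ suc j)))))))
    where e : ∀ x y → x * y - -1ℤ * y ≡ y * (1ℤ + x)
          e = solve-∀

  ∏-odd : ∀ k {s} → IsSign s → ∏ (odd k) (λ _ → s) ≡ s
  ∏-odd zero    {s} ss = *-identityˡ s
  ∏-odd (suc k) {s} ss = trans (cong (λ z → ∏ z (λ _ → s) * s * s) (ℕ.+-suc k k))
    (trans (*-assoc (∏ (odd k) (λ _ → s)) s s) (trans (cong (∏ (odd k) (λ _ → s) *_) (sign² ss)) (trans (*-identityʳ _)
        (∏-odd k ss))))

  -- (-M / d) = (d / M) for M ≡ 3 mod 4.
  J-negated : ∀ k g → Coprime (odd (odd k)) (odd g) → J g ((g ℕ.+ g) ℕ.* odd (odd k)) ≡ J (odd k) (odd g)
  J-negated k g cop = begin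
    J g ((g ℕ.+ g) ℕ.* odd (odd k))    ≡⟨ J-* g (g ℕ.+ g) (odd (odd k)) (pred-coprime g) cop ⟩
    J g (g ℕ.+ g) * JM                 ≡⟨ cong (_* JM) (J-minus-one g) ⟩
    ∏ g (λ _ → -1ℤ) * JM               ≡⟨ cong (_* JM) (sym (trans (reciprocity (odd k) g cop)
        (∏-odd k (∏-isSign g (λ _ → inj₂ refl))))) ⟩
    J (odd k) (odd g) * JM * JM        ≡⟨ *-assoc (J (odd k) (odd g)) JM JM ⟩
    J (odd k) (odd g) * (JM * JM)      ≡⟨ cong (J (odd k) (odd g) *_) (sign² (J-isSign g (odd (odd k)))) ⟩
    J (odd k) (odd g) * 1ℤ             ≡⟨ *-identityʳ _ ⟩
    J (odd k) (odd g)                  ∎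
    where
    open ≡-Reasoning
    JM = J g (odd (odd k))

-- Square roots modulo a prime from the value of the symbol.

module EulerCriterion where

  open import Data.Integer hiding (suc; _/_; _%_)
  open import Data.Integer.Properties
  open import Data.Integer.Divisibility.Signed
  open import Data.Integer.Tactic.RingSolver using (solve-∀)
  open Congruences
  open ResidueSymbol

  euclid : ∀ {p} → Prime p → ∀ x y → + p ∣ x * y → (+ p ∣ x) ⊎ (+ p ∣ y)
  euclid {p} pr x y d with euclidsLemma ∣ x ∣ ∣ y ∣ pr (subst (p ℕ.∣_) (abs-* x y) (∣⇒∣ᵤ d))
  ... | inj₁ q = inj₁ (∣ᵤ⇒∣ q)
  ... | inj₂ q = inj₂ (∣ᵤ⇒∣ q)

  prime∤1 : ∀ {p} → Prime p → ¬ (+ p ∣ 1ℤ)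
  prime∤1 {p} pr d = ¬prime[1] (subst Prime (ℕ.∣1⇒≡1 (∣⇒∣ℕ {p} {1} d)) pr)

  -- With the leading coefficient kept apart, the length of the vector is the degree, and division
  -- by a linear factor X - r leaves the leading coefficient unchanged.
  horner : ∀ {n} → ℤ → Vec ℤ n → ℤ → ℤ
  horner a []       x = a
  horner a (c ∷ cs) x = horner (a * x + c) cs x

  quotient-coeffs : ∀ {n} → ℤ → Vec ℤ n → ℤ → Vec ℤ n
  quotient-coeffs v []       r = []
  quotient-coeffs v (c ∷ cs) r = v ∷ quotient-coeffs (v * r + c) cs r

  -- Synthetic division, generalised over the accumulators u and v so that the induction along the
  -- coefficients goes through.
  horner-difference : ∀ {n} (cs : Vec ℤ n) u v w x r → u - v ≡ (x - r) * w →
    horner u cs x - horner v cs r ≡ (x - r) * horner w (quotient-coeffs v cs r) x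
  horner-difference []       u v w x r eq = eq
  horner-difference (c ∷ cs) u v w x r eq = horner-difference cs (u * x + c) (v * r + c) (w * x + v) x r
    (trans (e₁ u v x r c) (trans (cong (λ t → t * x + (x - r) * v) eq) (e₂ v w x r)))
    where
    e₁ : ∀ u v x r c → (u * x + c) - (v * r + c) ≡ (u - v) * x + (x - r) * v
    e₁ = solve-∀
    e₂ : ∀ v w x r → (x - r) * w * x + (x - r) * v ≡ (x - r) * (w * x + v)
    e₂ = solve-∀

  factor-root : ∀ {n} (cs : Vec ℤ (suc n)) a r → ∃[ ds ] (∀ x → horner a cs x - horner a cs r ≡ (x - r) * horner {n} a
      ds x)
  factor-root (c ∷ cs) a r = quotient-coeffs (a * r + c) cs r ,
    λ x → trans (horner-difference (c ∷ cs) a a 0ℤ x r (e a (x - r)))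
      (cong (λ t → (x - r) * horner t (quotient-coeffs (a * r + c) cs r) x) (e′ x a))
    where
    e : ∀ a y → a - a ≡ y * 0ℤ
    e = solve-∀
    e′ : ∀ x a → 0ℤ * x + a ≡ a
    e′ = solve-∀

  too-many-roots : ∀ {p} → Prime p → ∀ n a (cs : Vec ℤ n) (ρ : ℕ → ℤ) →
    (∀ i → i ℕ.≤ n → + p ∣ horner a cs (ρ i)) →
    (∀ i j → i ℕ.< j → j ℕ.≤ n → ¬ (+ p ∣ ρ i - ρ j)) → + p ∣ a
  too-many-roots pr zero    a []  ρ roots distinct = roots 0 z≤n
  too-many-roots {p} pr (suc n) a cs ρ roots distinct =
    too-many-roots pr n a ds ρ roots′ (λ i j i<j j≤n → distinct i j i<j (ℕ.m≤n⇒m≤1+n j≤n))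
    where
    r = ρ (suc n)
    ds = proj₁ (factor-root cs a r)
    factor = proj₂ (factor-root cs a r)
    roots′ : ∀ i → i ℕ.≤ n → + p ∣ horner a ds (ρ i)
    roots′ i i≤n = [ (λ d → contradiction d (distinct i (suc n) (s≤s i≤n) ℕ.≤-refl)) , (λ d → d) ]′
      (euclid pr (ρ i - r) (horner a ds (ρ i))
        (subst (+ p ∣_) (factor (ρ i)) (∣m∣n⇒∣m-n (roots i (ℕ.m≤n⇒m≤1+n i≤n)) (roots (suc n) ℕ.≤-refl))))

  pow-minus-one : ∀ k → Vec ℤ (suc k)
  pow-minus-one zero    = -1ℤ ∷ []
  pow-minus-one (suc k) = 0ℤ ∷ pow-minus-one k

  horner-pow : ∀ k a x → horner a (pow-minus-one k) x ≡ a * ∏ (suc k) (λ _ → x) - 1ℤ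
  horner-pow zero    a x = e a x
    where e : ∀ a x → a * x + -1ℤ ≡ a * (1ℤ * x) - 1ℤ
          e = solve-∀
  horner-pow (suc k) a x = trans (horner-pow k (a * x + 0ℤ) x) (e a x (∏ (suc k) (λ _ → x)))
    where e : ∀ a x y → (a * x + 0ℤ) * y - 1ℤ ≡ a * (y * x) - 1ℤ
          e = solve-∀

  ∏-≈ : ∀ {m} n {f g : ℕ → ℤ} → (∀ i → i ℕ.< n → f i ≈ g i [ m ]) → ∏ n f ≈ ∏ n g [ m ]
  ∏-≈ zero    h = ≈-refl
  ∏-≈ (suc n) h = ≈-* (∏-≈ n (λ i i<n → h i (ℕ.m<n⇒m<1+n i<n))) (h n ℕ.≤-refl)

  module _ (h : ℕ) (pr : Prime (odd h)) where

    below-coprime : ∀ {s} → 1 ℕ.≤ s → s ℕ.≤ h → Coprime s (odd h)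
    below-coprime {suc s} _ s≤h = Coprimality.sym (prime⇒coprime pr (s≤s (ℕ.≤-trans s≤h (ℕ.m≤m+n h h))))

    p∤factorial : ∀ n → n ℕ.≤ h → ¬ (+ odd h ∣ ∏ n (λ j → + suc j))
    p∤factorial zero    _   d = prime∤1 pr d
    p∤factorial (suc n) n<h d with euclid pr (∏ n (λ j → + suc j)) (+ suc n) d
    ... | inj₁ q = p∤factorial n (ℕ.<⇒≤ n<h) q
    ... | inj₂ q = ℕ.<⇒≱ (s≤s (ℕ.≤-trans n<h (ℕ.m≤m+n h h))) (ℕ.∣⇒≤ (∣⇒∣ℕ q))

    -- Multiplying a into each member of the half system produces h! again, up to the signs in
    -- `J h a`. Since h! is prime to p, it can be cancelled.
    gauss : ∀ a → Coprime a (odd h) → ∏ h (λ _ → + a) ≈ J h a [ + odd h ]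
    gauss a ca = cong-mod ([ (λ q → contradiction q (p∤factorial h ℕ.≤-refl)) , (λ q → q) ]′
      (euclid pr F (∏ h (λ _ → + a) - J h a) (subst (+ odd h ∣_) (e (∏ h (λ _ → + a)) (J h a) F) (difference key))))
      where
      F = ∏ h (λ j → + suc j)
      e : ∀ x y f → x * f - y * f ≡ f * (x - y)
      e = solve-∀
      key : ∏ h (λ _ → + a) * F ≈ J h a * F [ + odd h ]
      key = ≈-trans (≈-reflexive (sym (∏-* h (λ _ → + a) (λ j → + suc j))))
           (≈-trans (∏-≈ h (λ j j<h → sgn-perm h a j ca j<h))
           (≈-reflexive (trans (∏-* h (λ j → sgn h (a ℕ.* suc j)) (λ j → + suc (perm h a j)))
             (cong (J h a *_) (∏-perm h a ca (λ j → + suc j))))))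

    -- If a were not a square, then 1², ..., h² and a would be h + 1 incongruent roots of X^h - 1.
    -- In the list `ρ` of these roots the last index stands for a.
    residue : ∀ a → Coprime a (odd h) → J h a ≡ 1ℤ → ∃[ r ] + r * + r ≈ + a [ + odd h ]
    residue a ca Ja≡1 with ℕ.anyUpTo? (λ i → + odd h ∣? + suc i * + suc i - + a) h
    ... | yes (i , _ , d) = suc i , cong-mod d
    ... | no none = contradiction (go h refl) (prime∤1 pr)
      where
      ρ : ℕ → ℤ
      ρ i with i ℕ.<? h
      ... | yes _ = + suc i * + suc i
      ... | no  _ = + a
      ρ< : ∀ {i} → i ℕ.< h → ρ i ≡ + suc i * + suc i
      ρ< {i} lt with i ℕ.<? h
      ... | yes _ = refl
      ... | no ¬lt = contradiction lt ¬lt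
      root : ∀ b → Coprime b (odd h) → J h b ≡ 1ℤ → ∏ h (λ _ → + b) ≈ 1ℤ [ + odd h ]
      root b cb Jb = ≈-trans (gauss b cb) (≈-reflexive Jb)
      ρ-root : ∀ i → ∏ h (λ _ → ρ i) ≈ 1ℤ [ + odd h ]
      ρ-root i with i ℕ.<? h
      ... | no  _  = root a ca Ja≡1
      ... | yes lt = ≈-trans (≈-reflexive (∏-cong h (λ _ _ → sym (pos-* (suc i) (suc i)))))
                       (root (suc i ℕ.* suc i) (Coprime-* {suc i} {suc i} c c) (J-square h (suc i) c))
        where c = below-coprime (s≤s z≤n) lt
      distinct : ∀ i j → i ℕ.< j → j ℕ.≤ h → ¬ (+ odd h ∣ ρ i - ρ j)
      distinct i j i<j j≤h d with j ℕ.<? h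
      ... | no ¬j<h = none (i , i<h , subst (λ t → + odd h ∣ t - + a) (ρ< i<h) d)
        where i<h = ℕ.<-≤-trans i<j j≤h
      ... | yes j<h = [ no₁ , no₂ ]′ (euclid pr (+ suc j - + suc i) (+ suc j + + suc i)
                        (subst (+ odd h ∣_) (trans (cong (λ t → - (t - + suc j * + suc j)) (ρ< i<h)) (e (+ suc i)
                            (+ suc j))) (∣m⇒∣-m d)))
        where
        i<h = ℕ.<-trans i<j j<h
        e : ∀ x y → - (x * x - y * y) ≡ (y - x) * (y + x)
        e = solve-∀
        no₂ : ¬ (+ odd h ∣ + suc j + + suc i)
        no₂ q = ℕ.<⇒≱ (s≤s (ℕ.+-mono-≤ j<h i<h)) (ℕ.∣⇒≤ (∣⇒∣ℕ {odd h} {suc j ℕ.+ suc i} q))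
        no₁ : ¬ (+ odd h ∣ + suc j - + suc i)
        no₁ q = ℕ.<⇒≢ i<j (ℕ.suc-injective (+-injective (sym (i-j≡0⇒i≡j (+ suc j) (+ suc i) (small-multiple q small)))))
          where
          small : ∣ + suc j - + suc i ∣ ℕ.< odd h
          small = s≤s (ℕ.≤-trans (ℕ.≤-reflexive (trans (cong ∣_∣ ([+m]-[+n]≡m⊖n (suc j) (suc i)))
              (cong ∣_∣ (⊖-≥ (ℕ.<⇒≤ (s≤s i<j))))))
            (ℕ.≤-trans (ℕ.m∸n≤m (suc j) (suc i)) (ℕ.≤-trans j<h (ℕ.m≤m+n h h))))
      go : ∀ k → k ≡ h → + odd h ∣ 1ℤ
      go zero    eq = contradiction (subst (λ t → Prime (odd t)) (sym eq) pr) ¬prime[1]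
      go (suc k) eq = too-many-roots pr (suc k) 1ℤ (pow-minus-one k) ρ
        (λ i _ → subst (+ odd h ∣_) (sym (trans (horner-pow k 1ℤ (ρ i))
          (trans (cong (λ t → 1ℤ * ∏ t (λ _ → ρ i) - 1ℤ) eq) (cong (_- 1ℤ) (*-identityˡ (∏ h (λ _ → ρ i)))))))
              (difference (ρ-root i)))
        (λ i j i<j j≤ → distinct i j i<j (subst (j ℕ.≤_) eq j≤))

-- Sums of integers and of indicator functions.

module FiniteSums where

  open import Data.Integer hiding (suc; _/_; _%_)
  open import Data.Integer.Properties
  open import Data.Integer.Tactic.RingSolver using (solve-∀)
  open BigOperators

  open BigOp _+_ 0ℤ +-0-isCommutativeMonoid public using () renaming
    ( big to ∑; big-cong to ∑-cong; big-ε to ∑-0; big-∙ to ∑-+; big-swap to ∑-swap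
    ; big-split to ∑-split; big-single to ∑-single)

  ι : ∀ {P : Set} → Dec P → ℤ
  ι (yes _) = 1ℤ
  ι (no  _) = 0ℤ

  ι-yes : ∀ {P : Set} (d : Dec P) → P → ι d ≡ 1ℤ
  ι-yes (yes _) p = refl
  ι-yes (no ¬p) p = contradiction p ¬p

  ι-no : ∀ {P : Set} (d : Dec P) → ¬ P → ι d ≡ 0ℤ
  ι-no (yes p) ¬p = contradiction p ¬p
  ι-no (no _)  ¬p = refl

  ι-cong : ∀ {P Q : Set} (d : Dec P) (e : Dec Q) → (P → Q) → (Q → P) → ι d ≡ ι e
  ι-cong (yes p) e f g = sym (ι-yes e (f p))
  ι-cong (no ¬p) e f g = sym (ι-no e (λ q → ¬p (g q)))

  ι≥0 : ∀ {P : Set} (d : Dec P) → 0ℤ ≤ ι d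
  ι≥0 (yes _) = +≤+ z≤n
  ι≥0 (no _)  = ≤-refl

  ∑-*ˡ : ∀ n c (f : ℕ → ℤ) → c * ∑ n f ≡ ∑ n (λ i → c * f i)
  ∑-*ˡ zero    c f = *-zeroʳ c
  ∑-*ˡ (suc n) c f = trans (*-distribˡ-+ c (∑ n f) (f n)) (cong (_+ c * f n) (∑-*ˡ n c f))

  ∑-mono : ∀ n {f g : ℕ → ℤ} → (∀ i → i ℕ.< n → f i ≤ g i) → ∑ n f ≤ ∑ n g
  ∑-mono zero    h = ≤-refl
  ∑-mono (suc n) h = +-mono-≤ (∑-mono n (λ i i<n → h i (ℕ.m<n⇒m<1+n i<n))) (h n ℕ.≤-refl)

  ∑≥0 : ∀ n {f : ℕ → ℤ} → (∀ i → i ℕ.< n → 0ℤ ≤ f i) → 0ℤ ≤ ∑ n f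
  ∑≥0 n {f} h = subst (_≤ ∑ n f) (∑-0 n (λ _ _ → refl)) (∑-mono n h)

  ∑-const : ∀ n c → ∑ n (λ _ → c) ≡ + n * c
  ∑-const zero    c = sym (*-zeroˡ c)
  ∑-const (suc n) c = trans (cong (_+ c) (∑-const n c)) (e (+ n) c)
    where e : ∀ n c → n * c + c ≡ (1ℤ + n) * c
          e = solve-∀

  ∑-positive : ∀ n {f : ℕ → ℤ} → 0ℤ < ∑ n f → ∃[ i ] i ℕ.< n × 0ℤ < f i
  ∑-positive zero    (+<+ ())
  ∑-positive (suc n) {f} pos with 0ℤ <? f n
  ... | yes fn>0 = n , ℕ.≤-refl , fn>0
  ... | no ¬fn>0 with i , i<n , fi>0 ← ∑-positive n {f} (<-≤-trans pos (≤-trans (+-monoʳ-≤ (∑ n f) (≮⇒≥ ¬fn>0))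
        (≤-reflexive (+-identityʳ _))))
    = i , ℕ.m<n⇒m<1+n i<n , fi>0

  ∑-ι-unique : ∀ n {P : ℕ → Set} (P? : ∀ i → Dec (P i)) → (∀ i j → i ℕ.< n → j ℕ.< n → P i → P j → i ≡ j) →
               ∑ n (λ i → ι (P? i)) ≤ 1ℤ
  ∑-ι-unique zero    P? uniq = +≤+ z≤n
  ∑-ι-unique (suc n) P? uniq with P? n
  ... | no _  = ≤-trans (≤-reflexive (+-identityʳ _)) (∑-ι-unique n P? (λ i j i<n j<n → uniq i j (ℕ.m<n⇒m<1+n i<n)
        (ℕ.m<n⇒m<1+n j<n)))
  ... | yes p = ≤-reflexive (cong (_+ 1ℤ) (∑-0 n (λ i i<n → ι-no (P? i) (λ q →
                  ℕ.<⇒≢ i<n (uniq i n (ℕ.m<n⇒m<1+n i<n) ℕ.≤-refl q p)))))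

  ∑-ι-none : ∀ n {P : ℕ → Set} (P? : ∀ i → Dec (P i)) → ∑ n (λ i → ι (P? i)) ≢ 0ℤ → ∃[ i ] i ℕ.< n × P i
  ∑-ι-none zero    P? ne = contradiction refl ne
  ∑-ι-none (suc n) P? ne with P? n
  ... | yes p = n , ℕ.≤-refl , p
  ... | no _  with i , i<n , p ← ∑-ι-none n P? (λ eq → ne (trans (+-identityʳ _) eq)) = i , ℕ.m<n⇒m<1+n i<n , p

  ∑-prefix : ∀ {m n} → m ℕ.≤ n → (f : ℕ → ℤ) → (∀ i → m ℕ.≤ i → i ℕ.< n → f i ≡ 0ℤ) → ∑ n f ≡ ∑ m f
  ∑-prefix {m} {n} m≤n f zeros = begin
    ∑ n f                                            ≡⟨ cong (λ z → ∑ z f) (sym (ℕ.m+[n∸m]≡n m≤n)) ⟩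
    ∑ (m ℕ.+ (n ℕ.∸ m)) f                            ≡⟨ ∑-split m (n ℕ.∸ m) f ⟩
    ∑ m f + ∑ (n ℕ.∸ m) (λ i → f (m ℕ.+ i))          ≡⟨ cong (λ z → ∑ m f + z) (∑-0 (n ℕ.∸ m) (λ i i< →
          zeros (m ℕ.+ i) (ℕ.m≤m+n m i) (subst (m ℕ.+ i ℕ.<_) (ℕ.m+[n∸m]≡n m≤n) (ℕ.+-monoʳ-< m i<)))) ⟩
    ∑ m f + 0ℤ                                       ≡⟨ +-identityʳ _ ⟩
    ∑ m f ∎
    where open ≡-Reasoning

-- Divisor sums of a real character.

module DivisorSums where

  open import Data.Integer hiding (suc; _/_; _%_)
  open import Data.Integer.Properties
  open import Data.Integer.Divisibility.Signed
  open import Data.Integer.Tactic.RingSolver using (solve-∀)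
  open Congruences
  open FiniteSums
  open ResidueSymbol using (IsSign)

  prime-divisor : ∀ n → 2 ℕ.≤ n → ∃[ p ] Prime p × p ℕ.∣ n
  prime-divisor n@(suc _) 2≤n with factorise n
  ... | record { factors = []     ; isFactorisation = eq } = contradiction (sym eq) (ℕ.<⇒≢ 2≤n)
  ... | record { factors = p ∷ ps ; isFactorisation = eq ; factorsPrime = pr ∷ _ } = p , pr , subst (p ℕ.∣_) (sym eq)
        (ℕ.m∣m*n _)

  prime≥2 : ∀ {p} → Prime p → 2 ℕ.≤ p
  prime≥2 {p} pr = ℕ.nonTrivial⇒n>1 p {{prime⇒nonTrivial pr}}

  valuation : ∀ p → Prime p → ∀ n → 1 ℕ.≤ n → ∃[ a ] ∃[ m ] n ≡ p ℕ.^ a ℕ.* m × ¬ p ℕ.∣ m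
  valuation p pr = <-rec _ go
    where
    go : ∀ n → (∀ {m} → m ℕ.< n → 1 ℕ.≤ m → ∃[ a ] ∃[ k ] m ≡ p ℕ.^ a ℕ.* k × ¬ p ℕ.∣ k) →
         1 ℕ.≤ n → ∃[ a ] ∃[ m ] n ≡ p ℕ.^ a ℕ.* m × ¬ p ℕ.∣ m
    go n rec 1≤n with p ℕ.∣? n
    ... | no ¬d = 0 , n , sym (ℕ.*-identityˡ n) , ¬d
    ... | yes (ℕ.divides zero eq) = contradiction eq (λ e → ℕ.<⇒≢ 1≤n (sym e))
    ... | yes (ℕ.divides q@(suc _) eq) with a , m , q≡ , ¬d ← rec (subst (q ℕ.<_) (sym eq) (ℕ.m<m*n q p (prime≥2 pr)))
          (s≤s z≤n)
        = suc a , m , trans eq (trans (cong (ℕ._* p) q≡) (e (p ℕ.^ a) m p)) , ¬d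
      where e : ∀ x y z → x ℕ.* y ℕ.* z ≡ z ℕ.* x ℕ.* y
            e = ℕ.solve-∀

  ∤⇒coprime : ∀ {p d} → Prime p → ¬ p ℕ.∣ d → Coprime d p
  ∤⇒coprime {p} {d} pr ¬p∣d {e} (e∣d , e∣p) with prime⇒irreducible pr e∣p
  ... | inj₁ e≡1 = e≡1
  ... | inj₂ e≡p = contradiction (subst (ℕ._∣ d) e≡p e∣d) ¬p∣d

  coprime-power : ∀ {d p} a m → Coprime d p → d ℕ.∣ p ℕ.^ a ℕ.* m → d ℕ.∣ m
  coprime-power zero    m c d∣ = subst (_ ℕ.∣_) (ℕ.*-identityˡ m) d∣
  coprime-power {d} {p} (suc a) m c d∣ = coprime-power a m c (coprime-divisor c (subst (d ℕ.∣_) (ℕ.*-assoc p (p ℕ.^ a)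
      m) d∣))

  even⊎odd : ∀ a → ∃[ b ] (a ≡ b ℕ.+ b ⊎ a ≡ suc (b ℕ.+ b))
  even⊎odd zero = 0 , inj₁ refl
  even⊎odd (suc a) with even⊎odd a
  ... | b , inj₁ e = b , inj₂ (cong suc e)
  ... | b , inj₂ e = suc b , inj₁ (trans (cong suc e) (cong suc (sym (ℕ.+-suc b b))))

  ∑-multiples : ∀ p′ N (F : ℕ → ℤ) → let p = suc p′ in
    ∑ (p ℕ.* N) (λ i → ι (p ℕ.∣? suc i) * F (suc i)) ≡ ∑ N (λ i → F (p ℕ.* suc i))
  ∑-multiples p′ zero F = cong (λ z → ∑ z (λ i → ι (suc p′ ℕ.∣? suc i) * F (suc i))) (ℕ.*-zeroʳ (suc p′))
  ∑-multiples p′ (suc N) F = begin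
    ∑ (p ℕ.* suc N) f                                    ≡⟨ cong (λ z → ∑ z f) (trans (ℕ.*-suc p N) (ℕ.+-comm p
        (p ℕ.* N))) ⟩
    ∑ (p ℕ.* N ℕ.+ p) f                                  ≡⟨ ∑-split (p ℕ.* N) p f ⟩
    ∑ (p ℕ.* N) f + ∑ p (λ i → f (p ℕ.* N ℕ.+ i))        ≡⟨ cong₂ _+_ (∑-multiples p′ N F)
        (trans (∑-single p p′ {λ i → f (p ℕ.* N ℕ.+ i)} ℕ.≤-refl other) last) ⟩
    ∑ N (λ i → F (p ℕ.* suc i)) + F (p ℕ.* suc N) ∎
    where
    open ≡-Reasoning
    p = suc p′
    f : ℕ → ℤ
    f i = ι (p ℕ.∣? suc i) * F (suc i)
    end : suc (p ℕ.* N ℕ.+ p′) ≡ p ℕ.* suc N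
    end = trans (sym (ℕ.+-suc (p ℕ.* N) p′)) (trans (ℕ.+-comm (p ℕ.* N) p) (sym (ℕ.*-suc p N)))
    last : f (p ℕ.* N ℕ.+ p′) ≡ F (p ℕ.* suc N)
    last = trans (cong₂ _*_ (ι-yes (p ℕ.∣? suc (p ℕ.* N ℕ.+ p′)) (subst (p ℕ.∣_) (sym end) (ℕ.m∣m*n (suc N))))
        (cong F end)) (*-identityˡ _)
    other : ∀ i → i ℕ.< p → i ≢ p′ → f (p ℕ.* N ℕ.+ i) ≡ 0ℤ
    other i i<p i≢ = cong (_* F (suc (p ℕ.* N ℕ.+ i))) (ι-no (p ℕ.∣? suc (p ℕ.* N ℕ.+ i)) (λ d →
      ℕ.<⇒≱ (s≤s (ℕ.≤∧≢⇒< (ℕ.≤-pred i<p) i≢))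
        (ℕ.∣⇒≤ (ℕ.∣m+n∣m⇒∣n (subst (p ℕ.∣_) (sym (ℕ.+-suc (p ℕ.* N) i)) d) (ℕ.m∣m*n N)))))

  record Character (k : ℕ) : Set where
    field
      χ          : ℕ → ℤ
      χ-coprime  : ∀ {n} → Coprime n k → IsSign (χ n)
      χ-zero     : ∀ {n} → ¬ Coprime n k → χ n ≡ 0ℤ
      χ-*        : ∀ a b → χ (a ℕ.* b) ≡ χ a * χ b
      χ-periodic : ∀ {a b} → + a ≈ + b [ + k ] → χ a ≡ χ b
      χ-1        : χ 1 ≡ 1ℤ

  module DivisorSum {k} (character : Character k) where
    open Character character

    G : ℕ → ℤ
    G n = ∑ n (λ i → ι (suc i ℕ.∣? n) * χ (suc i))

    G-extend : ∀ {n X} → 1 ℕ.≤ n → n ℕ.≤ X → ∑ X (λ i → ι (suc i ℕ.∣? n) * χ (suc i)) ≡ G n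
    G-extend {n@(suc _)} {X} _ n≤X = ∑-prefix n≤X _ (λ i n≤i _ →
      cong (_* χ (suc i)) (ι-no (suc i ℕ.∣? n) (λ d → ℕ.<⇒≱ (s≤s n≤i) (ℕ.∣⇒≤ d))))

    module _ {p : ℕ} (pr : Prime p) {m : ℕ} (1≤m : 1 ℕ.≤ m) (p∤m : ¬ p ℕ.∣ m) where

      private instance
        p≢0 : ℕ.NonZero p
        p≢0 = prime⇒nonZero pr

      -- A divisor of p^(a+1) m is either p times a divisor of p^a m, or not divisible by p and then
      -- a divisor of m.
      G-step : ∀ a → G (p ℕ.* (p ℕ.^ a ℕ.* m)) ≡ χ p * G (p ℕ.^ a ℕ.* m) + G m
      G-step a = begin
        G (p ℕ.* N)
          ≡⟨ ∑-cong (p ℕ.* N) (λ i _ → pointwise (suc i)) ⟩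
        ∑ (p ℕ.* N) (λ i → ι (p ℕ.∣? suc i) * F (suc i) + ι (suc i ℕ.∣? m) * χ (suc i))
          ≡⟨ ∑-+ (p ℕ.* N) (λ i → ι (p ℕ.∣? suc i) * F (suc i)) (λ i → ι (suc i ℕ.∣? m) * χ (suc i)) ⟩
        ∑ (p ℕ.* N) (λ i → ι (p ℕ.∣? suc i) * F (suc i)) + ∑ (p ℕ.* N) (λ i → ι (suc i ℕ.∣? m) * χ (suc i))
          ≡⟨ cong₂ _+_ (multiples p refl) (G-extend 1≤m m≤pN) ⟩
        ∑ N (λ i → F (p ℕ.* suc i)) + G m
          ≡⟨ cong (_+ G m) (trans (∑-cong N (λ i _ → scale (suc i))) (sym (∑-*ˡ N (χ p) _))) ⟩
        χ p * G N + G m ∎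
        where
        open ≡-Reasoning
        N = p ℕ.^ a ℕ.* m
        F : ℕ → ℤ
        F d = ι (d ℕ.∣? p ℕ.* N) * χ d
        m≤pN : m ℕ.≤ p ℕ.* N
        m≤pN = ℕ.≤-trans (ℕ.m≤n*m m (p ℕ.^ a) {{ℕ.m^n≢0 p a}}) (ℕ.m≤n*m N p)
        multiples : ∀ q → q ≡ p → ∑ (q ℕ.* N) (λ i → ι (q ℕ.∣? suc i) * F (suc i)) ≡ ∑ N (λ i → F (q ℕ.* suc i))
        multiples zero    eq = contradiction eq (ℕ.<⇒≢ (ℕ.>-nonZero⁻¹ p))
        multiples (suc q) eq = ∑-multiples q N F
        scale : ∀ d → F (p ℕ.* d) ≡ χ p * (ι (d ℕ.∣? N) * χ d)
        scale d = trans (cong₂ _*_ (ι-cong (p ℕ.* d ℕ.∣? p ℕ.* N) (d ℕ.∣? N) (ℕ.*-cancelˡ-∣ p) (ℕ.*-monoʳ-∣ p))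
            (χ-* p d))
                        (e (ι (d ℕ.∣? N)) (χ p) (χ d))
          where e : ∀ x y z → x * (y * z) ≡ y * (x * z)
                e = solve-∀
        pointwise : ∀ d → F d ≡ ι (p ℕ.∣? d) * F d + ι (d ℕ.∣? m) * χ d
        pointwise d with p ℕ.∣? d
        ... | yes p∣d = sym (trans (cong₂ _+_ (*-identityˡ (F d)) (cong (_* χ d) (ι-no (d ℕ.∣? m) (λ d∣m → p∤m
              (ℕ.∣-trans p∣d d∣m)))))
                               (+-identityʳ (F d)))
        ... | no p∤d = sym (trans (+-identityˡ _) (cong (_* χ d) (ι-cong (d ℕ.∣? m) (d ℕ.∣? p ℕ.* N)
                        (λ d∣m → ℕ.∣-trans d∣m (ℕ.∣-trans (ℕ.n∣m*n (p ℕ.^ a)) (ℕ.n∣m*n p)))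
                        (λ d∣pN → coprime-power a m (∤⇒coprime pr p∤d) (coprime-divisor (∤⇒coprime pr p∤d) d∣pN)))))

      G-split : χ p ≡ 1ℤ → ∀ a → G (p ℕ.^ a ℕ.* m) ≡ + suc a * G m
      G-split χp zero    = trans (cong G (ℕ.*-identityˡ m)) (sym (*-identityˡ (G m)))
      G-split χp (suc a) = trans (cong G (ℕ.*-assoc p (p ℕ.^ a) m)) (trans (G-step a)
        (trans (cong₂ (λ u v → u * v + G m) χp (G-split χp a)) (e (+ suc a) (G m))))
        where e : ∀ x y → 1ℤ * (x * y) + y ≡ (1ℤ + x) * y
              e = solve-∀

      G-inert-odd : χ p ≡ -1ℤ → ∀ b → G (p ℕ.^ suc (b ℕ.+ b) ℕ.* m) ≡ 0ℤ
      G-inert-even : χ p ≡ -1ℤ → ∀ b → G (p ℕ.^ (b ℕ.+ b) ℕ.* m) ≡ G m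
      G-inert-odd χp b = trans (cong G (ℕ.*-assoc p (p ℕ.^ (b ℕ.+ b)) m)) (trans (G-step (b ℕ.+ b))
        (trans (cong₂ (λ u v → u * v + G m) χp (G-inert-even χp b)) (e (G m))))
        where e : ∀ x → -1ℤ * x + x ≡ 0ℤ
              e = solve-∀
      G-inert-even χp zero    = cong G (ℕ.*-identityˡ m)
      G-inert-even χp (suc b) = trans (cong G (trans (cong (λ z → p ℕ.^ suc z ℕ.* m) (ℕ.+-suc b b)) (ℕ.*-assoc p
          (p ℕ.^ suc (b ℕ.+ b)) m)))
        (trans (G-step (suc (b ℕ.+ b))) (trans (cong₂ (λ u v → u * v + G m) χp (G-inert-odd χp b)) (+-identityˡ (G m))))

-- Numbers with positive divisor sum.

module NormLikeNumbers where

  open import Data.Integer hiding (suc; _/_; _%_)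
  open import Data.Integer.Properties
  open import Data.Integer.Divisibility.Signed
  open import Data.Integer.Tactic.RingSolver using (solve-∀)
  open Congruences
  open FiniteSums
  open DivisorSums

  Coprime-∣ˡ : ∀ {a b c} → a ℕ.∣ b → Coprime b c → Coprime a c
  Coprime-∣ˡ a∣b cop (d∣a , d∣c) = cop (ℕ.∣-trans d∣a a∣b , d∣c)

  coprime-*-∣ : ∀ {a b x} → Coprime a b → + a ∣ x → + b ∣ x → + (a ℕ.* b) ∣ x
  coprime-*-∣ {a} {b} {x} cop (divides y x≡) b∣x with coprime-∣ (Coprimality.sym cop) (subst (+ b ∣_)
      (trans x≡ (*-comm y (+ a))) b∣x)
  ... | divides z y≡ = divides z (trans x≡ (trans (cong (_* + a) y≡) (trans (e z (+ a) (+ b)) (cong (z *_)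
        (sym (pos-* a b))))))
    where e : ∀ z a b → z * b * a ≡ z * (a * b)
          e = solve-∀

  RootMod : ℤ → ℕ → Set
  RootMod M P = ∃[ Q ] + P ∣ Q * Q + M

  root-resp-≈ : ∀ {m M x y} → x ≈ y [ m ] → m ∣ y * y + M → m ∣ x * x + M
  root-resp-≈ {m} {M} {x} {y} p d = ≈0⇒∣ (≈-trans (≈-+ (≈-* p p) (≈-refl {x = M})) (∣⇒≈0 d))

  root-* : ∀ {M P p} → Coprime P p → RootMod M P → RootMod M p → RootMod M (P ℕ.* p)
  root-* {M} {P} {zero} cop (Q₁ , d₁) (Q₂ , d₂) = Q₂ , subst (λ z → + z ∣ Q₂ * Q₂ + M) (sym (ℕ.*-zeroʳ P)) d₂
  root-* {M} {P} {p@(suc p′)} cop (Q₁ , d₁) (Q₂ , d₂) = Q , coprime-*-∣ cop (root-resp-≈ Q≈Q₁ d₁) (root-resp-≈ Q≈Q₂ d₂)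
    where
    inv = inverse-mod P p′ cop
    u = + proj₁ inv
    Q = Q₁ + + P * (u * (Q₂ - Q₁))
    Q≈Q₁ : Q ≈ Q₁ [ + P ]
    Q≈Q₁ = cong-mod (divides (u * (Q₂ - Q₁)) (e Q₁ (+ P) (u * (Q₂ - Q₁))))
      where e : ∀ q p x → (q + p * x) - q ≡ x * p
            e = solve-∀
    Q≈Q₂ : Q ≈ Q₂ [ + p ]
    Q≈Q₂ = ≈-trans (≈-reflexive (e₁ Q₁ Q₂ (+ P) u)) (≈-trans (≈-+ (≈-refl {x = Q₁}) (≈-*ʳ (Q₂ - Q₁) (proj₂ inv)))
        (≈-reflexive (e₂ Q₁ Q₂)))
      where
      e₁ : ∀ a b p u → a + p * (u * (b - a)) ≡ a + p * u * (b - a)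
      e₁ = solve-∀
      e₂ : ∀ a b → a + 1ℤ * (b - a) ≡ b
      e₂ = solve-∀

  module _ {k} (character : Character k) (M : ℤ)
           (root : ∀ p → Prime p → Coprime p k → Character.χ character p ≡ 1ℤ → RootMod M p) where
    open Character character
    open DivisorSum character

    -- The square factor takes up the primes with χ(p) = -1, for which `root` supplies no square
    -- root of -M.
    NormLike : ℕ → Set
    NormLike n = ∃[ l ] ∃[ P ] n ≡ l ℕ.* l ℕ.* P × RootMod M P

    Classified : ℕ → Set
    Classified n = G n ≡ 0ℤ ⊎ (1ℤ ≤ G n × NormLike n)

    -- If χ(p) = 1, then G is multiplied by a + 1; the largest even power of p goes into the square,
    -- and a remaining single p joins P by the Chinese remainder theorem. If χ(p) = -1, an odd
    -- exponent makes G vanish, and an even power goes into the square while G stays the same.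
    classify-step : ∀ {p} → Prime p → ∀ n a m → Coprime p k → 1 ℕ.≤ m → n ≡ p ℕ.^ a ℕ.* m → ¬ p ℕ.∣ m →
                    Classified m → Classified n
    classify-step {p} pr n a m p-coprime 1≤m n≡ p∤m = main
      where
      even-case : ∀ b → a ≡ b ℕ.+ b → NormLike m → NormLike n
      even-case b a≡ (l , P , m≡ , r) = p ℕ.^ b ℕ.* l , P , trans n≡ (trans (cong₂ ℕ._*_ (trans (cong (p ℕ.^_) a≡)
          (ℕ.^-distribˡ-+-* p b b)) m≡) (e (p ℕ.^ b) l P)) , r
        where e : ∀ x l P → x ℕ.* x ℕ.* (l ℕ.* l ℕ.* P) ≡ x ℕ.* l ℕ.* (x ℕ.* l) ℕ.* P
              e = ℕ.solve-∀
      odd-case : ∀ b → a ≡ suc (b ℕ.+ b) → RootMod M p → NormLike m → NormLike n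
      odd-case b a≡ rp (l , P , m≡ , r) = p ℕ.^ b ℕ.* l , P ℕ.* p ,
          trans n≡ (trans (cong₂ ℕ._*_ (trans (cong (p ℕ.^_) a≡) (cong (p ℕ.*_) (ℕ.^-distribˡ-+-* p b b))) m≡)
              (e p (p ℕ.^ b) l P)) ,
          root-* (∤⇒coprime pr (λ p∣P → p∤m (ℕ.∣-trans p∣P (subst (P ℕ.∣_) (sym m≡) (ℕ.n∣m*n (l ℕ.* l)))))) r rp
        where e : ∀ p x l P → p ℕ.* (x ℕ.* x) ℕ.* (l ℕ.* l ℕ.* P) ≡ x ℕ.* l ℕ.* (x ℕ.* l) ℕ.* (P ℕ.* p)
              e = ℕ.solve-∀
      main : Classified m → Classified n
      main ih with χ-coprime p-coprime | even⊎odd a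
      main ih | inj₁ χp | b , parity with ih
      ... | inj₁ Gm≡0 = inj₁ (trans (cong G n≡) (trans (G-split pr 1≤m p∤m χp a) (trans (cong (+ suc a *_) Gm≡0)
            (*-zeroʳ (+ suc a)))))
      ... | inj₂ (1≤Gm , nm) = inj₂ (≤-trans 1≤Gm (≤-trans Gm≤ (≤-reflexive (sym (trans (cong G n≡) (G-split pr 1≤m p∤m
            χp a))))) ,
                                     [ (λ e → even-case b e nm) , (λ e → odd-case b e (root p pr p-coprime χp) nm) ]′
                                         parity)
        where
        Gm≤ : G m ≤ + suc a * G m
        Gm≤ = subst (_≤ + suc a * G m) (*-identityˡ (G m))
                (*-monoʳ-≤-nonNeg (G m) {{nonNegative (≤-trans (+≤+ z≤n) 1≤Gm)}} {1ℤ} {+ suc a} (+≤+ (s≤s z≤n)))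
      main ih | inj₂ χp | b , inj₂ a≡ = inj₁ (trans (cong G (trans n≡ (cong (λ z → p ℕ.^ z ℕ.* m) a≡)))
          (G-inert-odd pr 1≤m p∤m χp b))
      main ih | inj₂ χp | b , inj₁ a≡ = [ (λ z → inj₁ (trans Gn≡Gm z)) , (λ (g , nm) → inj₂ (subst (1ℤ ≤_) (sym Gn≡Gm) g
          , even-case b a≡ nm)) ]′ ih
        where
        Gn≡Gm : G n ≡ G m
        Gn≡Gm = trans (cong G (trans n≡ (cong (λ z → p ℕ.^ z ℕ.* m) a≡))) (G-inert-even pr 1≤m p∤m χp b)

    classify : ∀ n → 1 ℕ.≤ n → Coprime n k → Classified n
    classify = <-rec _ go
      where
      go : ∀ n → (∀ {m} → m ℕ.< n → 1 ℕ.≤ m → Coprime m k → Classified m) → 1 ℕ.≤ n → Coprime n k → Classified n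
      go 1 rec _ _ = inj₂ (≤-reflexive (sym (trans (+-identityˡ _) (trans (cong (_* χ 1) (ι-yes (1 ℕ.∣? 1) ℕ.∣-refl))
          (trans (*-identityˡ (χ 1)) χ-1)))) ,
                          1 , 1 , refl , 0ℤ , divides M (e M))
        where e : ∀ m → 0ℤ * 0ℤ + m ≡ m * 1ℤ
              e = solve-∀
      go n@(suc (suc _)) rec 1≤n cop =
        let p , pr , p∣n = prime-divisor n (s≤s (s≤s z≤n))
            a , m , n≡ , p∤m = valuation p pr n 1≤n
            m∣n = subst (m ℕ.∣_) (sym n≡) (ℕ.n∣m*n (p ℕ.^ a))
            1≤m = ℕ.n≢0⇒n>0 (λ m≡0 → p∤m (subst (p ℕ.∣_) (sym m≡0) (p ℕ.∣0)))
            m<n = ℕ.≤∧≢⇒< (ℕ.∣⇒≤ m∣n) (λ m≡n → p∤m (subst (p ℕ.∣_) (sym m≡n) p∣n))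
        in classify-step pr n a m (Coprime-∣ˡ p∣n cop) 1≤m n≡ p∤m (rec m<n 1≤m (Coprime-∣ˡ m∣n cop))

-- Dirichlet's hyperbola method and equidistribution.

module HyperbolaMethod where

  open import Data.Integer hiding (suc; _/_; _%_)
  open import Data.Integer.Properties
  open import Data.Integer.Divisibility.Signed
  open import Data.Integer.Tactic.RingSolver using (solve-∀)
  open Congruences
  open FiniteSums
  open DivisorSums
  open ResidueSymbol using (sign²)

  ≈? : ∀ x y m → Dec (x ≈ y [ m ])
  ≈? x y m = map′ cong-mod difference (m ∣? x - y)

  %-≈ : ∀ x k .{{_ : ℕ.NonZero k}} → + (x % k) ≈ + x [ + k ]
  %-≈ x k = ≈-sym (cong-mod (divides (+ (x / k)) (trans (cong (_- + (x % k))
    (trans (cong +_ (ℕ.m≡m%n+[m/n]*n x k)) (trans (pos-+ (x % k) (x / k ℕ.* k)) (cong (λ z → + (x % k) + z)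
        (pos-* (x / k) k))))) (e (+ (x % k)) (+ (x / k) * + k)))))
    where e : ∀ r y → (r + y) - r ≡ y
          e = solve-∀

  ∑-cut : ∀ {A B} → B ℕ.≤ A → (f : ℕ → ℤ) → ∑ A (λ t → ι (t ℕ.<? B) * f t) ≡ ∑ B f
  ∑-cut {A} {B} B≤A f = trans
    (∑-prefix B≤A _ (λ i B≤i _ → cong (_* f i) (ι-no (i ℕ.<? B) (ℕ.≤⇒≯ B≤i))))
    (∑-cong B (λ i i<B → trans (cong (_* f i) (ι-yes (i ℕ.<? B) i<B)) (*-identityˡ (f i))))

  ∑-divisible : ∀ d X (F : ℕ → ℤ) → ∑ X (λ j → ι (suc d ℕ.∣? suc j) * F (suc j)) ≡ ∑ (X / suc d)
      (λ e → F (suc d ℕ.* suc e))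
  ∑-divisible d X F = trans (∑-prefix le _ tail) (∑-multiples d q F)
    where
    q = X / suc d
    X≡ : X ≡ X % suc d ℕ.+ q ℕ.* suc d
    X≡ = ℕ.m≡m%n+[m/n]*n X (suc d)
    le : suc d ℕ.* q ℕ.≤ X
    le = subst (ℕ._≤ X) (ℕ.*-comm q (suc d)) (ℕ.m/n*n≤m X (suc d))
    tail : ∀ i → suc d ℕ.* q ℕ.≤ i → i ℕ.< X → ι (suc d ℕ.∣? suc i) * F (suc i) ≡ 0ℤ
    tail i dq≤i i<X = cong (_* F (suc i)) (ι-no (suc d ℕ.∣? suc i) contra)
      where
      contra : ¬ suc d ℕ.∣ suc i
      contra (ℕ.divides e eq) = ℕ.<⇒≱ (ℕ.*-cancelʳ-< (suc d) q e q*d<e*d) (ℕ.m<1+n⇒m≤n e<1+q)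
        where
        q*d<e*d : q ℕ.* suc d ℕ.< e ℕ.* suc d
        q*d<e*d = subst (q ℕ.* suc d ℕ.<_) eq (s≤s (subst (ℕ._≤ i) (ℕ.*-comm (suc d) q) dq≤i))
        e<1+q : e ℕ.< suc q
        e<1+q = ℕ.*-cancelʳ-< (suc d) e (suc q) (ℕ.≤-<-trans (subst (ℕ._≤ X) eq i<X)
                (subst (ℕ._< suc q ℕ.* suc d) (sym X≡) (ℕ.+-monoˡ-< (q ℕ.* suc d) (ℕ.m%n<n X (suc d)))))

  module Hyperbola {k₀} (character : Character (suc k₀)) where
    private k = suc k₀
    open Character character
    open DivisorSum character

    R? : ∀ c n → Dec (+ n ≈ + c [ + k ])
    R? c n = ≈? (+ n) (+ c) (+ k)

    -- The index t stands for e = L + t + 1, so this counts the solutions of d e ≡ c with L < e ≤ L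
    -- + ℓ.
    N : ℕ → ℕ → ℕ → ℕ → ℤ
    N c d L ℓ = ∑ ℓ (λ t → ι (R? c (d ℕ.* suc (L ℕ.+ t))))

    N-block : ∀ c d L → Coprime d k → N c d L k ≡ 1ℤ
    N-block c d L cop = trans (∑-single k t₀ {λ t → ι (R? c (d ℕ.* suc (L ℕ.+ t)))} (ℕ.m%n<n x k) unique)
        (ι-yes (R? c (d ℕ.* suc (L ℕ.+ t₀))) holds)
      where
      inv = inverse-mod d k₀ cop
      d′ = proj₁ inv
      -- The congruence d (1 + L + t) ≡ c gives t ≡ d′ c - (1 + L), and k₀ stands for -1 modulo k.
      x = d′ ℕ.* c ℕ.+ k₀ ℕ.* suc L
      t₀ = x % k
      pos-x : + x ≡ + d′ * + c + + k₀ * (1ℤ + + L)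
      pos-x = trans (pos-+ (d′ ℕ.* c) (k₀ ℕ.* suc L)) (cong₂ _+_ (pos-* d′ c) (pos-* k₀ (suc L)))
      pos-e : ∀ t → + (d ℕ.* suc (L ℕ.+ t)) ≡ + d * (1ℤ + + L + + t)
      pos-e t = trans (pos-* d (suc (L ℕ.+ t))) (cong (+ d *_) (pos-+ (suc L) t))
      e₁ : ∀ d L d′ c k₀ → d * (1ℤ + L + (d′ * c + k₀ * (1ℤ + L))) ≡ d * (1ℤ + L) * (1ℤ + k₀) + d * d′ * c
      e₁ = solve-∀
      holds : + (d ℕ.* suc (L ℕ.+ t₀)) ≈ + c [ + k ]
      holds = ≈-trans (≈-reflexive (pos-e t₀)) (≈-trans (≈-*ˡ (+ d) (≈-+ (≈-refl {x = 1ℤ + + L}) (%-≈ x k)))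
        (≈-trans (≈-reflexive (trans (cong (λ z → + d * (1ℤ + + L + z)) pos-x) (e₁ (+ d) (+ L) (+ d′) (+ c) (+ k₀))))
        (≈-trans (≈-+ (∣⇒≈0 (divides (+ d * (1ℤ + + L)) refl)) (≈-*ʳ (+ c) (proj₂ inv)))
        (≈-reflexive (trans (+-identityˡ _) (*-identityˡ (+ c)))))))
      unique : ∀ t → t ℕ.< k → t ≢ t₀ → ι (R? c (d ℕ.* suc (L ℕ.+ t))) ≡ 0ℤ
      unique t t<k t≢ = ι-no (R? c (d ℕ.* suc (L ℕ.+ t))) (λ h → t≢ (t≡ h))
        where
        e₂ : ∀ d L t s → d * (1ℤ + L + t) - d * (1ℤ + L + s) ≡ d * (t - s)
        e₂ = solve-∀
        t≡ : + (d ℕ.* suc (L ℕ.+ t)) ≈ + c [ + k ] → t ≡ t₀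
        t≡ h = +-injective (i-j≡0⇒i≡j (+ t) (+ t₀) (small-multiple
          (coprime-∣ (Coprimality.sym cop) (subst (+ k ∣_) (trans (cong₂ _-_ (pos-e t) (pos-e t₀)) (e₂ (+ d) (+ L) (+ t)
              (+ t₀)))
            (difference (≈-trans h (≈-sym holds))))) small))
          where
          small : ∣ + t - + t₀ ∣ ℕ.< k
          small = ℕ.≤-<-trans (ℕ.≤-reflexive (trans (cong ∣_∣ ([+m]-[+n]≡m⊖n t t₀)) (∣m⊖n∣≡∣m-n∣ t t₀)))
                    (ℕ.≤-<-trans (ℕ.∣m-n∣≤m⊔n t t₀) (ℕ.⊔-pres-<m t<k (ℕ.m%n<n x k)))
            where
            ∣m⊖n∣≡∣m-n∣ : ∀ m n → ∣ m ⊖ n ∣ ≡ ℕ.∣ m - n ∣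
            ∣m⊖n∣≡∣m-n∣ m n with ℕ.≤-total m n
            ... | inj₁ m≤n = trans (∣⊖∣-≤ m≤n) (sym (ℕ.m≤n⇒∣m-n∣≡n∸m m≤n))
            ... | inj₂ n≤m = trans (cong ∣_∣ (⊖-≥ n≤m)) (sym (ℕ.m≤n⇒∣n-m∣≡n∸m n≤m))

    N-split : ∀ c d L a b → N c d L (a ℕ.+ b) ≡ N c d L a + N c d (L ℕ.+ a) b
    N-split c d L a b = trans (∑-split a b (λ t → ι (R? c (d ℕ.* suc (L ℕ.+ t)))))
      (cong (λ z → N c d L a + z) (∑-cong b (λ t _ → cong (λ z → ι (R? c (d ℕ.* suc z))) (sym (ℕ.+-assoc L a t)))))

    N≥0 : ∀ c d L ℓ → 0ℤ ≤ N c d L ℓ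
    N≥0 c d L ℓ = ∑≥0 ℓ (λ t _ → ι≥0 (R? c (d ℕ.* suc (L ℕ.+ t))))

    N-blocks : ∀ c d L q → Coprime d k → N c d L (q ℕ.* k) ≡ + q
    N-blocks c d L zero    cop = refl
    N-blocks c d L (suc q) cop = trans (N-split c d L k (q ℕ.* k)) (cong₂ _+_ (N-block c d L cop) (N-blocks c d
        (L ℕ.+ k) q cop))

    N-short : ∀ c d L r → Coprime d k → r ℕ.≤ k → N c d L r ≤ 1ℤ
    N-short c d L r cop r≤k = begin
      N c d L r                                   ≡⟨ +-identityʳ _ ⟨
      N c d L r + 0ℤ                              ≤⟨ +-monoʳ-≤ (N c d L r) (N≥0 c d (L ℕ.+ r) (k ℕ.∸ r)) ⟩
      N c d L r + N c d (L ℕ.+ r) (k ℕ.∸ r)       ≡⟨ N-split c d L r (k ℕ.∸ r) ⟨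
      N c d L (r ℕ.+ (k ℕ.∸ r))                   ≡⟨ cong (N c d L) (ℕ.m+[n∸m]≡n r≤k) ⟩
      N c d L k                                   ≡⟨ N-block c d L cop ⟩
      1ℤ ∎
      where open ≤-Reasoning

    -- A block of k consecutive e contains exactly one solution and a shorter block at most one. The
    -- bounds do not involve c, which makes different classes comparable.
    N-bounds : ∀ c d L ℓ → Coprime d k → + (ℓ / k) ≤ N c d L ℓ × N c d L ℓ ≤ + (ℓ / k) + 1ℤ
    N-bounds c d L ℓ cop = lower , upper
      where
      q = ℓ / k
      r = ℓ % k
      N≡ : N c d L ℓ ≡ + q + N c d (L ℕ.+ q ℕ.* k) r
      N≡ = trans (cong (N c d L) (trans (ℕ.m≡m%n+[m/n]*n ℓ k) (ℕ.+-comm r (q ℕ.* k))))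
             (trans (N-split c d L (q ℕ.* k) r) (cong (_+ N c d (L ℕ.+ q ℕ.* k) r) (N-blocks c d L q cop)))
      lower : + q ≤ N c d L ℓ
      lower = subst₂ _≤_ (+-identityʳ (+ q)) (sym N≡) (+-monoʳ-≤ (+ q) (N≥0 c d (L ℕ.+ q ℕ.* k) r))
      upper : N c d L ℓ ≤ + q + 1ℤ
      upper = subst (_≤ + q + 1ℤ) (sym N≡) (+-monoʳ-≤ (+ q) (N-short c d (L ℕ.+ q ℕ.* k) r cop (ℕ.<⇒≤ (ℕ.m%n<n ℓ k))))

    S : ℕ → ℕ → ℤ
    S c X = ∑ X (λ j → ι (R? c (suc j)) * G (suc j))

    S-by-divisors : ∀ c X → S c X ≡ ∑ X (λ i → χ (suc i) * N c (suc i) 0 (X / suc i))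
    S-by-divisors c X = begin
      S c X
        ≡⟨ ∑-cong X (λ j j<X → trans (cong (ι (R? c (suc j)) *_) (sym (G-extend (s≤s z≤n) j<X)))
             (∑-*ˡ X (ι (R? c (suc j))) (λ i → ι (suc i ℕ.∣? suc j) * χ (suc i)))) ⟩
      ∑ X (λ j → ∑ X (λ i → ι (R? c (suc j)) * (ι (suc i ℕ.∣? suc j) * χ (suc i))))
        ≡⟨ ∑-swap X X (λ j i → ι (R? c (suc j)) * (ι (suc i ℕ.∣? suc j) * χ (suc i))) ⟩
      ∑ X (λ i → ∑ X (λ j → ι (R? c (suc j)) * (ι (suc i ℕ.∣? suc j) * χ (suc i))))
        ≡⟨ ∑-cong X (λ i _ → trans (∑-cong X (λ j _ → e (ι (R? c (suc j))) (ι (suc i ℕ.∣? suc j)) (χ (suc i))))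
             (trans (sym (∑-*ˡ X (χ (suc i)) (λ j → ι (suc i ℕ.∣? suc j) * ι (R? c (suc j)))))
                    (cong (χ (suc i) *_) (∑-divisible i X (λ n → ι (R? c n)))))) ⟩
      ∑ X (λ i → χ (suc i) * N c (suc i) 0 (X / suc i)) ∎
      where
      open ≡-Reasoning
      e : ∀ a b c → a * (b * c) ≡ c * (b * a)
      e = solve-∀

    -- The product of the two values is χ(c) = 1, so neither is zero, and two signs with product 1
    -- agree.
    χ-equal : ∀ {d e c} → χ c ≡ 1ℤ → + (d ℕ.* e) ≈ + c [ + k ] → χ d ≡ χ e
    χ-equal {d} {e} {c} χc h = go (coprime? d k)
      where
      χdχe : χ d * χ e ≡ 1ℤ
      χdχe = trans (sym (χ-* d e)) (trans (χ-periodic h) χc)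
      go : Dec (Coprime d k) → χ d ≡ χ e
      go (no ¬c) = contradiction (trans (sym (cong (_* χ e) (χ-zero ¬c))) χdχe) (λ ())
      go (yes cop) = begin
        χ d                 ≡⟨ *-identityʳ (χ d) ⟨
        χ d * 1ℤ            ≡⟨ cong (χ d *_) χdχe ⟨
        χ d * (χ d * χ e)   ≡⟨ *-assoc (χ d) (χ d) (χ e) ⟨
        χ d * χ d * χ e     ≡⟨ cong (_* χ e) (sign² (χ-coprime cop)) ⟩
        1ℤ * χ e            ≡⟨ *-identityˡ (χ e) ⟩
        χ e ∎
        where open ≡-Reasoning

    -- Both inequalities express (d + 1)(e + 1) ≤ X.
    /-galois : ∀ {e d} X → e ℕ.< X / suc d → d ℕ.< X / suc e
    /-galois {e} {d} X lt = ℕ.≤-trans (ℕ.≤-reflexive (sym (ℕ.m*n/n≡m (suc d) (suc e))))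
      (ℕ./-monoˡ-≤ (suc e) (ℕ.≤-trans (ℕ.≤-reflexive (ℕ.*-comm (suc d) (suc e)))
        (ℕ.≤-trans (ℕ.*-monoˡ-≤ (suc d) lt) (ℕ.m/n*n≤m X (suc d)))))

    -- For d ≤ Y the first term counts all pairs (d, e) with d e ≤ Y². The second counts those with
    -- e > Y once more, on behalf of the pairs (e, d) whose first member is large. The divisor is
    -- written `suc (d ∸ 1)` to be visibly nonzero.
    count : ℕ → ℕ → ℕ → ℤ
    count Y c d = N c d 0 (Y ℕ.* Y ℕ./ suc (d ℕ.∸ 1)) + N c d Y (Y ℕ.* Y ℕ./ suc (d ℕ.∸ 1) ℕ.∸ Y)

    -- Dirichlet's hyperbola method: a pair (d, e) with d > Y is counted through its other member e,
    -- which is possible because χ(d) = χ(e) whenever d e ≡ c.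
    hyperbola : ∀ c Y → χ c ≡ 1ℤ → S c (Y ℕ.* Y) ≡ ∑ Y (λ i → χ (suc i) * count Y c (suc i))
    hyperbola c Y χc = begin
      S c X
        ≡⟨ S-by-divisors c X ⟩
      ∑ X f
        ≡⟨ trans (cong (λ z → ∑ z f) (sym (ℕ.m+[n∸m]≡n Y≤X))) (∑-split Y (X ℕ.∸ Y) f) ⟩
      ∑ Y f + ∑ (X ℕ.∸ Y) (λ i → f (Y ℕ.+ i))
        ≡⟨ cong (λ z → ∑ Y f + z) large ⟩
      ∑ Y f + ∑ Y (λ e → χ (suc e) * N c (suc e) Y (X / suc e ℕ.∸ Y))
        ≡⟨ ∑-+ Y f (λ e → χ (suc e) * N c (suc e) Y (X / suc e ℕ.∸ Y)) ⟨
      ∑ Y (λ i → f i + χ (suc i) * N c (suc i) Y (X / suc i ℕ.∸ Y))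
        ≡⟨ ∑-cong Y (λ i _ → sym (*-distribˡ-+ (χ (suc i)) _ _)) ⟩
      ∑ Y (λ i → χ (suc i) * count Y c (suc i)) ∎
      where
      open ≡-Reasoning
      X = Y ℕ.* Y
      f : ℕ → ℤ
      f i = χ (suc i) * N c (suc i) 0 (X / suc i)
      Y≤X : Y ℕ.≤ X
      Y≤X = m≤m*m Y
        where
        m≤m*m : ∀ m → m ℕ.≤ m ℕ.* m
        m≤m*m zero    = z≤n
        m≤m*m (suc m) = ℕ.m≤m*n (suc m) (suc m)
      term : ℕ → ℕ → ℤ
      term i e = χ (suc i) * ι (R? c (suc i ℕ.* suc e))
      X/d≤Y : ∀ i → X / suc (Y ℕ.+ i) ℕ.≤ Y
      X/d≤Y i = ℕ.≤-trans (ℕ./-monoˡ-≤ (suc (Y ℕ.+ i)) (ℕ.*-monoʳ-≤ Y (ℕ.≤-trans (ℕ.m≤m+n Y i) (ℕ.n≤1+n _))))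
                  (ℕ.≤-reflexive (ℕ.m*n/n≡m Y (suc (Y ℕ.+ i))))
      χ-swap : ∀ i e → term i e ≡ χ (suc e) * ι (R? c (suc e ℕ.* suc i))
      χ-swap i e = go (R? c (suc i ℕ.* suc e))
        where
        go : Dec (+ (suc i ℕ.* suc e) ≈ + c [ + k ]) → term i e ≡ χ (suc e) * ι (R? c (suc e ℕ.* suc i))
        go (yes h) = cong₂ _*_ (χ-equal χc h) (cong (λ z → ι (R? c z)) (ℕ.*-comm (suc i) (suc e)))
        go (no ¬h) = trans (trans (cong (χ (suc i) *_) (ι-no (R? c (suc i ℕ.* suc e)) ¬h)) (*-zeroʳ (χ (suc i))))
          (sym (trans (cong (χ (suc e) *_) (ι-no (R? c (suc e ℕ.* suc i)) (λ h → ¬h (subst (λ z → + z ≈ + c [ + k ])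
              (ℕ.*-comm (suc e) (suc i)) h)))) (*-zeroʳ (χ (suc e)))))
      shifted : ∀ e i → ι (e ℕ.<? X / suc (Y ℕ.+ i)) ≡ ι (i ℕ.<? X / suc e ℕ.∸ Y)
      shifted e i = ι-cong (e ℕ.<? X / suc (Y ℕ.+ i)) (i ℕ.<? X / suc e ℕ.∸ Y)
        (λ lt → ℕ.m+n≤o⇒m≤o∸n (suc i) (subst (ℕ._≤ X / suc e) (cong suc (ℕ.+-comm Y i)) (/-galois X lt)))
        (λ lt → /-galois X (subst (ℕ._≤ X / suc e) (ℕ.+-suc Y i)
           (subst (Y ℕ.+ suc i ℕ.≤_) (ℕ.m+[n∸m]≡n {Y} (ℕ.<⇒≤ (ℕ.m∸n≢0⇒n<m {X / suc e} {Y} (λ z → contradiction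
               (subst (suc i ℕ.≤_) z lt) λ ())))) (ℕ.+-monoʳ-≤ Y lt))))
      large : ∑ (X ℕ.∸ Y) (λ i → f (Y ℕ.+ i)) ≡ ∑ Y (λ e → χ (suc e) * N c (suc e) Y (X / suc e ℕ.∸ Y))
      large = begin
        ∑ (X ℕ.∸ Y) (λ i → f (Y ℕ.+ i))
          ≡⟨ ∑-cong (X ℕ.∸ Y) (λ i _ → trans (∑-*ˡ (X / suc (Y ℕ.+ i)) (χ (suc (Y ℕ.+ i))) _)
               (sym (∑-cut (X/d≤Y i) (term (Y ℕ.+ i))))) ⟩
        ∑ (X ℕ.∸ Y) (λ i → ∑ Y (λ e → ι (e ℕ.<? X / suc (Y ℕ.+ i)) * term (Y ℕ.+ i) e))
          ≡⟨ ∑-swap (X ℕ.∸ Y) Y (λ i e → ι (e ℕ.<? X / suc (Y ℕ.+ i)) * term (Y ℕ.+ i) e) ⟩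
        ∑ Y (λ e → ∑ (X ℕ.∸ Y) (λ i → ι (e ℕ.<? X / suc (Y ℕ.+ i)) * term (Y ℕ.+ i) e))
          ≡⟨ ∑-cong Y (λ e _ → trans (∑-cong (X ℕ.∸ Y) (λ i _ → cong₂ _*_ (shifted e i) (χ-swap (Y ℕ.+ i) e)))
               (trans (∑-cut {A = X ℕ.∸ Y} (ℕ.∸-monoˡ-≤ Y (ℕ.m/n≤m X (suc e))) (λ i → χ (suc e) * ι
                   (R? c (suc e ℕ.* suc (Y ℕ.+ i)))))
                 (sym (∑-*ˡ (X / suc e ℕ.∸ Y) (χ (suc e)) _)))) ⟩
        ∑ Y (λ e → χ (suc e) * N c (suc e) Y (X / suc e ℕ.∸ Y)) ∎

    -- Only Y terms are left after the hyperbola method. In each of them the counts for c and c′ are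
    -- sums of two interval counts, and each interval count changes by at most 1 with the class.
    -- Hence every d costs at most 2, whatever the sign of χ(d).
    equidistribution : ∀ c c′ Y → χ c ≡ 1ℤ → χ c′ ≡ 1ℤ → S c′ (Y ℕ.* Y) - + (2 ℕ.* Y) ≤ S c (Y ℕ.* Y)
    equidistribution c c′ Y χc χc′ = begin
      S c′ (Y ℕ.* Y) - + (2 ℕ.* Y)
        ≡⟨ cong₂ _+_ (hyperbola c′ Y χc′) (trans (cong -_ (pos-* 2 Y)) (trans (e₀ (+ Y)) (sym (∑-const Y (- + 2))))) ⟩
      ∑ Y (λ i → χ (suc i) * count Y c′ (suc i)) + ∑ Y (λ _ → - + 2)
        ≡⟨ ∑-+ Y (λ i → χ (suc i) * count Y c′ (suc i)) (λ _ → - + 2) ⟨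
      ∑ Y (λ i → χ (suc i) * count Y c′ (suc i) + - + 2)
        ≤⟨ ∑-mono Y (λ i _ → pointwise (suc i) (coprime? (suc i) k)) ⟩
      ∑ Y (λ i → χ (suc i) * count Y c (suc i))
        ≡⟨ hyperbola c Y χc ⟨
      S c (Y ℕ.* Y) ∎
      where
      open ≤-Reasoning
      e₀ : ∀ y → - (+ 2 * y) ≡ y * - + 2
      e₀ = solve-∀
      close : ∀ b c d → Coprime d k → count Y b d - + 2 ≤ count Y c d
      close b c d cop = ≤-trans (+-monoˡ-≤ (- + 2) (+-mono-≤ (proj₂ (N-bounds b d 0 ℓ₁ cop))
          (proj₂ (N-bounds b d Y ℓ₂ cop))))
        (≤-trans (≤-reflexive (e (+ (ℓ₁ / k)) (+ (ℓ₂ / k)))) (+-mono-≤ (proj₁ (N-bounds c d 0 ℓ₁ cop))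
            (proj₁ (N-bounds c d Y ℓ₂ cop))))
        where
        ℓ₁ = Y ℕ.* Y ℕ./ suc (d ℕ.∸ 1)
        ℓ₂ = ℓ₁ ℕ.∸ Y
        e : ∀ x y → x + 1ℤ + (y + 1ℤ) - + 2 ≡ x + y
        e = solve-∀
      pointwise : ∀ d → Dec (Coprime d k) → χ d * count Y c′ d + - + 2 ≤ χ d * count Y c d
      pointwise d (no ¬cop) = subst (λ z → z * count Y c′ d + - + 2 ≤ z * count Y c d) (sym (χ-zero ¬cop)) -≤+
      pointwise d (yes cop) with χ d | χ-coprime cop
      ... | _ | inj₁ refl = subst₂ _≤_ (cong (_+ - + 2) (sym (*-identityˡ (count Y c′ d))))
            (sym (*-identityˡ (count Y c d))) (close c′ c d cop)
      ... | _ | inj₂ refl = subst₂ _≤_ (e₁ (count Y c′ d)) (sym (-1*i≡-i (count Y c d))) (neg-mono-≤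
            (≤-trans (≤-reflexive (e₂ (count Y c d)))
                              (≤-trans (+-monoˡ-≤ (+ 2) (close c c′ d cop)) ≤-refl)))
        where
        e₁ : ∀ x → - (x + + 2) ≡ -1ℤ * x + - + 2
        e₁ = solve-∀
        e₂ : ∀ x → x ≡ x - + 2 + + 2
        e₂ = solve-∀

-- Norm-like numbers in a residue class with χ = 1.

module NormsInResidueClasses where

  open import Data.Integer hiding (suc; _/_; _%_)
  open import Data.Integer.Properties
  open import Data.Integer.Divisibility.Signed
  open import Data.Integer.Tactic.RingSolver using (solve-∀)
  open Congruences
  open FiniteSums
  open DivisorSums
  open NormLikeNumbers
  open HyperbolaMethod
  open EulerCriterion using (residue)
  open Reciprocity using (J-negated)
  open ResidueSymbol

  Coprime-resp-≈ : ∀ {a b k} → + a ≈ + b [ + k ] → Coprime a k → Coprime b k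
  Coprime-resp-≈ {a} {b} {k} p cop {d} (d∣b , d∣k) = cop
      (∣⇒∣ℕ (≈-∣ (cong-mod (∣-trans (∣ℕ⇒∣ d∣k) (difference (≈-sym p)))) (∣ℕ⇒∣ d∣b)) , d∣k)

  Coprime-^ : ∀ {a m} n → Coprime a m → Coprime (a ℕ.^ n) m
  Coprime-^ {a} {m} zero    c = 1-coprimeTo m
  Coprime-^ {a} {m} (suc n) c = Coprime-* {a} {a ℕ.^ n} c (Coprime-^ n c)

  J-1 : ∀ h → J h 1 ≡ 1ℤ
  J-1 h = ∏-1 h (λ j j<h → proj₁ (sgn-mag-unique h (inj₁ refl) (s≤s z≤n) j<h
    (≈-reflexive (trans (cong +_ (ℕ.*-identityˡ (suc j))) (sym (*-identityˡ (+ suc j)))))))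

  ∑-term : ∀ n {f : ℕ → ℤ} i → i ℕ.< n → (∀ j → j ℕ.< n → 0ℤ ≤ f j) → f i ≤ ∑ n f
  ∑-term (suc n) {f} i i<1+n pos with i ℕ.≟ n
  ... | yes refl = subst (_≤ ∑ n f + f n) (+-identityˡ (f n)) (+-monoˡ-≤ (f n) (∑≥0 n (λ j j<n → pos j
        (ℕ.m<n⇒m<1+n j<n))))
  ... | no i≢n = subst (_≤ ∑ n f + f n) (+-identityʳ (f i))
                   (+-mono-≤ (∑-term n i (ℕ.≤∧≢⇒< (ℕ.≤-pred i<1+n) i≢n) (λ j j<n → pos j (ℕ.m<n⇒m<1+n j<n)))
                       (pos n ℕ.≤-refl))

  -- Values u² + M v² with v a small power of k and u ≡ 1 mod k large: pairwise distinct,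
  -- congruent to 1 mod k and with gcd(u, v) = 1.
  module NormFamily (M k V T′ : ℕ) {{_ : ℕ.NonZero M}} {{_ : ℕ.NonZero k}} (1<k : 1 ℕ.< k) where
    T = suc T′
    B = M ℕ.* (k ℕ.^ V ℕ.* k ℕ.^ V)
    Z = 1 ℕ.+ k ℕ.* (B ℕ.+ T)
    Y = suc Z

    v u : ℕ → ℕ
    v i = k ℕ.^ suc i
    u s = 1 ℕ.+ k ℕ.* (B ℕ.+ s)

    norm : ℕ → ℕ → ℕ
    norm s i = u s ℕ.* u s ℕ.+ M ℕ.* (v i ℕ.* v i)

    ν : ℕ → ℕ
    ν q = norm (q % T) (q / T)

    Mv²≤B : ∀ {i} → i ℕ.< V → M ℕ.* (v i ℕ.* v i) ℕ.≤ B
    Mv²≤B i<V = ℕ.*-monoʳ-≤ M (ℕ.*-mono-≤ le le)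
      where le = ℕ.^-monoʳ-≤ k i<V

    B<u : ∀ s → B ℕ.< u s
    B<u s = s≤s (ℕ.≤-trans (ℕ.m≤m+n B s) (ℕ.m≤n*m (B ℕ.+ s) k))

    norm≤ : ∀ s i → s ℕ.< T → i ℕ.< V → norm s i ℕ.≤ Y ℕ.* Y
    norm≤ s i s<T i<V = begin
      norm s i            ≤⟨ ℕ.+-mono-≤ (ℕ.*-mono-≤ u≤Z u≤Z) (Mv²≤B i<V) ⟩
      Z ℕ.* Z ℕ.+ B       ≤⟨ ℕ.+-monoʳ-≤ (Z ℕ.* Z) (ℕ.≤-trans (ℕ.<⇒≤ (B<u s)) u≤Z) ⟩
      Z ℕ.* Z ℕ.+ Z       ≤⟨ ℕ.m≤m+n (Z ℕ.* Z ℕ.+ Z) (Z ℕ.+ 1) ⟩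
      Z ℕ.* Z ℕ.+ Z ℕ.+ (Z ℕ.+ 1) ≡⟨ e Z ⟩
      Y ℕ.* Y             ∎
      where
      open ℕ.≤-Reasoning
      u≤Z : u s ℕ.≤ Z
      u≤Z = s≤s (ℕ.*-monoʳ-≤ k (ℕ.+-monoʳ-≤ B (ℕ.<⇒≤ s<T)))
      e : ∀ z → z ℕ.* z ℕ.+ z ℕ.+ (z ℕ.+ 1) ≡ suc z ℕ.* suc z
      e = ℕ.solve-∀

    norm-quotient : ℕ → ℕ → ℕ
    norm-quotient s i = 2 ℕ.* (B ℕ.+ s) ℕ.+ k ℕ.* (B ℕ.+ s) ℕ.* (B ℕ.+ s) ℕ.+ M ℕ.* (k ℕ.^ i ℕ.* (k ℕ.* k ℕ.^ i))

    norm≡1+ : ∀ s i → norm s i ≡ 1 ℕ.+ norm-quotient s i ℕ.* k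
    norm≡1+ s i = e k (B ℕ.+ s) M (k ℕ.^ i)
      where e : ∀ k x M y → (1 ℕ.+ k ℕ.* x) ℕ.* (1 ℕ.+ k ℕ.* x) ℕ.+ M ℕ.* (k ℕ.* y ℕ.* (k ℕ.* y))
                          ≡ 1 ℕ.+ (2 ℕ.* x ℕ.+ k ℕ.* x ℕ.* x ℕ.+ M ℕ.* (y ℕ.* (k ℕ.* y))) ℕ.* k
            e = ℕ.solve-∀

    norm≥1 : ∀ s i → 1 ℕ.≤ norm s i
    norm≥1 s i = s≤s z≤n

    v-strict : ∀ {i j} → i ℕ.< j → M ℕ.* (v i ℕ.* v i) ℕ.< M ℕ.* (v j ℕ.* v j)
    v-strict i<j = ℕ.*-monoʳ-< M (ℕ.*-mono-< le le)
      where le = ℕ.^-monoʳ-< k 1<k (s≤s i<j)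

    -- The smaller M v² on the left would require a larger u there. But every M v² is at most B,
    -- which is less than u, and therefore too small to bridge the gap between consecutive squares.
    no-collision : ∀ s s′ i i′ → i ℕ.< i′ → i′ ℕ.< V → norm s i ≢ norm s′ i′
    no-collision s s′ i i′ i<i′ i′<V eq = ℕ.<-irrefl refl (begin-strict
      u s′ ℕ.* u s′ ℕ.+ b′                     ≤⟨ ℕ.+-monoʳ-≤ (u s′ ℕ.* u s′) (ℕ.≤-trans (Mv²≤B i′<V) (ℕ.<⇒≤ (B<u s′)))
          ⟩
      u s′ ℕ.* u s′ ℕ.+ u s′                   <⟨ ℕ.m<m+n _ {suc (u s′)} (s≤s z≤n) ⟩
      u s′ ℕ.* u s′ ℕ.+ u s′ ℕ.+ suc (u s′)    ≡⟨ e (u s′) ⟩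
      suc (u s′) ℕ.* suc (u s′)                ≤⟨ ℕ.*-mono-≤ u′<u u′<u ⟩
      u s ℕ.* u s                              ≤⟨ ℕ.m≤m+n _ b ⟩
      u s ℕ.* u s ℕ.+ b                        ≡⟨ eq ⟩
      u s′ ℕ.* u s′ ℕ.+ b′                     ∎)
      where
      open ℕ.≤-Reasoning
      b = M ℕ.* (v i ℕ.* v i)
      b′ = M ℕ.* (v i′ ℕ.* v i′)
      u′<u : u s′ ℕ.< u s
      u′<u = ℕ.≰⇒> (λ u≤u′ → ℕ.<⇒≢ (ℕ.+-mono-≤-< (ℕ.*-mono-≤ u≤u′ u≤u′) (v-strict i<i′)) eq)
      e : ∀ z → z ℕ.* z ℕ.+ z ℕ.+ suc z ≡ suc z ℕ.* suc z
      e = ℕ.solve-∀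

    square-injective : ∀ {x y} → x ℕ.* x ≡ y ℕ.* y → x ≡ y
    square-injective {x} {y} eq with ℕ.<-cmp x y
    ... | tri≈ _ e _ = e
    ... | tri< lt _ _ = contradiction eq (ℕ.<⇒≢ (ℕ.*-mono-< lt lt))
    ... | tri> _ _ gt = contradiction (sym eq) (ℕ.<⇒≢ (ℕ.*-mono-< gt gt))

    norm-injective : ∀ s s′ i i′ → i ℕ.< V → i′ ℕ.< V → norm s i ≡ norm s′ i′ → s ≡ s′ × i ≡ i′
    norm-injective s s′ i i′ i< i′< eq with ℕ.<-cmp i i′
    ... | tri< lt _ _ = contradiction eq (no-collision s s′ i i′ lt i′<)
    ... | tri> _ _ gt = contradiction (sym eq) (no-collision s′ s i′ i gt i<)
    ... | tri≈ _ refl _ = ℕ.+-cancelˡ-≡ B s s′ (ℕ.*-cancelˡ-≡ (B ℕ.+ s) (B ℕ.+ s′) k (ℕ.suc-injective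
            (square-injective {u s} {u s′} (ℕ.+-cancelʳ-≡ (M ℕ.* (v i ℕ.* v i)) (u s ℕ.* u s) (u s′ ℕ.* u s′) eq)))) ,
                refl

    quotient< : ∀ q → q ℕ.< V ℕ.* T → q / T ℕ.< V
    quotient< q q< = ℕ.m<n*o⇒m/o<n q<

    ν-injective : ∀ q q′ → q ℕ.< V ℕ.* T → q′ ℕ.< V ℕ.* T → ν q ≡ ν q′ → q ≡ q′
    ν-injective q q′ q< q′< eq =
      let r , d = norm-injective (q % T) (q′ % T) (q / T) (q′ / T) (quotient< q q<) (quotient< q′ q′<) eq in
      trans (ℕ.m≡m%n+[m/n]*n q T) (trans (cong₂ (λ a b → a ℕ.+ b ℕ.* T) r d) (sym (ℕ.m≡m%n+[m/n]*n q′ T)))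

    ν≤ : ∀ q → q ℕ.< V ℕ.* T → ν q ℕ.≤ Y ℕ.* Y
    ν≤ q q< = norm≤ (q % T) (q / T) (ℕ.m%n<n q T) (quotient< q q<)

  -- For V = 2k + 1 and T = 5 + 2kb the left side is 2Y + 1 and the right side is V T, the number of
  -- norms in the family.
  enough-identity : ∀ k b → suc (2 ℕ.* suc (1 ℕ.+ k ℕ.* (b ℕ.+ suc (4 ℕ.+ 2 ℕ.* (k ℕ.* b))))) ≡ suc (k ℕ.+ k) ℕ.* suc
      (4 ℕ.+ 2 ℕ.* (k ℕ.* b))
  enough-identity = ℕ.solve-∀

  -- M = 4t + 3, and χ is the quadratic character of ℚ(√-M), made zero at the even numbers.
  module Three (t : ℕ) where
    h = odd t
    M = odd h
    k = 2 ℕ.* M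

    M∣k : M ℕ.∣ k
    M∣k = ℕ.n∣m*n 2

    to-M : ∀ {n} → Coprime n k → Coprime n M
    to-M cop (d∣n , d∣M) = cop (d∣n , ℕ.∣-trans d∣M M∣k)

    χ′ : ∀ n → Dec (Coprime n k) → ℤ
    χ′ n (yes _) = J h n
    χ′ n (no  _) = 0ℤ

    private
      χ₀ : ℕ → ℤ
      χ₀ n = χ′ n (coprime? n k)

      χ₀-yes : ∀ {n} → Coprime n k → χ₀ n ≡ J h n
      χ₀-yes {n} c with coprime? n k
      ... | yes _ = refl
      ... | no ¬c = ⊥-elim (¬c c)

      χ₀-no : ∀ {n} → ¬ Coprime n k → χ₀ n ≡ 0ℤ
      χ₀-no {n} ¬c with coprime? n k
      ... | yes c = ⊥-elim (¬c c)
      ... | no _  = refl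

    character : Character k
    character = record
      { χ = χ₀
      ; χ-coprime = λ {n} c → subst IsSign (sym (χ₀-yes c)) (J-isSign h n)
      ; χ-zero = χ₀-no
      ; χ-* = mult
      ; χ-periodic = periodic
      ; χ-1 = trans (χ₀-yes (1-coprimeTo k)) (J-1 h)
      }
      where
      mult : ∀ a b → χ₀ (a ℕ.* b) ≡ χ₀ a * χ₀ b
      mult a b = go (coprime? a k) (coprime? b k)
        where
        go : Dec (Coprime a k) → Dec (Coprime b k) → χ₀ (a ℕ.* b) ≡ χ₀ a * χ₀ b
        go (yes ca) (yes cb) = trans (χ₀-yes (Coprime-* {a} {b} ca cb)) (trans (J-* h a b (to-M ca) (to-M cb))
            (cong₂ _*_ (sym (χ₀-yes ca)) (sym (χ₀-yes cb))))
        go (no ¬ca) _ = trans (χ₀-no (λ c → ¬ca (Coprime-∣ˡ (ℕ.m∣m*n b) c))) (sym (cong (_* χ₀ b) (χ₀-no ¬ca)))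
        go (yes _) (no ¬cb) = trans (χ₀-no (λ c → ¬cb (Coprime-∣ˡ (ℕ.n∣m*n a) c)))
            (sym (trans (cong (χ₀ a *_) (χ₀-no ¬cb)) (*-zeroʳ (χ₀ a))))
      periodic : ∀ {a b} → + a ≈ + b [ + k ] → χ₀ a ≡ χ₀ b
      periodic {a} {b} p = go (coprime? a k)
        where
        go : Dec (Coprime a k) → χ₀ a ≡ χ₀ b
        go (yes ca) = trans (χ₀-yes ca) (trans (J-cong h a b (to-M cb) (cong-mod (∣-trans (∣ℕ⇒∣ M∣k) (difference p))))
            (sym (χ₀-yes cb)))
          where cb = Coprime-resp-≈ p ca
        go (no ¬ca) = trans (χ₀-no ¬ca) (sym (χ₀-no (λ cb → ¬ca (Coprime-resp-≈ (≈-sym p) cb))))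

    open Character character public
    open DivisorSum character public
    open Hyperbola character public

    χ-J : ∀ {n} → Coprime n k → χ n ≡ J h n
    χ-J = χ₀-yes

    coprime⇒odd : ∀ {n} → Coprime n k → ∃[ g ] n ≡ odd g
    coprime⇒odd {n} cop with even⊎odd n
    ... | g , inj₂ e = g , e
    ... | g , inj₁ e = contradiction (cop {2} (ℕ.divides g (trans e (d g)) , ℕ.m∣m*n M)) (λ ())
      where d : ∀ g → g ℕ.+ g ≡ g ℕ.* 2
            d = ℕ.solve-∀

    -- By reciprocity χ(p) is the symbol (-M/p), and Euler's criterion extracts a root from its
    -- value 1. The residue -M is written as (p - 1) M.
    root : ∀ p → Prime p → Coprime p k → χ p ≡ 1ℤ → RootMod (+ M) p
    root p pr cop χp = go (coprime⇒odd cop)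
      where
      go : (∃[ g ] p ≡ odd g) → RootMod (+ M) p
      go (g , refl) = + r , subst (+ odd g ∣_) (e (+ r * + r) (+ (g ℕ.+ g)) (+ M)) (∣m∣n⇒∣m+n (difference r²≈)
          (∣n⇒∣m*n (+ M) (∣-refl {+ odd g})))
        where
        M-coprime : Coprime M (odd g)
        M-coprime = Coprimality.sym (to-M cop)
        res = residue g pr ((g ℕ.+ g) ℕ.* M) (Coprime-* {g ℕ.+ g} {M} (pred-coprime g) M-coprime)
                (trans (J-negated t g M-coprime) (trans (sym (χ-J cop)) χp))
        r = proj₁ res
        r²≈ : + r * + r ≈ + (g ℕ.+ g) * + M [ + odd g ]
        r²≈ = ≈-trans (proj₂ res) (≈-reflexive (pos-* (g ℕ.+ g) M))
        e : ∀ x y m → (x - y * m) + m * (1ℤ + y) ≡ x + m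
        e = solve-∀

    -- Modulo d one has -M v² ≡ u² with v invertible, so (-M/d) = 1, and reciprocity gives (d/M) =
    -- 1. This is an argument about Jacobi symbols and covers composite d, so every divisor of such
    -- a norm contributes 1 to its divisor sum.
    χ-norm-divisor : ∀ {u v d} → Coprime (u ℕ.* u ℕ.+ M ℕ.* (v ℕ.* v)) k → Coprime v (u ℕ.* u ℕ.+ M ℕ.* (v ℕ.* v)) →
                     d ℕ.∣ u ℕ.* u ℕ.+ M ℕ.* (v ℕ.* v) → χ d ≡ 1ℤ
    χ-norm-divisor {u} {v} {d} cnk cvn d∣n = go (coprime⇒odd cdk)
      where
      n = u ℕ.* u ℕ.+ M ℕ.* (v ℕ.* v)
      cdk : Coprime d k
      cdk = Coprime-∣ˡ d∣n cnk
      cMd : Coprime M d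
      cMd = Coprimality.sym (to-M cdk)
      cvd : Coprime v d
      cvd = Coprimality.sym (Coprime-∣ˡ d∣n (Coprimality.sym cvn))
      cMvvd : Coprime (M ℕ.* (v ℕ.* v)) d
      cMvvd = Coprime-* {M} {v ℕ.* v} cMd (Coprime-* {v} {v} cvd cvd)
      cud : Coprime u d
      cud {e} (e∣u , e∣d) = cMvvd (ℕ.∣m+n∣m⇒∣n (ℕ.∣-trans e∣d d∣n) (ℕ.∣-trans e∣u (ℕ.m∣m*n u)) , e∣d)
      go : (∃[ g ] d ≡ odd g) → χ d ≡ 1ℤ
      go (g , refl) = begin
        χ (odd g)                                     ≡⟨ χ-J cdk ⟩
        J h (odd g)                                   ≡⟨ J-negated t g cMd ⟨
        J g x                                         ≡⟨ *-identityʳ (J g x) ⟨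
        J g x * 1ℤ                                    ≡⟨ cong (J g x *_) (J-square g v cvd) ⟨
        J g x * J g (v ℕ.* v)                         ≡⟨ J-* g x (v ℕ.* v) cxd (Coprime-* {v} {v} cvd cvd) ⟨
        J g (x ℕ.* (v ℕ.* v))                         ≡⟨ J-cong g (x ℕ.* (v ℕ.* v)) (u ℕ.* u) (Coprime-* {u} {u} cud
            cud) close ⟩
        J g (u ℕ.* u)                                 ≡⟨ J-square g u cud ⟩
        1ℤ ∎
        where
        open ≡-Reasoning
        x = (g ℕ.+ g) ℕ.* M
        cxd : Coprime x (odd g)
        cxd = Coprime-* {g ℕ.+ g} {M} (pred-coprime g) cMd
        pos-x : + (x ℕ.* (v ℕ.* v)) ≡ + (g ℕ.+ g) * + M * (+ v * + v)
        pos-x = trans (pos-* x (v ℕ.* v)) (cong₂ _*_ (pos-* (g ℕ.+ g) M) (pos-* v v))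
        pos-n : + n ≡ + u * + u + + M * (+ v * + v)
        pos-n = trans (pos-+ (u ℕ.* u) (M ℕ.* (v ℕ.* v))) (cong₂ _+_ (pos-* u u) (trans (pos-* M (v ℕ.* v))
            (cong (+ M *_) (pos-* v v))))
        e : ∀ y m u v → (m * (v * v)) * (1ℤ + y) - (u * u + m * (v * v)) ≡ y * m * (v * v) - u * u
        e = solve-∀
        close : + (x ℕ.* (v ℕ.* v)) ≈ + (u ℕ.* u) [ + odd g ]
        close = cong-mod (subst (+ odd g ∣_) (trans (e (+ (g ℕ.+ g)) (+ M) (+ u) (+ v)) (cong₂ _-_ (sym pos-x)
            (sym (pos-* u u))))
          (∣m∣n⇒∣m-n (∣n⇒∣m*n (+ M * (+ v * + v)) (∣-refl {+ odd g})) (subst (+ odd g ∣_) pos-n (∣ℕ⇒∣ d∣n))))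

    G-norm≥1 : ∀ {u v} n → n ≡ u ℕ.* u ℕ.+ M ℕ.* (v ℕ.* v) → 1 ℕ.≤ n → Coprime n k → Coprime v n → 1ℤ ≤ G n
    G-norm≥1 {u} {v} n refl 1≤n cnk cvn = subst (_≤ G n) first (∑-term n 0 1≤n nonneg)
      where
      first : ι (1 ℕ.∣? n) * χ 1 ≡ 1ℤ
      first = cong₂ _*_ (ι-yes (1 ℕ.∣? n) (ℕ.1∣ n)) χ-1
      nonneg : ∀ j → j ℕ.< n → 0ℤ ≤ ι (suc j ℕ.∣? n) * χ (suc j)
      nonneg j _ with suc j ℕ.∣? n
      ... | yes d = subst (0ℤ ≤_) (sym (trans (*-identityˡ (χ (suc j))) (χ-norm-divisor {u} {v} cnk cvn d))) (+≤+ z≤n)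
      ... | no _  = ≤-refl

    G≥0 : ∀ n → 1 ℕ.≤ n → Coprime n k → 0ℤ ≤ G n
    G≥0 n 1≤n cop = [ (λ eq → ≤-reflexive (sym eq)) , (λ c → ≤-trans (+≤+ z≤n) (proj₁ c)) ]′
                    (classify character (+ M) root n 1≤n cop)

    positive⇒normLike : ∀ n → 1 ℕ.≤ n → Coprime n k → 0ℤ < G n → NormLike character (+ M) root n
    positive⇒normLike n 1≤n cop pos = [ (λ eq → ⊥-elim (<-irrefl (sym eq) pos)) , proj₂ ]′
                                      (classify character (+ M) root n 1≤n cop)

    ≈1⇒coprime : ∀ {n} → + n ≈ 1ℤ [ + k ] → Coprime n k
    ≈1⇒coprime p = Coprime-resp-≈ {1} (≈-sym p) (1-coprimeTo k)

    -- All terms in the class of 1 are nonnegative, each listed value contributes at least 1, and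
    -- injectivity of ν prevents counting a value twice.
    S₁-lower : ∀ X W (ν : ℕ → ℕ) → (∀ q → q ℕ.< W → 1 ℕ.≤ ν q × ν q ℕ.≤ X × + ν q ≈ 1ℤ [ + k ] × 1ℤ ≤ G (ν q)) →
               (∀ q q′ → q ℕ.< W → q′ ℕ.< W → ν q ≡ ν q′ → q ≡ q′) → + W ≤ S 1 X
    S₁-lower X W ν prop inj = begin
      + W                                                      ≡⟨ trans (∑-const W 1ℤ) (*-identityʳ (+ W)) ⟨
      ∑ W (λ _ → 1ℤ)                                           ≡⟨ ∑-cong W (λ q q<W → sym (hit q q<W)) ⟩
      ∑ W (λ q → ∑ X (λ j → ι (ν q ℕ.≟ suc j)))                ≡⟨ ∑-swap W X (λ q j → ι (ν q ℕ.≟ suc j)) ⟩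
      ∑ X (λ j → ∑ W (λ q → ι (ν q ℕ.≟ suc j)))                ≤⟨ ∑-mono X (λ j _ → pointwise j) ⟩
      S 1 X ∎
      where
      open ≤-Reasoning
      hit : ∀ q → q ℕ.< W → ∑ X (λ j → ι (ν q ℕ.≟ suc j)) ≡ 1ℤ
      hit q q<W = trans (∑-single X (ν q ℕ.∸ 1) {λ j → ι (ν q ℕ.≟ suc j)} (subst (ℕ._≤ X) (sym 1+pred)
          (proj₁ (proj₂ (prop q q<W))))
          (λ j _ j≢ → ι-no (ν q ℕ.≟ suc j) (λ eq → j≢ (cong (ℕ._∸ 1) (sym eq)))))
          (ι-yes (ν q ℕ.≟ suc (ν q ℕ.∸ 1)) (sym 1+pred))
        where 1+pred = ℕ.m+[n∸m]≡n (proj₁ (prop q q<W))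
      rhs≥0 : ∀ j → 0ℤ ≤ ι (R? 1 (suc j)) * G (suc j)
      rhs≥0 j = go (R? 1 (suc j))
        where
        go : (r : Dec (+ suc j ≈ 1ℤ [ + k ])) → 0ℤ ≤ ι r * G (suc j)
        go (yes r) = subst (0ℤ ≤_) (sym (*-identityˡ (G (suc j)))) (G≥0 (suc j) (s≤s z≤n) (≈1⇒coprime r))
        go (no _)  = ≤-refl
      pointwise : ∀ j → ∑ W (λ q → ι (ν q ℕ.≟ suc j)) ≤ ι (R? 1 (suc j)) * G (suc j)
      pointwise j = go (∑ W (λ q → ι (ν q ℕ.≟ suc j)) ≟ 0ℤ)
       where
       go : Dec (∑ W (λ q → ι (ν q ℕ.≟ suc j)) ≡ 0ℤ) → ∑ W (λ q → ι (ν q ℕ.≟ suc j)) ≤ ι (R? 1 (suc j)) * G (suc j)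
       go (yes eq) = subst (_≤ ι (R? 1 (suc j)) * G (suc j)) (sym eq) (rhs≥0 j)
       go (no ne) = ≤-trans (∑-ι-unique W (λ q → ν q ℕ.≟ suc j) (λ q q′ q< q′< e e′ → inj q q′ q< q′<
           (trans e (sym e′)))) (found (∑-ι-none W (λ q → ν q ℕ.≟ suc j) ne))
        where
        found : (∃[ q ] q ℕ.< W × ν q ≡ suc j) → 1ℤ ≤ ι (R? 1 (suc j)) * G (suc j)
        found (q , q<W , eq) = subst (1ℤ ≤_) (sym (trans (cong (_* G (suc j)) (ι-yes (R? 1 (suc j))
            (subst (λ z → + z ≈ 1ℤ [ + k ]) eq (proj₁ (proj₂ (proj₂ (prop q q<W)))))))
          (*-identityˡ (G (suc j))))) (subst (λ z → 1ℤ ≤ G z) eq (proj₂ (proj₂ (proj₂ (prop q q<W)))))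

    ≈1-of : ∀ n w → n ≡ 1 ℕ.+ w ℕ.* k → + n ≈ 1ℤ [ + k ]
    ≈1-of n w eq = cong-mod (divides (+ w) (trans (cong (_- 1ℤ) (trans (cong +_ eq) (trans (pos-+ 1 (w ℕ.* k))
        (cong (λ z → 1ℤ + z) (pos-* w k))))) (e (+ w * + k))))
      where e : ∀ x → 1ℤ + x - 1ℤ ≡ x
            e = solve-∀

    S₁-large : ∀ V T′ → let open NormFamily M k V T′ (s≤s (s≤s z≤n)) in + (V ℕ.* T) ≤ S 1 (Y ℕ.* Y)
    S₁-large V T′ = S₁-lower (Y ℕ.* Y) (V ℕ.* T) ν prop ν-injective
      where
      open NormFamily M k V T′ (s≤s (s≤s z≤n))
      prop : ∀ q → q ℕ.< V ℕ.* T → 1 ℕ.≤ ν q × ν q ℕ.≤ Y ℕ.* Y × + ν q ≈ 1ℤ [ + k ] × 1ℤ ≤ G (ν q)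
      prop q q< = norm≥1 s i , ν≤ q q< , ≈1 , G-norm≥1 {u s} {v i} (ν q) refl (norm≥1 s i) (≈1⇒coprime ≈1)
                    (Coprime-^ {k} (suc i) (Coprimality.sym (≈1⇒coprime ≈1)))
        where
        s = q % T
        i = q / T
        ≈1 : + norm s i ≈ 1ℤ [ + k ]
        ≈1 = ≈1-of (norm s i) (norm-quotient s i) (norm≡1+ s i)

    NormIn : ℕ → Set
    NormIn c = ∃[ n ] 1 ℕ.≤ n × + n ≈ + c [ + k ] × Coprime n k × NormLike character (+ M) root n

    norm-in-class : ∀ c → χ c ≡ 1ℤ → NormIn c
    norm-in-class c χc = extract (∑-positive (Y ℕ.* Y) S-positive)
      where
      -- The family has V T members, while 2Y grows like 2k T; so V must exceed 2k. The constant
      -- `B₀` depends on V alone, and T is chosen after it.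
      V = suc (k ℕ.+ k)
      B₀ = M ℕ.* (k ℕ.^ V ℕ.* k ℕ.^ V)
      T′ = 4 ℕ.+ 2 ℕ.* (k ℕ.* B₀)
      open NormFamily M k V T′ (s≤s (s≤s z≤n)) using (T; Y)
      enough : 2 ℕ.* Y ℕ.< V ℕ.* T
      enough = ℕ.≤-reflexive (enough-identity k B₀)
      S-positive : 0ℤ < S c (Y ℕ.* Y)
      S-positive = <-≤-trans (≤-<-trans (≤-reflexive (sym (+-inverseʳ (+ (2 ℕ.* Y)))))
                     (+-monoˡ-< (- + (2 ℕ.* Y)) (<-≤-trans (+<+ enough) (S₁-large V T′)))) (equidistribution c 1 Y χc
                         χ-1)
      extract : (∃[ j ] j ℕ.< Y ℕ.* Y × 0ℤ < ι (R? c (suc j)) * G (suc j)) →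
                NormIn c
      extract (j , _ , pos) = go (R? c (suc j)) pos
        where
        go : (r : Dec (+ suc j ≈ + c [ + k ])) → 0ℤ < ι r * G (suc j) →
             NormIn c
        go (no _) (+<+ ())
        go (yes r) pos = finish (coprime? (suc j) k)
          where
          finish : Dec (Coprime (suc j) k) → NormIn c
          finish (no ¬cop) = contradiction (trans (sym (χ-zero ¬cop)) (trans (χ-periodic r) χc)) (λ ())
          finish (yes cop) = suc j , s≤s z≤n , r , cop ,
            positive⇒normLike (suc j) (s≤s z≤n) cop (subst (0ℤ <_) (*-identityˡ (G (suc j))) pos)

-- Hermite reduction of positive ternary forms.

module TernaryForms where

  open import Data.Integer hiding (suc; _/_; _%_)
  open import Data.Integer.Properties
  open import Data.Integer.Divisibility.Signed
  open import Data.Integer.Tactic.RingSolver using (solve-∀)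
  open import Data.Integer.DivMod using (_/ℕ_; _%ℕ_; a≡a%ℕn+[a/ℕn]*n; n%ℕd<d)

  nearest : ∀ x m → 0ℤ < m → ∃[ k ] (- m ≤ x + + 2 * m * k × x + + 2 * m * k ≤ m)
  nearest x (+ zero) (+<+ ())
  nearest x (+ suc n) _ = - q , lower , upper
    where
    m = + suc n
    d = 2 ℕ.* suc n
    q = (x + m) /ℕ d
    r = (x + m) %ℕ d
    e₁ : ∀ x m q → x + + 2 * m * (- q) ≡ (x + m) - q * (+ 2 * m) - m
    e₁ = solve-∀
    e₂ : ∀ r y m → r + y - y - m ≡ r - m
    e₂ = solve-∀
    x≡ : x + + 2 * m * (- q) ≡ + r - m
    x≡ = trans (e₁ x m q) (trans (cong (λ z → z - q * (+ 2 * m) - m) (trans (a≡a%ℕn+[a/ℕn]*n (x + m) d)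
        (cong (λ z → + r + q * z) (pos-* 2 (suc n))))) (e₂ (+ r) (q * (+ 2 * m)) m))
    lower : - m ≤ x + + 2 * m * (- q)
    lower = subst₂ _≤_ (+-identityˡ (- m)) (sym x≡) (+-monoˡ-≤ (- m) {0ℤ} {+ r} (+≤+ z≤n))
    e₃ : ∀ m → + 2 * m - m ≡ m
    e₃ = solve-∀
    upper : x + + 2 * m * (- q) ≤ m
    upper = ≤-trans (≤-reflexive x≡) (≤-trans (+-monoˡ-≤ (- m) {+ r} {+ d} (+≤+ (ℕ.<⇒≤ (n%ℕd<d (x + m) d))))
              (≤-reflexive (trans (cong (_- m) (pos-* 2 (suc n))) (e₃ m))))

  0≤sq : ∀ x → 0ℤ ≤ x * x
  0≤sq (+ n)    = subst (0ℤ ≤_) (pos-* n n) (+≤+ z≤n)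
  0≤sq -[1+ n ] = +≤+ z≤n

  0<* : ∀ {x y} → 0ℤ < x → 0ℤ < y → 0ℤ < x * y
  0<* {x} {y} 0<x 0<y = subst (_< x * y) (*-zeroʳ x) (*-monoˡ-<-pos x {{positive 0<x}} 0<y)

  0≤* : ∀ {x y} → 0ℤ ≤ x → 0ℤ ≤ y → 0ℤ ≤ x * y
  0≤* {x} {y} 0≤x 0≤y = subst (_≤ x * y) (*-zeroʳ x) (*-monoˡ-≤-nonNeg x {{nonNegative 0≤x}} 0≤y)

  pos-factor : ∀ {x y} → 0ℤ < x → 0ℤ < x * y → 0ℤ < y
  pos-factor {x} {y} 0<x 0<xy = *-cancelˡ-<-nonNeg x {{nonNegative (<⇒≤ 0<x)}} (subst (_< x * y) (sym (*-zeroʳ x)) 0<xy)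

  from-diff : ∀ {a b c} → 0ℤ ≤ c → b - a ≡ c → a ≤ b
  from-diff 0≤c eq = 0≤i-j⇒j≤i (subst (0ℤ ≤_) (sym eq) 0≤c)

  from-diff-< : ∀ {a b c} → 0ℤ < c → b - a ≡ c → a < b
  from-diff-< {a} {b} 0<c eq = subst₂ _<_ (+-identityˡ a) (trans (cong (_+ a) (sym eq)) (e a b)) (+-monoˡ-< a 0<c)
    where e : ∀ a b → b - a + a ≡ b
          e = solve-∀

  sq-bound : ∀ {x m} → - m ≤ x → x ≤ m → x * x ≤ m * m
  sq-bound {x} {m} l u = from-diff (0≤* (i≤j⇒0≤j-i l) (i≤j⇒0≤j-i u)) (e x m)
    where e : ∀ x m → m * m - x * x ≡ (x - - m) * (m - x)
          e = solve-∀

  -- The vector (x, y, z) of value n has an even inner product with every lattice vector.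
  record Form (p n : ℤ) : Set where
    field
      a b c d e f x y z : ℤ
      a>0   : 0ℤ < a
      β>0   : 0ℤ < + 4 * a * b - f * f
      disc  : + 4 * a * b * c + d * e * f - a * d * d - b * e * e - c * f * f ≡ p
      value : a * x * x + b * y * y + c * z * z + d * y * z + e * x * z + f * x * y ≡ n
      even₁ : + 2 ∣ f * y + e * z
      even₂ : + 2 ∣ f * x + d * z
      even₃ : + 2 ∣ e * x + d * y
    β κ γ : ℤ
    β = + 4 * a * b - f * f
    κ = + 2 * a * d - e * f
    γ = + 4 * a * c - e * e

  open Form

  module _ {p n : ℤ} (p>0 : 0ℤ < p) where

    -- Completing the square, 4a times the form is (2ax + fy + ez)² + βy² + 2κyz + γz². The left
    -- side is the determinant of the binary tail.
    βγ : ∀ (F : Form p n) → β F * γ F - κ F * κ F ≡ + 4 * a F * p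
    βγ F = trans (lemma (a F) (b F) (c F) (d F) (e F) (f F)) (cong (+ 4 * a F *_) (disc F))
      where
      lemma : ∀ a b c d e f → (+ 4 * a * b - f * f) * (+ 4 * a * c - e * e) - (+ 2 * a * d - e * f) * (+ 2 * a * d
          - e * f)
              ≡ + 4 * a * (+ 4 * a * b * c + d * e * f - a * d * d - b * e * e - c * f * f)
      lemma = solve-∀

    γ>0 : ∀ (F : Form p n) → 0ℤ < γ F
    γ>0 F = pos-factor (β>0 F) (subst (0ℤ <_) (eq (β F * γ F) (κ F * κ F))
              (+-mono-<-≤ (subst (0ℤ <_) (sym (βγ F)) (0<* (0<* {+ 4} (+<+ (s≤s z≤n)) (a>0 F)) p>0)) (0≤sq (κ F))))
      where eq : ∀ x y → x - y + y ≡ x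
            eq = solve-∀

    b>0 : ∀ (F : Form p n) → 0ℤ < b F
    b>0 F = pos-factor {+ 4 * a F} (0<* {+ 4} (+<+ (s≤s z≤n)) (a>0 F)) (subst (0ℤ <_) (eq (+ 4 * a F * b F) (f F * f F))
        (+-mono-<-≤ (β>0 F) (0≤sq (f F))))
      where eq : ∀ x y → x - y + y ≡ x
            eq = solve-∀

    swap-xy : Form p n → Form p n
    swap-xy F = record
      { a = b F ; b = a F ; c = c F ; d = e F ; e = d F ; f = f F ; x = y F ; y = x F ; z = z F
      ; a>0 = b>0 F
      ; β>0 = subst (0ℤ <_) (e₁ (a F) (b F) (f F)) (β>0 F)
      ; disc = trans (e₂ (a F) (b F) (c F) (d F) (e F) (f F)) (disc F)
      ; value = trans (e₃ (a F) (b F) (c F) (d F) (e F) (f F) (x F) (y F) (z F)) (value F)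
      ; even₁ = even₂ F ; even₂ = even₁ F ; even₃ = subst (+ 2 ∣_) (+-comm (e F * x F) (d F * y F)) (even₃ F)
      }
      where
      e₁ : ∀ a b f → + 4 * a * b - f * f ≡ + 4 * b * a - f * f
      e₁ = solve-∀
      e₂ : ∀ a b c d e f → + 4 * b * a * c + e * d * f - b * e * e - a * d * d - c * f * f
           ≡ + 4 * a * b * c + d * e * f - a * d * d - b * e * e - c * f * f
      e₂ = solve-∀
      e₃ : ∀ a b c d e f x y z → b * y * y + a * x * x + c * z * z + e * x * z + d * y * z + f * y * x
           ≡ a * x * x + b * y * y + c * z * z + d * y * z + e * x * z + f * x * y
      e₃ = solve-∀

    swap-yz : Form p n → Form p n
    swap-yz F = record
      { a = a F ; b = c F ; c = b F ; d = d F ; e = f F ; f = e F ; x = x F ; y = z F ; z = y F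
      ; a>0 = a>0 F
      ; β>0 = γ>0 F
      ; disc = trans (e₂ (a F) (b F) (c F) (d F) (e F) (f F)) (disc F)
      ; value = trans (e₃ (a F) (b F) (c F) (d F) (e F) (f F) (x F) (y F) (z F)) (value F)
      ; even₁ = subst (+ 2 ∣_) (+-comm (f F * y F) (e F * z F)) (even₁ F) ; even₂ = even₃ F ; even₃ = even₂ F
      }
      where
      e₂ : ∀ a b c d e f → + 4 * a * c * b + d * f * e - a * d * d - c * f * f - b * e * e
           ≡ + 4 * a * b * c + d * e * f - a * d * d - b * e * e - c * f * f
      e₂ = solve-∀
      e₃ : ∀ a b c d e f x y z → a * x * x + c * z * z + b * y * y + d * z * y + f * x * y + e * x * z
           ≡ a * x * x + b * y * y + c * z * z + d * y * z + e * x * z + f * x * y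
      e₃ = solve-∀

    -- second basis vector += k × first
    shift-yx : ℤ → Form p n → Form p n
    shift-yx k F = record
      { a = a F ; b = b F + f F * k + a F * k * k ; c = c F ; d = d F + e F * k ; e = e F ; f = f F + + 2 * a F * k
      ; x = x F - k * y F ; y = y F ; z = z F
      ; a>0 = a>0 F
      ; β>0 = subst (0ℤ <_) (e₁ (a F) (b F) (f F) k) (β>0 F)
      ; disc = trans (e₂ (a F) (b F) (c F) (d F) (e F) (f F) k) (disc F)
      ; value = trans (e₃ (a F) (b F) (c F) (d F) (e F) (f F) (x F) (y F) (z F) k) (value F)
      ; even₁ = subst (+ 2 ∣_) (e₄ (a F) (e F) (f F) (y F) (z F) k) (∣m∣n⇒∣m+n (even₁ F) (divides (a F * k * y F) refl))
      ; even₂ = subst (+ 2 ∣_) (e₅ (a F) (b F) (d F) (e F) (f F) (x F) (y F) (z F) k)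
                  (∣m∣n⇒∣m+n (∣m∣n⇒∣m+n (even₂ F) (∣n⇒∣m*n k (even₁ F))) (divides (a F * k * x F - f F * k * y F - a
                      F * k * k * y F) refl))
      ; even₃ = subst (+ 2 ∣_) (e₆ (d F) (e F) (x F) (y F) k) (even₃ F)
      }
      where
      e₁ : ∀ a b f k → + 4 * a * b - f * f ≡ + 4 * a * (b + f * k + a * k * k) - (f + + 2 * a * k) * (f + + 2 * a * k)
      e₁ = solve-∀
      e₂ : ∀ a b c d e f k → + 4 * a * (b + f * k + a * k * k) * c + (d + e * k) * e * (f + + 2 * a * k)
          - a * (d + e * k) * (d + e * k)
             - (b + f * k + a * k * k) * e * e - c * (f + + 2 * a * k) * (f + + 2 * a * k)
           ≡ + 4 * a * b * c + d * e * f - a * d * d - b * e * e - c * f * f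
      e₂ = solve-∀
      e₃ : ∀ a b c d e f x y z k → a * (x - k * y) * (x - k * y) + (b + f * k + a * k * k) * y * y + c * z * z
          + (d + e * k) * y * z
             + e * (x - k * y) * z + (f + + 2 * a * k) * (x - k * y) * y
           ≡ a * x * x + b * y * y + c * z * z + d * y * z + e * x * z + f * x * y
      e₃ = solve-∀
      e₄ : ∀ a e f y z k → f * y + e * z + a * k * y * + 2 ≡ (f + + 2 * a * k) * y + e * z
      e₄ = solve-∀
      e₅ : ∀ a b d e f x y z k → f * x + d * z + k * (f * y + e * z) + (a * k * x - f * k * y - a * k * k * y) * + 2
           ≡ (f + + 2 * a * k) * (x - k * y) + (d + e * k) * z
      e₅ = solve-∀
      e₆ : ∀ d e x y k → e * x + d * y ≡ e * (x - k * y) + (d + e * k) * y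
      e₆ = solve-∀

    -- third basis vector += k × second
    shift-zy : ℤ → Form p n → Form p n
    shift-zy k F = record
      { a = a F ; b = b F ; c = c F + d F * k + b F * k * k ; d = d F + + 2 * b F * k ; e = e F + f F * k ; f = f F
      ; x = x F ; y = y F - k * z F ; z = z F
      ; a>0 = a>0 F
      ; β>0 = β>0 F
      ; disc = trans (e₂ (a F) (b F) (c F) (d F) (e F) (f F) k) (disc F)
      ; value = trans (e₃ (a F) (b F) (c F) (d F) (e F) (f F) (x F) (y F) (z F) k) (value F)
      ; even₁ = subst (+ 2 ∣_) (e₆ (e F) (f F) (y F) (z F) k) (even₁ F)
      ; even₂ = subst (+ 2 ∣_) (e₄ (b F) (d F) (f F) (x F) (z F) k) (∣m∣n⇒∣m+n (even₂ F) (divides (b F * k * z F) refl))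
      ; even₃ = subst (+ 2 ∣_) (e₅ (b F) (d F) (e F) (f F) (x F) (y F) (z F) k)
                  (∣m∣n⇒∣m+n (∣m∣n⇒∣m+n (even₃ F) (∣n⇒∣m*n k (even₂ F))) (divides (b F * k * y F - d F * k * z F - b
                      F * k * k * z F) refl))
      }
      where
      e₂ : ∀ a b c d e f k → + 4 * a * b * (c + d * k + b * k * k) + (d + + 2 * b * k) * (e + f * k) * f
          - a * (d + + 2 * b * k) * (d + + 2 * b * k)
             - b * (e + f * k) * (e + f * k) - (c + d * k + b * k * k) * f * f
           ≡ + 4 * a * b * c + d * e * f - a * d * d - b * e * e - c * f * f
      e₂ = solve-∀
      e₃ : ∀ a b c d e f x y z k → a * x * x + b * (y - k * z) * (y - k * z) + (c + d * k + b * k * k) * z * z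
          + (d + + 2 * b * k) * (y - k * z) * z
             + (e + f * k) * x * z + f * x * (y - k * z)
           ≡ a * x * x + b * y * y + c * z * z + d * y * z + e * x * z + f * x * y
      e₃ = solve-∀
      e₄ : ∀ b d f x z k → f * x + d * z + b * k * z * + 2 ≡ f * x + (d + + 2 * b * k) * z
      e₄ = solve-∀
      e₅ : ∀ b d e f x y z k → e * x + d * y + k * (f * x + d * z) + (b * k * y - d * k * z - b * k * k * z) * + 2
           ≡ (e + f * k) * x + (d + + 2 * b * k) * (y - k * z)
      e₅ = solve-∀
      e₆ : ∀ e f y z k → f * y + e * z ≡ f * (y - k * z) + (e + f * k) * z
      e₆ = solve-∀

    ReducedTail : Form p n → Set
    ReducedTail F = - β F ≤ + 2 * κ F × + 2 * κ F ≤ β F × β F ≤ γ F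

    -- Lagrange-Gauss reduction of the tail βy² + 2κyz + γz² with the first basis vector fixed. A
    -- shift brings κ into range; if then γ < β, exchanging the last two vectors lowers β, on which
    -- the recursion runs.
    reduce-tail : ∀ (F : Form p n) → Acc ℕ._<_ ∣ β F ∣ → Σ[ F′ ∈ Form p n ] a F′ ≡ a F × ReducedTail F′
    reduce-tail F (acc rec) = go (γ F₁ <? β F₁)
      where
      near = nearest (+ 2 * κ F) (β F) (β>0 F)
      k = proj₁ near
      F₁ = shift-zy k F
      κ₁ : + 2 * κ F + + 2 * β F * k ≡ + 2 * κ F₁
      κ₁ = eq (a F) (b F) (d F) (e F) (f F) k
        where eq : ∀ a b d e f k → + 2 * (+ 2 * a * d - e * f) + + 2 * (+ 4 * a * b - f * f) * k
                   ≡ + 2 * (+ 2 * a * (d + + 2 * b * k) - (e + f * k) * f)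
              eq = solve-∀
      go : Dec (γ F₁ < β F₁) → Σ[ F′ ∈ Form p n ] a F′ ≡ a F × ReducedTail F′
      go (no ¬lt) = F₁ , refl , subst (- β F ≤_) κ₁ (proj₁ (proj₂ near)) , subst (_≤ β F) κ₁ (proj₂ (proj₂ near)) , ≮⇒≥
          ¬lt
      go (yes lt) = reduce-tail (swap-yz F₁) (rec (0<i<j⇒∣i∣<∣j∣ (γ>0 F₁) lt))
        where
        0<i<j⇒∣i∣<∣j∣ : ∀ {i j} → 0ℤ < i → i < j → ∣ i ∣ ℕ.< ∣ j ∣
        0<i<j⇒∣i∣<∣j∣ (+<+ _) (+<+ q) = q

    Reduced : Form p n → Set
    Reduced F = ReducedTail F × - a F ≤ f F × f F ≤ a F × a F ≤ b F

    -- Adding a multiple of the first vector to the second reduces f and leaves β, κ and γ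
    -- unchanged, so the tail stays reduced. If then b < a, exchanging the first two vectors lowers
    -- a, and the reduction starts again.
    reduce : ∀ (F : Form p n) → Acc ℕ._<_ ∣ a F ∣ → Σ[ F′ ∈ Form p n ] Reduced F′
    reduce F (acc rec) = go (b F₂ <? a F₂)
      where
      tail = reduce-tail F (<-wellFounded ∣ β F ∣)
      F₁ = proj₁ tail
      near = nearest (f F₁) (a F₁) (a>0 F₁)
      k = proj₁ near
      F₂ = shift-yx k F₁
      β≡ : β F₁ ≡ β F₂
      β≡ = eq (a F₁) (b F₁) (f F₁) k
        where eq : ∀ a b f k → + 4 * a * b - f * f ≡ + 4 * a * (b + f * k + a * k * k) - (f + + 2 * a * k) *
                  (f + + 2 * a * k)
              eq = solve-∀
      κ≡ : κ F₁ ≡ κ F₂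
      κ≡ = eq (a F₁) (d F₁) (e F₁) (f F₁) k
        where eq : ∀ a d e f k → + 2 * a * d - e * f ≡ + 2 * a * (d + e * k) - e * (f + + 2 * a * k)
              eq = solve-∀
      tail₂ : ReducedTail F₂
      tail₂ = subst₂ (λ u v → - u ≤ + 2 * v) β≡ κ≡ (proj₁ (proj₂ (proj₂ tail))) ,
              subst₂ (λ u v → + 2 * v ≤ u) β≡ κ≡ (proj₁ (proj₂ (proj₂ (proj₂ tail)))) ,
              subst (_≤ γ F₂) β≡ (proj₂ (proj₂ (proj₂ (proj₂ tail))))
      go : Dec (b F₂ < a F₂) → Σ[ F′ ∈ Form p n ] Reduced F′
      go (no ¬lt) = F₂ , tail₂ , proj₁ (proj₂ near) , proj₂ (proj₂ near) , ≮⇒≥ ¬lt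
      go (yes lt) = reduce (swap-xy F₂) (rec (subst (λ w → ∣ b F₂ ∣ ℕ.< ∣ w ∣) (proj₁ (proj₂ tail))
          (lemma (b>0 F₂) lt)))
        where
        lemma : ∀ {i j} → 0ℤ < i → i < j → ∣ i ∣ ℕ.< ∣ j ∣
        lemma (+<+ _) (+<+ q) = q

-- Bounds for reduced forms of discriminant at most 7.

module ReducedForms where

  open import Data.Integer hiding (suc; _/_; _%_)
  open import Data.Integer.Properties
  open import Data.Integer.Divisibility.Signed
  open import Data.Integer.Tactic.RingSolver using (solve-∀)
  open import Data.Integer.DivMod using (_/ℕ_; _%ℕ_; a≡a%ℕn+[a/ℕn]*n; n%ℕd<d)
  open TernaryForms

  parity : ∀ x → (∃[ k ] x ≡ + 2 * k) ⊎ (∃[ k ] x ≡ 1ℤ + + 2 * k)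
  parity x with x %ℕ 2 | n%ℕd<d x 2 | a≡a%ℕn+[a/ℕn]*n x 2
  ... | 0 | _ | eq = inj₁ (x /ℕ 2 , trans eq (trans (+-identityˡ _) (*-comm (x /ℕ 2) (+ 2))))
  ... | 1 | _ | eq = inj₂ (x /ℕ 2 , trans eq (cong (λ z → 1ℤ + z) (*-comm (x /ℕ 2) (+ 2))))
  ... | suc (suc _) | s≤s (s≤s ()) | _

  odd-not-even : ∀ {x} k → x ≡ 1ℤ + + 2 * k → ¬ (+ 2 ∣ x)
  odd-not-even {x} k eq d = contradiction (∣⇒∣ᵤ (subst (+ 2 ∣_) (trans (cong (_- + 2 * k) eq) (e k)) (∣m∣n⇒∣m-n d
      (divides k (*-comm (+ 2) k))))) (from-no (2 ℕ.∣? 1))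
    where e : ∀ k → 1ℤ + + 2 * k - + 2 * k ≡ 1ℤ
          e = solve-∀

  discriminant-mod-4 : ∀ b f → (+ 4 ∣ + 4 * 1ℤ * b - f * f) ⊎ (+ 4 ∣ 1ℤ + (+ 4 * 1ℤ * b - f * f))
  discriminant-mod-4 b f with parity f
  ... | inj₁ (k , refl) = inj₁ (divides (b - k * k) (e b k))
    where e : ∀ b k → + 4 * 1ℤ * b - + 2 * k * (+ 2 * k) ≡ (b - k * k) * + 4
          e = solve-∀
  ... | inj₂ (k , refl) = inj₂ (divides (b - k * k - k) (e b k))
    where e : ∀ b k → 1ℤ + (+ 4 * 1ℤ * b - (1ℤ + + 2 * k) * (1ℤ + + 2 * k)) ≡ (b - k * k - k) * + 4
          e = solve-∀

  -- A reduced form with leading coefficient 1. Its β and γ are kept as natural numbers B and C to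
  -- make them enumerable; both have the shape 4u - v² and so are 0 or 3 modulo 4.
  record Tail (p n : ℤ) : Set where
    field
      B C       : ℕ
      κ b c d e f x y z : ℤ
      B<7       : B ℕ.< 7
      1≤B       : 1 ℕ.≤ B
      2κ≤B      : 2 ℕ.* ∣ κ ∣ ℕ.≤ B
      product   : + B * + C ≡ κ * κ + + 4 * p
      B≡        : + B ≡ + 4 * 1ℤ * b - f * f
      C≡        : + C ≡ + 4 * 1ℤ * c - e * e
      B-mod     : 4 ℕ.∣ B ⊎ 4 ℕ.∣ suc B
      C-mod     : 4 ℕ.∣ C ⊎ 4 ℕ.∣ suc C
      value₄    : + 4 * n ≡ (+ 2 * x + f * y + e * z) * (+ 2 * x + f * y + e * z) + + B * (y * y) + + 2 * κ * (y * z)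
          + + C * (z * z)
      value     : 1ℤ * x * x + b * y * y + c * z * z + d * y * z + e * x * z + f * x * y ≡ n
      even₁     : + 2 ∣ f * y + e * z
      even₂     : + 2 ∣ f * x + d * z

  open Form

  module _ {p n : ℤ} (p>0 : 0ℤ < p) (p≤7 : p ≤ + 7) where

    module _ (F : Form p n) (red : Reduced p>0 F) where
      private
        A = a F
        tail = proj₁ red

      -- Reducedness means 4κ² ≤ β² and β ≤ γ, whence 3β² ≤ 4βγ - 4κ² = 16ap.
      tail-bound : + 3 * (β F * β F) ≤ + 16 * (A * p)
      tail-bound = from-diff (+-mono-≤ (0≤* (0≤* {+ 4} (+≤+ z≤n) (<⇒≤ (β>0 F))) (i≤j⇒0≤j-i (proj₂ (proj₂ tail))))
          (i≤j⇒0≤j-i (sq-bound (proj₁ tail) (proj₁ (proj₂ tail)))))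
        (trans (cong (_- + 3 * (β F * β F)) (trans (e₁ A p) (cong (+ 4 *_) (sym (βγ p>0 F))))) (e₂ (β F) (γ F) (κ F)))
        where
        e₁ : ∀ a p → + 16 * (a * p) ≡ + 4 * (+ 4 * a * p)
        e₁ = solve-∀
        e₂ : ∀ β γ κ → + 4 * (β * γ - κ * κ) - + 3 * (β * β) ≡ + 4 * β * (γ - β) + (β * β - + 2 * κ * (+ 2 * κ))
        e₂ = solve-∀

      3a²≤β : + 3 * (A * A) ≤ β F
      3a²≤β = from-diff (+-mono-≤ (0≤* (0≤* {+ 4} (+≤+ z≤n) (<⇒≤ (a>0 F))) (i≤j⇒0≤j-i (proj₂ (proj₂ (proj₂ red)))))
                                  (i≤j⇒0≤j-i (sq-bound (proj₁ (proj₂ red)) (proj₁ (proj₂ (proj₂ red)))))) (e₁ A (b F)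
                                      (f F))
        where e₁ : ∀ a b f → + 4 * a * b - f * f - + 3 * (a * a) ≡ + 4 * a * (b - a) + (a * a - f * f)
              e₁ = solve-∀

      27a³≤16p : + 27 * (A * A * A) ≤ + 16 * p
      27a³≤16p = *-cancelˡ-≤-pos (+ 27 * (A * A * A)) (+ 16 * p) A {{positive (a>0 F)}} (≤-trans
        (from-diff (0≤* {+ 3} (+≤+ z≤n) (0≤* (i≤j⇒0≤j-i 3a²≤β) (+-mono-≤ (<⇒≤ (β>0 F)) (0≤* {+ 3} (+≤+ z≤n) (0≤sq A)))))
            (e₁ A (β F)))
        (≤-trans tail-bound (≤-reflexive (e₂ A p))))
        where
        e₁ : ∀ a β → + 3 * (β * β) - a * (+ 27 * (a * a * a)) ≡ + 3 * ((β - + 3 * (a * a)) * (β + + 3 * (a * a)))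
        e₁ = solve-∀
        e₂ : ∀ a p → + 16 * (a * p) ≡ a * (+ 16 * p)
        e₂ = solve-∀

      -- For a ≥ 2 the bound 27a³ ≤ 16p would give 216 ≤ 112.
      a≡1 : A ≡ 1ℤ
      a≡1 with + 2 ≤? A
      ... | no ¬2≤a = one (a>0 F) (≰⇒> ¬2≤a)
        where one : ∀ {i} → 0ℤ < i → i < + 2 → i ≡ 1ℤ
              one (+<+ (s≤s z≤n)) (+<+ (s≤s (s≤s z≤n))) = refl
      ... | yes 2≤a = contradiction (≤-trans (*-monoˡ-≤-nonNeg (+ 27) 8≤a³) (≤-trans 27a³≤16p (*-monoˡ-≤-nonNeg
            (+ 16) p≤7))) (from-no (+ 27 * + 8 ≤? + 16 * + 7))
        where
        8≤a³ : + 8 ≤ A * A * A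
        8≤a³ = from-diff (0≤* (i≤j⇒0≤j-i 2≤a) (+-mono-≤ (+-mono-≤ (0≤sq A) (0≤* {+ 2} (+≤+ z≤n) (<⇒≤ (a>0 F))))
            (+≤+ {0} {4} z≤n))) (e₁ A)
          where e₁ : ∀ a → a * a * a - + 8 ≡ (a - + 2) * (a * a + + 2 * a + + 4)
                e₁ = solve-∀

      β≤6 : β F < + 7
      β≤6 = ≰⇒> (λ 7≤β → contradiction (≤-trans (*-monoˡ-≤-nonNeg (+ 3) (49≤ 7≤β)) (≤-trans tail-bound
              (≤-trans (≤-reflexive (cong (λ z → + 16 * (z * p)) a≡1)) (*-monoˡ-≤-nonNeg (+ 16)
                  (≤-trans (≤-reflexive (*-identityˡ p)) p≤7)))))
              (from-no (+ 3 * + 49 ≤? + 16 * + 7)))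
        where
        49≤ : + 7 ≤ β F → + 49 ≤ β F * β F
        49≤ h = from-diff (0≤* (i≤j⇒0≤j-i h) (+-mono-≤ (<⇒≤ (β>0 F)) (+≤+ {0} {7} z≤n))) (e₁ (β F))
          where e₁ : ∀ x → x * x - + 49 ≡ (x - + 7) * (x + + 7)
                e₁ = solve-∀

    reduced-tail : Form p n → Tail p n
    reduced-tail F₀ = build (reduce p>0 F₀ (<-wellFounded ∣ a F₀ ∣))
      where
      build : Σ[ F ∈ Form p n ] Reduced p>0 F → Tail p n
      build (F , red) = go (a F) refl (a≡1 F red) (β F) refl (γ F) refl (β>0 F) (β≤6 F red) (γ>0 p>0 F)
        where
        go : ∀ A → A ≡ a F → A ≡ 1ℤ → ∀ u → u ≡ β F → ∀ w → w ≡ γ F → 0ℤ < u → u < + 7 → 0ℤ < w → Tail p n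
        go _ A≡ refl (+ B) B≡ (+ C) C≡ (+<+ 1≤B) (+<+ B<7) _ = record
          { B = B ; C = C ; κ = κ₁ ; b = b F ; c = c F ; d = d F ; e = e F ; f = f F ; x = x F ; y = y F ; z = z F
          ; B<7 = B<7 ; 1≤B = 1≤B
          ; 2κ≤B = subst (ℕ._≤ B) (trans (cong (λ t → ∣ + 2 * t ∣) κ≡) (abs-* (+ 2) κ₁))
              (abs-bound (subst (λ t → - t ≤ + 2 * κ F) (sym B≡) (proj₁ (proj₁ red)))
                                                                (subst (λ t → + 2 * κ F ≤ t) (sym B≡)
                                                                    (proj₁ (proj₂ (proj₁ red)))))
          ; product = trans (cong₂ _*_ B≡ C≡) (trans (e₁ (β F * γ F) (κ F * κ F)) (cong₂ _+_ (cong₂ _*_ κ≡ κ≡)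
                        (trans (βγ p>0 F) (cong (λ t → + 4 * t * p) (sym A≡)))))
          ; B≡ = B≡′ ; C≡ = C≡′
          ; B-mod = [ (λ q → inj₁ (∣⇒∣ᵤ (subst (+ 4 ∣_) (sym B≡′) q))) , (λ q → inj₂ (∣⇒∣ᵤ (subst (λ t → + 4 ∣ 1ℤ + t)
              (sym B≡′) q))) ]′ (discriminant-mod-4 (b F) (f F))
          ; C-mod = [ (λ q → inj₁ (∣⇒∣ᵤ (subst (+ 4 ∣_) (sym C≡′) q))) , (λ q → inj₂ (∣⇒∣ᵤ (subst (λ t → + 4 ∣ 1ℤ + t)
              (sym C≡′) q))) ]′ (discriminant-mod-4 (c F) (e F))
          ; value₄ = trans (cong (+ 4 *_) (sym value₁)) (trans (e₂ (b F) (c F) (d F) (e F) (f F) (x F) (y F) (z F))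
              (cong₂ (λ u v → (+ 2 * x F + f F * y F + e F * z F) * (+ 2 * x F + f F * y F + e F * z F) + u * (y F * y
                  F) + + 2 * κ₁ * (y F * z F) + v * (z F * z F)) (sym B≡′) (sym C≡′)))
          ; value = value₁
          ; even₁ = even₁ F ; even₂ = even₂ F
          }
          where
          κ₁ = + 2 * 1ℤ * d F - e F * f F
          κ≡ : κ F ≡ κ₁
          κ≡ = cong (λ t → + 2 * t * d F - e F * f F) (sym A≡)
          B≡′ : + B ≡ + 4 * 1ℤ * b F - f F * f F
          B≡′ = trans B≡ (cong (λ t → + 4 * t * b F - f F * f F) (sym A≡))
          C≡′ : + C ≡ + 4 * 1ℤ * c F - e F * e F
          C≡′ = trans C≡ (cong (λ t → + 4 * t * c F - e F * e F) (sym A≡))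
          value₁ : 1ℤ * x F * x F + b F * y F * y F + c F * z F * z F + d F * y F * z F + e F * x F * z F + f F * x
              F * y F ≡ n
          value₁ = trans (cong (λ t → t * x F * x F + b F * y F * y F + c F * z F * z F + d F * y F * z F + e F * x
              F * z F + f F * x F * y F) A≡) (value F)
          e₁ : ∀ u v → u ≡ v + (u - v)
          e₁ = solve-∀
          e₂ : ∀ b c d e f x y z → + 4 * (1ℤ * x * x + b * y * y + c * z * z + d * y * z + e * x * z + f * x * y)
               ≡ (+ 2 * x + f * y + e * z) * (+ 2 * x + f * y + e * z) + (+ 4 * 1ℤ * b - f * f) * (y * y)
                 + + 2 * (+ 2 * 1ℤ * d - e * f) * (y * z) + (+ 4 * 1ℤ * c - e * e) * (z * z)
          e₂ = solve-∀
          abs-bound : ∀ {i m} → - + m ≤ i → i ≤ + m → ∣ i ∣ ℕ.≤ m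
          abs-bound {+ i} _ (+≤+ u) = u
          abs-bound { -[1+ i ]} {suc m} (-≤- l) _ = s≤s l

-- Enumeration of the reduced forms of discriminants 5 and 7.

module SmallDiscriminants where

  open import Data.Integer hiding (suc; _/_; _%_)
  open import Data.Integer.Properties
  open import Data.Integer.Divisibility.Signed
  open import Data.Integer.Tactic.RingSolver using (solve-∀)
  open ReducedForms

  TailEquation : ℕ → ℕ → ℕ → ℕ → Set
  TailEquation r B j C = 1 ℕ.≤ B × 2 ℕ.* j ℕ.≤ B × B ℕ.* C ≡ j ℕ.* j ℕ.+ r × (4 ℕ.∣ B ⊎ 4 ℕ.∣ suc B) ×
      (4 ℕ.∣ C ⊎ 4 ℕ.∣ suc C)

  tailEquation? : ∀ r B j C → Dec (TailEquation r B j C)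
  tailEquation? r B j C = (1 ℕ.≤? B) ×-dec (2 ℕ.* j ℕ.≤? B) ×-dec (B ℕ.* C ℕ.≟ j ℕ.* j ℕ.+ r) ×-dec
    ((4 ℕ.∣? B) ⊎-dec (4 ℕ.∣? suc B)) ×-dec ((4 ℕ.∣? C) ⊎-dec (4 ℕ.∣? suc C))

  -- The equation is BC - κ² = 4p with p = 5. The search is finite because 2|κ| ≤ B < 7 gives |κ| <
  -- 4, and C ≤ κ² + 4p < 30.
  tails-20 : ∀ {B} → B ℕ.< 7 → ∀ {j} → j ℕ.< 4 → ∀ {C} → C ℕ.< 30 → TailEquation 20 B j C → B ≡ 3 × j ≡ 1 × C ≡ 7
  tails-20 = from-yes (ℕ.allUpTo? (λ B → ℕ.allUpTo? (λ j → ℕ.allUpTo? (λ C →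
    tailEquation? 20 B j C →-dec ((B ℕ.≟ 3) ×-dec (j ℕ.≟ 1) ×-dec (C ℕ.≟ 7))) 30) 4) 7)

  tails-28 : ∀ {B} → B ℕ.< 7 → ∀ {j} → j ℕ.< 4 → ∀ {C} → C ℕ.< 38 → TailEquation 28 B j C →
             (B ≡ 4 × j ≡ 0 × C ≡ 7) ⊎ (B ≡ 4 × j ≡ 2 × C ≡ 8)
  tails-28 = from-yes (ℕ.allUpTo? (λ B → ℕ.allUpTo? (λ j → ℕ.allUpTo? (λ C →
    tailEquation? 28 B j C →-dec (((B ℕ.≟ 4) ×-dec (j ℕ.≟ 0) ×-dec (C ℕ.≟ 7)) ⊎-dec ((B ℕ.≟ 4) ×-dec (j ℕ.≟ 2) ×-dec
        (C ℕ.≟ 8)))) 38) 4) 7)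

  square-abs : ∀ x → x * x ≡ + (∣ x ∣ ℕ.* ∣ x ∣)
  square-abs (+ n)    = sym (pos-* n n)
  square-abs -[1+ n ] = refl

  module _ {q : ℕ} {n : ℤ} (tail : Tail (+ q) n) where
    open Tail tail

    tail-equation : TailEquation (4 ℕ.* q) B ∣ κ ∣ C
    tail-equation = 1≤B , 2κ≤B , +-injective (trans (pos-* B C) (trans product (trans (cong₂ _+_ (square-abs κ)
        (sym (pos-* 4 q)))
      (sym (pos-+ (∣ κ ∣ ℕ.* ∣ κ ∣) (4 ℕ.* q)))))) , B-mod , C-mod

    κ<4 : ∣ κ ∣ ℕ.< 4
    κ<4 = s≤s (ℕ.*-cancelˡ-≤ 2 (ℕ.≤-trans 2κ≤B (ℕ.≤-pred B<7)))

    C-bound : C ℕ.< 10 ℕ.+ 4 ℕ.* q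
    C-bound = s≤s (ℕ.≤-trans (ℕ.m≤n*m C B {{ℕ.>-nonZero 1≤B}}) (ℕ.≤-trans (ℕ.≤-reflexive
        (proj₁ (proj₂ (proj₂ tail-equation))))
                (ℕ.+-monoˡ-≤ (4 ℕ.* q) (ℕ.*-mono-≤ (ℕ.≤-pred κ<4) (ℕ.≤-pred κ<4)))))

  ∣∣-cases : ∀ x n → ∣ x ∣ ≡ n → x ≡ + n ⊎ x ≡ - + n
  ∣∣-cases x n eq = [ (λ e → inj₁ (trans e (cong +_ eq))) , (λ e → inj₂ (trans e (cong (λ m → - + m) eq))) ]′
      (∣i∣≡j⇒i≡±j x)
    where
    ∣i∣≡j⇒i≡±j : ∀ x → x ≡ + ∣ x ∣ ⊎ x ≡ - + ∣ x ∣
    ∣i∣≡j⇒i≡±j (+ n)    = inj₁ refl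
    ∣i∣≡j⇒i≡±j -[1+ n ] = inj₂ refl

  -- The two tails are 4y² + 7z² and 4y² ± 4yz + 8z²; the second equals (2y ± z)² + 7z².
  represent-7 : ∀ {n} → Tail (+ 7) n → ∃[ X ] ∃[ W ] ∃[ Z ] + 4 * n ≡ X * X + W * W + + 7 * (Z * Z)
  represent-7 {n} tail = [ case₁ , case₂ ]′ (tails-28 B<7 (κ<4 tail) (C-bound tail) (tail-equation tail))
    where
    open Tail tail
    X = + 2 * x + f * y + e * z
    value-at : ∀ {b₀ c₀ k₀} → B ≡ b₀ → C ≡ c₀ → κ ≡ k₀ → + 4 * n ≡ X * X + + b₀ * (y * y) + + 2 * k₀ * (y * z) + + c₀ *
        (z * z)
    value-at refl refl refl = value₄
    e₁ : ∀ X y z → X * X + + 4 * (y * y) + + 2 * + 0 * (y * z) + + 7 * (z * z) ≡ X * X + + 2 * y * (+ 2 * y) + + 7 *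
        (z * z)
    e₁ = solve-∀
    e₂ : ∀ X y z → X * X + + 4 * (y * y) + + 2 * + 2 * (y * z) + + 8 * (z * z) ≡ X * X + (+ 2 * y + z) * (+ 2 * y + z)
        + + 7 * (z * z)
    e₂ = solve-∀
    e₃ : ∀ X y z → X * X + + 4 * (y * y) + + 2 * (- + 2) * (y * z) + + 8 * (z * z) ≡ X * X + (+ 2 * y - z) * (+ 2 * y
        - z) + + 7 * (z * z)
    e₃ = solve-∀
    case₁ : B ≡ 4 × ∣ κ ∣ ≡ 0 × C ≡ 7 → ∃[ X ] ∃[ W ] ∃[ Z ] + 4 * n ≡ X * X + W * W + + 7 * (Z * Z)
    case₁ (B≡4 , κ≡ , C≡7) = X , + 2 * y , z , trans (value-at B≡4 C≡7 (∣i∣≡0⇒i≡0 κ≡)) (e₁ X y z)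
    case₂ : B ≡ 4 × ∣ κ ∣ ≡ 2 × C ≡ 8 → ∃[ X ] ∃[ W ] ∃[ Z ] + 4 * n ≡ X * X + W * W + + 7 * (Z * Z)
    case₂ (B≡4 , κ≡ , C≡8) = [ (λ k → X , + 2 * y + z , z , trans (value-at B≡4 C≡8 k) (e₂ X y z)) ,
                               (λ k → X , + 2 * y - z , z , trans (value-at B≡4 C≡8 k) (e₃ X y z)) ]′ (∣∣-cases κ 2 κ≡)

  square-odd : ∀ f → (∃[ k ] f ≡ + 2 * k) → ∀ b r → r ≡ + 4 * 1ℤ * b - f * f → + 2 ∣ r
  square-odd _ (k , refl) b r eq = divides (+ 2 * b - + 2 * (k * k)) (trans eq (e b k))
    where e : ∀ b k → + 4 * 1ℤ * b - + 2 * k * (+ 2 * k) ≡ (+ 2 * b - + 2 * (k * k)) * + 2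
          e = solve-∀

  -- The tail is 3y² ± 2yz + 7z², where the sign is absorbed by y. Since 3 = 4b - f² and 7 = 4c -
  -- e², both e and f are odd, so even inner products make X and y + z even. An even z would then
  -- make x and y even, against n odd. These parities later allow a division by 20 instead of 5.
  represent-5 : ∀ {n} → Tail (+ 5) n → ¬ (+ 2 ∣ n) →
    ∃[ X ] ∃[ Y ] ∃[ Z ] + 4 * n ≡ X * X + + 3 * (Y * Y) + + 2 * (Y * Z) + + 7 * (Z * Z) × (+ 2 ∣ X) ×
        (+ 2 ∣ + 3 * Y + Z) × ¬ (+ 2 ∣ Z)
  represent-5 {n} tail n-odd = finish (∣∣-cases κ 1 κ≡)
    where
    open Tail tail
    table = tails-20 B<7 (κ<4 tail) (C-bound tail) (tail-equation tail)
    B≡3 = proj₁ table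
    κ≡ = proj₁ (proj₂ table)
    C≡7 = proj₂ (proj₂ table)
    X = + 2 * x + f * y + e * z
    f-odd : ∃[ k ] f ≡ 1ℤ + + 2 * k
    f-odd = [ (λ ev → contradiction (square-odd f ev b (+ 3) (trans (cong +_ (sym B≡3)) B≡)) (odd-not-even 1ℤ refl)) ,
        (λ o → o) ]′ (parity f)
    e-odd : ∃[ k ] e ≡ 1ℤ + + 2 * k
    e-odd = [ (λ ev → contradiction (square-odd e ev c (+ 7) (trans (cong +_ (sym C≡7)) C≡)) (odd-not-even (+ 3) refl))
        , (λ o → o) ]′ (parity e)
    strip : ∀ {f u} → (∃[ k ] f ≡ 1ℤ + + 2 * k) → + 2 ∣ f * u → + 2 ∣ u
    strip {u = u} (k , refl) dv = subst (+ 2 ∣_) (e₀ k u) (∣m∣n⇒∣m-n dv (divides (k * u) refl))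
      where e₀ : ∀ k u → (1ℤ + + 2 * k) * u - k * u * + 2 ≡ u
            e₀ = solve-∀
    y+z-even : + 2 ∣ y + z
    y+z-even = subst (+ 2 ∣_) (trans (cong₂ (λ f e → f * y + e * z - (proj₁ f-odd * y + proj₁ e-odd * z) * + 2)
        (proj₂ f-odd) (proj₂ e-odd)) (e₀ (proj₁ f-odd) (proj₁ e-odd) y z))
                 (∣m∣n⇒∣m-n even₁ (divides (proj₁ f-odd * y + proj₁ e-odd * z) refl))
      where e₀ : ∀ k l y z → (1ℤ + + 2 * k) * y + (1ℤ + + 2 * l) * z - (k * y + l * z) * + 2 ≡ y + z
            e₀ = solve-∀
    X-even : + 2 ∣ X
    X-even = subst (+ 2 ∣_) (e₀ x (f * y) (e * z)) (∣m∣n⇒∣m+n (divides x refl) even₁)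
      where e₀ : ∀ x u v → x * + 2 + (u + v) ≡ + 2 * x + u + v
            e₀ = solve-∀
    z-odd : ¬ (+ 2 ∣ z)
    z-odd 2∣z = n-odd (subst (+ 2 ∣_) value
        (∣m∣n⇒∣m+n (∣m∣n⇒∣m+n (∣m∣n⇒∣m+n (∣m∣n⇒∣m+n (∣m∣n⇒∣m+n (∣n⇒∣m*n (1ℤ * x) 2∣x) (∣n⇒∣m*n (b * y) 2∣y))
            (∣n⇒∣m*n (c * z) 2∣z))
          (∣n⇒∣m*n (d * y) 2∣z)) (∣n⇒∣m*n (e * x) 2∣z)) (∣n⇒∣m*n (f * x) 2∣y)))
      where
      2∣y : + 2 ∣ y
      2∣y = ∣m+n∣n⇒∣m y+z-even 2∣z
      2∣x : + 2 ∣ x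
      2∣x = strip f-odd (∣m+n∣n⇒∣m even₂ (∣n⇒∣m*n d 2∣z))
    value-at : ∀ {k₀} → κ ≡ k₀ → + 4 * n ≡ X * X + + 3 * (y * y) + + 2 * k₀ * (y * z) + + 7 * (z * z)
    value-at refl = trans value₄ (cong₂ (λ u v → X * X + + u * (y * y) + + 2 * κ * (y * z) + + v * (z * z)) B≡3 C≡7)
    finish : κ ≡ + 1 ⊎ κ ≡ - + 1 → ∃[ X ] ∃[ Y ] ∃[ Z ] + 4 * n ≡ X * X + + 3 * (Y * Y) + + 2 * (Y * Z) + + 7 * (Z * Z)
        × (+ 2 ∣ X) × (+ 2 ∣ + 3 * Y + Z) × ¬ (+ 2 ∣ Z)
    finish (inj₁ k) = X , y , z , trans (value-at k) (e₁ X y z) , X-even , subst (+ 2 ∣_) (e₂ y z) (∣m∣n⇒∣m+n y+z-even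
        (divides y refl)) , z-odd
      where
      e₁ : ∀ X y z → X * X + + 3 * (y * y) + + 2 * + 1 * (y * z) + + 7 * (z * z) ≡ X * X + + 3 * (y * y) + + 2 * (y * z)
          + + 7 * (z * z)
      e₁ = solve-∀
      e₂ : ∀ y z → y + z + y * + 2 ≡ + 3 * y + z
      e₂ = solve-∀
    finish (inj₂ k) = X , - y , z , trans (value-at k) (e₁ X y z) , X-even , subst (+ 2 ∣_) (e₂ y z) (∣m∣n⇒∣m-n y+z-even
        (divides (+ 2 * y) refl)) , z-odd
      where
      e₁ : ∀ X y z → X * X + + 3 * (y * y) + + 2 * (- + 1) * (y * z) + + 7 * (z * z) ≡ X * X + + 3 * (- y * - y) + + 2 *
          (- y * z) + + 7 * (z * z)
      e₁ = solve-∀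
      e₂ : ∀ y z → y + z - + 2 * y * + 2 ≡ + 3 * (- y) + z
      e₂ = solve-∀

-- A form of discriminant p that represents p M.

module FormsFromNorms where

  open import Data.Integer hiding (suc; _/_; _%_)
  open import Data.Integer.Properties
  open import Data.Integer.Divisibility.Signed
  open import Data.Integer.Tactic.RingSolver using (solve-∀)
  open Congruences
  open ResidueSymbol
  open Reciprocity using (J-minus-one; ∏-odd)
  open NormLikeNumbers
  open NormsInResidueClasses
  open TernaryForms
  open ReducedForms using (parity)

  -- If P x² + H x y + R y² has discriminant -M and the three divisibilities hold, then
  -- (p (σ₁ x + σ₂ y + M z)² + P x² + H x y + R y²) / M is an integral form of discriminant p.
  form : ∀ {p M P H R σ₁ σ₂ : ℤ} → 0ℤ < p → 0ℤ < M → 0ℤ < P → H * H + M ≡ R * (+ 4 * P) →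
         M ∣ P + p * σ₁ * σ₁ → M ∣ H + + 2 * p * σ₁ * σ₂ → M ∣ R + p * σ₂ * σ₂ → Form p (p * M)
  form {p} {M} {P} {H} {R} {σ₁} {σ₂} p>0 M>0 P>0 det (divides a₁ a≡) (divides h₁ h≡) (divides b₁ b≡) = record
    { a = p * M ; b = a₁ ; c = b₁ ; d = h₁ ; e = + 2 * p * σ₂ ; f = + 2 * p * σ₁ ; x = 1ℤ ; y = 0ℤ ; z = 0ℤ
    ; a>0 = 0<* p>0 M>0
    ; β>0 = subst (0ℤ <_) (trans (e₁ p P σ₁) (trans (cong (λ t → + 4 * p * t - + 2 * p * σ₁ * (+ 2 * p * σ₁)) a≡)
        (e₂ p M a₁ σ₁)))
              (0<* (0<* {+ 4} (+<+ (s≤s z≤n)) p>0) P>0)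
    ; disc = *-cancelʳ-≡ _ p M {{>-nonZero M>0}} (trans (e₃ p M a₁ b₁ h₁ σ₁ σ₂) (trans
               (cong₂ (λ u v → + 4 * p * u * v + h₁ * M * (+ 2 * p * σ₂) * (+ 2 * p * σ₁) - p * (h₁ * M) * (h₁ * M)
                  - u * (+ 2 * p * σ₂) * (+ 2 * p * σ₂) - v * (+ 2 * p * σ₁) * (+ 2 * p * σ₁)) (sym a≡) (sym b≡))
               (trans (cong (λ u → + 4 * p * (P + p * σ₁ * σ₁) * (R + p * σ₂ * σ₂) + u * (+ 2 * p * σ₂) * (+ 2 * p * σ₁)
                   - p * u * u
                  - (P + p * σ₁ * σ₁) * (+ 2 * p * σ₂) * (+ 2 * p * σ₂) - (R + p * σ₂ * σ₂) * (+ 2 * p * σ₁) *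
                      (+ 2 * p * σ₁)) (sym h≡))
               (trans (e₄ p P H R σ₁ σ₂) (trans (cong (λ u → p * (u - H * H)) (sym det)) (e₅ p M H))))))
    ; value = e₆ (p * M) a₁ b₁ h₁ (+ 2 * p * σ₂) (+ 2 * p * σ₁)
    ; even₁ = divides 0ℤ (e₇ (+ 2 * p * σ₁) (+ 2 * p * σ₂))
    ; even₂ = divides (p * σ₁) (e₈ p σ₁ h₁)
    ; even₃ = divides (p * σ₂) (e₈ p σ₂ h₁)
    }
    where
    e₁ : ∀ p P s → + 4 * p * P ≡ + 4 * p * (P + p * s * s) - + 2 * p * s * (+ 2 * p * s)
    e₁ = solve-∀
    e₂ : ∀ p M a s → + 4 * p * (a * M) - + 2 * p * s * (+ 2 * p * s) ≡ + 4 * (p * M) * a - + 2 * p * s * (+ 2 * p * s)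
    e₂ = solve-∀
    e₃ : ∀ p M a b h s t → (+ 4 * (p * M) * a * b + h * (+ 2 * p * t) * (+ 2 * p * s) - p * M * h * h
        - a * (+ 2 * p * t) * (+ 2 * p * t) - b * (+ 2 * p * s) * (+ 2 * p * s)) * M
         ≡ + 4 * p * (a * M) * (b * M) + h * M * (+ 2 * p * t) * (+ 2 * p * s) - p * (h * M) * (h * M)
                  - a * M * (+ 2 * p * t) * (+ 2 * p * t) - b * M * (+ 2 * p * s) * (+ 2 * p * s)
    e₃ = solve-∀
    e₄ : ∀ p P H R s t → + 4 * p * (P + p * s * s) * (R + p * t * t) + (H + + 2 * p * s * t) * (+ 2 * p * t) *
        (+ 2 * p * s) - p * (H + + 2 * p * s * t) * (H + + 2 * p * s * t)
                  - (P + p * s * s) * (+ 2 * p * t) * (+ 2 * p * t) - (R + p * t * t) * (+ 2 * p * s) * (+ 2 * p * s)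
         ≡ p * (R * (+ 4 * P) - H * H)
    e₄ = solve-∀
    e₅ : ∀ p M H → p * (H * H + M - H * H) ≡ p * M
    e₅ = solve-∀
    e₆ : ∀ a b c d e f → a * 1ℤ * 1ℤ + b * 0ℤ * 0ℤ + c * 0ℤ * 0ℤ + d * 0ℤ * 0ℤ + e * 1ℤ * 0ℤ + f * 1ℤ * 0ℤ ≡ a
    e₆ = solve-∀
    e₇ : ∀ f e → f * 0ℤ + e * 0ℤ ≡ 0ℤ
    e₇ = solve-∀
    e₈ : ∀ p s h → + 2 * p * s * 1ℤ + h * 0ℤ ≡ p * s * + 2
    e₈ = solve-∀

  -- Adding the odd modulus changes the parity of a root. For an odd root H, the number H² + M is
  -- divisible by 4 when M ≡ 3 mod 4.
  odd-root : ∀ g M → RootMod M (odd g) → ∃[ u ] + odd g ∣ (1ℤ + + 2 * u) * (1ℤ + + 2 * u) + M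
  odd-root g M (Q , dv) = [ (λ (q , eq) → (q + + g) , root-resp-≈ (shift q eq) dv) , (λ (q , eq) → q , subst
      (λ t → + odd g ∣ t * t + M) eq dv) ]′ (parity Q)
    where
    e : ∀ q g → (1ℤ + + 2 * (q + g)) - + 2 * q ≡ 1ℤ * (1ℤ + (g + g))
    e = solve-∀
    shift : ∀ q → Q ≡ + 2 * q → 1ℤ + + 2 * (q + + g) ≈ Q [ + odd g ]
    shift q eq = cong-mod (divides 1ℤ (trans (cong (λ t → 1ℤ + + 2 * (q + + g) - t) eq) (e q (+ g))))

  module _ (t p : ℕ) (1≤p : 1 ℕ.≤ p) where
    open Three t using (h; M; k; χ; χ-*; χ-J; to-M; M∣k; coprime⇒odd; norm-in-class)

    private
      -- This is 2M - 1, which represents -1 modulo k.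
      m-1 = h ℕ.+ h ℕ.+ M

      m-1≈ : + m-1 ≈ -1ℤ [ + k ]
      m-1≈ = cong-mod (divides 1ℤ (trans (cong (λ z → z - -1ℤ) (pos-+ (h ℕ.+ h) M)) (trans (e (+ (h ℕ.+ h)))
          (cong (1ℤ *_) (sym (pos-* 2 M))))))
        where e : ∀ x → x + (1ℤ + x) - -1ℤ ≡ 1ℤ * (+ 2 * (1ℤ + x))
              e = solve-∀

      m-1-coprime : Coprime m-1 k
      m-1-coprime {d} (d∣m-1 , d∣k) = ℕ.∣1⇒≡1 (∣⇒∣ᵤ {+ d} { -1ℤ} (≈-∣ (cong-mod (∣-trans (∣ℕ⇒∣ d∣k) (difference m-1≈)))
          (∣ℕ⇒∣ d∣m-1)))

      J-m-1 : J h m-1 ≡ -1ℤ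
      J-m-1 = trans (J-cong h m-1 (h ℕ.+ h) (pred-coprime h) (cong-mod (divides 1ℤ (trans (cong (_- + (h ℕ.+ h))
          (pos-+ (h ℕ.+ h) M)) (e (+ (h ℕ.+ h)) (+ M))))))
                (trans (J-minus-one h) (∏-odd t (inj₂ refl)))
        where
        e : ∀ x y → x + y - x ≡ 1ℤ * y
        e = solve-∀

    module _ (cop : Coprime p k) (Jp : J h p ≡ -1ℤ) where
      private
        χc : χ (p ℕ.* m-1) ≡ 1ℤ
        -- Both p and -1 have symbol -1 modulo M, so the class of -p is one in which norm-like
        -- numbers exist.
        χc = trans (χ-* p m-1) (cong₂ _*_ (trans (χ-J cop) Jp) (trans (χ-J m-1-coprime) J-m-1))

        build : ∀ n l g → 1 ℕ.≤ n → + n ≈ + (p ℕ.* m-1) [ + k ] → Coprime n k → n ≡ l ℕ.* l ℕ.* odd g → RootMod (+ M)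
            (odd g) → Form (+ p) (+ p * + M)
        build n l g 1≤n n≈c cnk n≡ rt = form {+ p} {+ M} {+ P} {H} {R} {σ₁} {σ₂} (+<+ 1≤p) (+<+ (s≤s z≤n))
            (+<+ (s≤s z≤n)) (trans det (cong (R *_) (pos-* 4 P))) dvd-a dvd-h dvd-b
          where
          P = odd g
          n≈-p : + n ≈ - + p [ + M ]
          n≈-p = cong-mod (∣-trans (∣ℕ⇒∣ M∣k) (difference (≈-trans n≈c (≈-trans (≈-reflexive (pos-* p m-1))
              (≈-trans (≈-*ˡ (+ p) m-1≈) (≈-reflexive (e (+ p))))))))
            where e : ∀ p → p * -1ℤ ≡ - p
                  e = solve-∀
          pos-n : + n ≡ + l * + l * + P
          pos-n = trans (cong +_ n≡) (trans (pos-* (l ℕ.* l) P) (cong (_* + P) (pos-* l l)))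
          cPk : Coprime P k
          cPk = Coprime-∣ˡ (subst (P ℕ.∣_) (sym n≡) (ℕ.n∣m*n (l ℕ.* l))) cnk
          clM : Coprime l M
          clM = to-M (Coprime-∣ˡ (subst (l ℕ.∣_) (sym n≡) (ℕ.∣-trans (ℕ.m∣m*n l) (ℕ.m∣m*n P))) cnk)
          c2M : Coprime 2 M
          c2M {d} (d∣2 , d∣M) = ℕ.∣1⇒≡1 (ℕ.∣m+n∣m⇒∣n (subst (d ℕ.∣_) (ℕ.+-comm 1 (h ℕ.+ h)) d∣M) (ℕ.∣-trans d∣2
              (ℕ.divides h (e h))))
            where e : ∀ h → h ℕ.+ h ≡ h ℕ.* 2
                  e = ℕ.solve-∀
          inv-l = inverse-mod l (h ℕ.+ h) clM
          l′ = + proj₁ inv-l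
          inv-2p = inverse-mod (2 ℕ.* p) (h ℕ.+ h) (Coprime-* {2} {p} c2M (to-M cop))
          w = + proj₁ inv-2p
          rt′ = odd-root g (+ M) rt
          u = proj₁ rt′
          H = 1ℤ + + 2 * u
          4∣ : + 4 ∣ H * H + + M
          4∣ = divides (u * u + u + + t + 1ℤ) (trans (cong (λ z → H * H + z) M≡) (e u (+ t)))
            where
            M≡ : + M ≡ + 3 + + 4 * + t
            M≡ = trans (cong +_ (e₀ t)) (trans (pos-+ 3 (4 ℕ.* t)) (cong (λ z → + 3 + z) (pos-* 4 t)))
              where e₀ : ∀ t → suc (suc (t ℕ.+ t) ℕ.+ suc (t ℕ.+ t)) ≡ 3 ℕ.+ 4 ℕ.* t
                    e₀ = ℕ.solve-∀
            e : ∀ u t → (1ℤ + + 2 * u) * (1ℤ + + 2 * u) + (+ 3 + + 4 * t) ≡ (u * u + u + t + 1ℤ) * + 4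
            e = solve-∀
          c4P : Coprime 4 P
          c4P = Coprime-* {2} {2} c2P c2P
            where c2P : Coprime 2 P
                  c2P (d∣2 , d∣P) = cPk (d∣P , ℕ.∣-trans d∣2 (ℕ.m∣m*n M))
          4P∣ : + (4 ℕ.* P) ∣ H * H + + M
          4P∣ = coprime-*-∣ c4P 4∣ (proj₂ rt′)
          R = _∣_.quotient 4P∣
          det : H * H + + M ≡ R * + (4 ℕ.* P)
          det = _∣_.equality 4P∣
          -- From l² P = n ≡ -p follows P ≡ -p l′², which gives σ₁; and σ₂ is the solution of 2pσ₁σ₂
          -- ≡ -H modulo M.
          σ₁ = l′
          σ₂ = - (H * + l * w)
          P≈ : + P ≈ - (+ p * σ₁ * σ₁) [ + M ]
          P≈ = ≈-trans (≈-reflexive (e₁ (+ P))) (≈-trans (≈-*ʳ (+ P) (≈-sym (≈-* (proj₂ inv-l) (proj₂ inv-l))))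
                (≈-trans (≈-reflexive (trans (e₂ (+ l) l′ (+ P)) (cong (_* (l′ * l′)) (sym pos-n))))
                (≈-trans (≈-*ʳ (l′ * l′) n≈-p) (≈-reflexive (e₃ (+ p) l′)))))
            where
            e₁ : ∀ x → x ≡ 1ℤ * 1ℤ * x
            e₁ = solve-∀
            e₂ : ∀ l m x → l * m * (l * m) * x ≡ l * l * x * (m * m)
            e₂ = solve-∀
            e₃ : ∀ p m → - p * (m * m) ≡ - (p * m * m)
            e₃ = solve-∀
          2pσσ≈ : + 2 * + p * σ₁ * σ₂ ≈ - H [ + M ]
          2pσσ≈ = ≈-trans (≈-reflexive (trans (e₁ (+ p) l′ H (+ l) w) (cong (λ z → - H * (+ l * l′) * (z * w))
              (sym (pos-* 2 p)))))
                   (≈-trans (≈-* (≈-*ˡ (- H) (proj₂ inv-l)) (proj₂ inv-2p)) (≈-reflexive (e₂ (- H))))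
            where
            e₁ : ∀ p m H l w → + 2 * p * m * (- (H * l * w)) ≡ - H * (l * m) * (+ 2 * p * w)
            e₁ = solve-∀
            e₂ : ∀ x → x * 1ℤ * 1ℤ ≡ x
            e₂ = solve-∀
          dvd-a : + M ∣ + P + + p * σ₁ * σ₁
          dvd-a = subst (+ M ∣_) (e (+ P) (+ p * σ₁ * σ₁)) (difference P≈)
            where e : ∀ x y → x - - y ≡ x + y
                  e = solve-∀
          dvd-h : + M ∣ H + + 2 * + p * σ₁ * σ₂
          dvd-h = subst (+ M ∣_) (e H (+ 2 * + p * σ₁ * σ₂)) (difference 2pσσ≈)
            where e : ∀ x y → y - - x ≡ x + y
                  e = solve-∀
          dvd-b : + M ∣ R + + p * σ₂ * σ₂
          -- Multiplied by 4P, which is prime to M, the number becomes H² + M + 4pσ₂²P ≡ H² -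
          -- (2pσ₁σ₂)² ≡ 0.
          dvd-b = coprime-∣ {M} {4 ℕ.* P} cM4P (≈0⇒∣ (≈-trans (≈-reflexive e₀) (≈-trans (≈-+ (≈-+ (≈-refl {x = H * H})
              (∣⇒≈0 (∣-refl {+ M}))) (≈-*ˡ (+ 4 * (+ p * σ₂ * σ₂)) P≈))
                    (≈-trans (≈-reflexive (e₂ H (+ p) σ₁ σ₂)) (≈-trans (≈-+ (≈-refl {x = H * H})
                        (≈-neg (≈-* 2pσσ≈ 2pσσ≈))) (≈-reflexive (e₃ H)))))))
            where
            cM4P : Coprime M (4 ℕ.* P)
            cM4P = Coprimality.sym (Coprime-* {4} {P} (Coprime-* {2} {2} c2M c2M) (to-M cPk))
            e₁ : ∀ R Q P p s → Q * (R + p * s * s) ≡ R * Q + Q * (p * s * s)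
            e₁ = solve-∀
            e₁′ : ∀ x P → + 4 * P * x ≡ + 4 * x * P
            e₁′ = solve-∀
            e₀ : + (4 ℕ.* P) * (R + + p * σ₂ * σ₂) ≡ H * H + + M + + 4 * (+ p * σ₂ * σ₂) * + P
            e₀ = trans (e₁ R (+ (4 ℕ.* P)) (+ P) (+ p) σ₂) (cong₂ _+_ (sym det) (trans (cong (_* (+ p * σ₂ * σ₂))
                (pos-* 4 P)) (e₁′ (+ p * σ₂ * σ₂) (+ P))))
            e₂ : ∀ H p s u → H * H + 0ℤ + + 4 * (p * u * u) * (- (p * s * s)) ≡ H * H + - (+ 2 * p * s * u *
                (+ 2 * p * s * u))
            e₂ = solve-∀
            e₃ : ∀ H → H * H + - (- H * - H) ≡ 0ℤ
            e₃ = solve-∀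

      ternary-form : Form (+ p) (+ p * + M)
      ternary-form =
        let n , 1≤n , n≈c , cnk , l , P , n≡ , rt = norm-in-class (p ℕ.* m-1) χc
            g , P≡ = coprime⇒odd (Coprime-∣ˡ (subst (P ℕ.∣_) (sym n≡) (ℕ.n∣m*n (l ℕ.* l))) cnk)
        in build n l g 1≤n n≈c cnk (trans n≡ (cong (l ℕ.* l ℕ.*_) P≡)) (subst (RootMod (+ M)) P≡ rt)

-- Ternary representations of 4M and 3M.

module TernaryRepresentations where

  open import Data.Integer hiding (suc; _/_; _%_)
  open import Data.Integer.Properties
  open import Data.Integer.Divisibility.Signed
  open import Data.Integer.Tactic.RingSolver using (solve-∀)
  open import Data.Integer.DivMod using (_/ℕ_; _%ℕ_; a≡a%ℕn+[a/ℕn]*n; n%ℕd<d)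
  open Congruences
  open ResidueSymbol
  open Reciprocity using (reciprocity; ∏-odd)
  open NormLikeNumbers using (coprime-*-∣)
  open DivisorSums using (∤⇒coprime)
  open HyperbolaMethod using (%-≈)
  open NormsInResidueClasses
  open ReducedForms using (reduced-tail; odd-not-even)
  open SmallDiscriminants
  open FormsFromNorms

  %ℕ-≈ : ∀ x q .{{_ : ℕ.NonZero q}} → x ≈ + (x %ℕ q) [ + q ]
  %ℕ-≈ x q = cong-mod (divides (x /ℕ q) (trans (cong (_- + (x %ℕ q)) (a≡a%ℕn+[a/ℕn]*n x q)) (e (+ (x %ℕ q))
      ((x /ℕ q) * + q))))
    where e : ∀ r y → r + y - r ≡ y
          e = solve-∀

  Anisotropic : ℕ → ℕ → Set
  Anisotropic q c = ∀ {r} → r ℕ.< q → ∀ {s} → s ℕ.< q → q ℕ.∣ c ℕ.* (r ℕ.* r) ℕ.+ s ℕ.* s → r ≡ 0 × s ≡ 0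

  anisotropic? : ∀ q c → Dec (Anisotropic q c)
  anisotropic? q c = ℕ.allUpTo? (λ r → ℕ.allUpTo? (λ s → (q ℕ.∣? c ℕ.* (r ℕ.* r) ℕ.+ s ℕ.* s) →-dec ((r ℕ.≟ 0) ×-dec
      (s ℕ.≟ 0))) q) q

  anisotropic-∣ : ∀ q c .{{_ : ℕ.NonZero q}} → Anisotropic q c → ∀ x y → + q ∣ + c * (x * x) + y * y → (+ q ∣ x) ×
      (+ q ∣ y)
  anisotropic-∣ q c an x y dv = zero-residue x (proj₁ rs) , zero-residue y (proj₂ rs)
    where
    r = x %ℕ q
    s = y %ℕ q
    pos-eq : + (c ℕ.* (r ℕ.* r) ℕ.+ s ℕ.* s) ≡ + c * (+ r * + r) + + s * + s
    pos-eq = trans (pos-+ (c ℕ.* (r ℕ.* r)) (s ℕ.* s)) (cong₂ _+_ (trans (pos-* c (r ℕ.* r)) (cong (+ c *_)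
        (pos-* r r))) (pos-* s s))
    rs : r ≡ 0 × s ≡ 0
    rs = an (n%ℕd<d x q) (n%ℕd<d y q) (∣⇒∣ℕ (subst (+ q ∣_) (sym pos-eq)
           (≈-∣ (≈-+ (≈-*ˡ (+ c) (≈-* (%ℕ-≈ x q) (%ℕ-≈ x q))) (≈-* (%ℕ-≈ y q) (%ℕ-≈ y q))) dv)))
    zero-residue : ∀ x → x %ℕ q ≡ 0 → + q ∣ x
    zero-residue x eq = ≈0⇒∣ (≈-trans (%ℕ-≈ x q) (≈-reflexive (cong +_ eq)))

  prime-coprime-double : ∀ {q} M → Prime q → ¬ q ℕ.∣ 2 → ¬ q ℕ.∣ M → Coprime q (2 ℕ.* M)
  prime-coprime-double M pr q∤2 q∤M = Coprimality.sym (∤⇒coprime pr (λ d → [ q∤2 , q∤M ]′ (euclidsLemma 2 M pr d)))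

  residue≢0⇒∤ : ∀ {q m} .{{_ : ℕ.NonZero q}} → m % q ≢ 0 → ¬ q ℕ.∣ m
  residue≢0⇒∤ ne d = ne (ℕ.n∣m⇒m%n≡0 _ _ d)

  -- As -1 is not a square modulo 7, X and W are divisible by 7, and one factor 7 cancels.
  divide-by-7 : ∀ M → (∃[ X ] ∃[ W ] ∃[ Z ] + 4 * (+ 7 * M) ≡ X * X + W * W + + 7 * (Z * Z)) → ∃[ X ] ∃[ W ] ∃[ Z ]
      + 4 * M ≡ + 7 * (X * X) + + 7 * (W * W) + Z * Z
  divide-by-7 M (X , W , Z , eq) = go (anisotropic-∣ 7 1 (from-yes (anisotropic? 7 1)) X W
      (divides (+ 4 * M - Z * Z) (trans (e₁ X W Z) (trans (cong (_- + 7 * (Z * Z)) (sym eq)) (e₂ M Z)))))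
    where
    e₁ : ∀ X W Z → + 1 * (X * X) + W * W ≡ X * X + W * W + + 7 * (Z * Z) - + 7 * (Z * Z)
    e₁ = solve-∀
    e₂ : ∀ M Z → + 4 * (+ 7 * M) - + 7 * (Z * Z) ≡ (+ 4 * M - Z * Z) * + 7
    e₂ = solve-∀
    e₃ : ∀ M → + 7 * (+ 4 * M) ≡ + 4 * (+ 7 * M)
    e₃ = solve-∀
    e₄ : ∀ x w Z → x * + 7 * (x * + 7) + w * + 7 * (w * + 7) + + 7 * (Z * Z) ≡ + 7 * (+ 7 * (x * x) + + 7 * (w * w)
        + Z * Z)
    e₄ = solve-∀
    go : (+ 7 ∣ X) × (+ 7 ∣ W) → ∃[ X ] ∃[ W ] ∃[ Z ] + 4 * M ≡ + 7 * (X * X) + + 7 * (W * W) + Z * Z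
    go (divides x X≡ , divides w W≡) = x , w , Z , *-cancelˡ-≡ (+ 7) (+ 4 * M) _
      (trans (e₃ M) (trans eq (trans (cong₂ (λ u v → u * u + v * v + + 7 * (Z * Z)) X≡ W≡) (e₄ x w Z))))

  ScaledBy3 : ℤ → Set
  ScaledBy3 M = ∃[ X ] ∃[ U ] ∃[ Z ] + 3 * M ≡ + 15 * (X * X) + + 5 * (U * U) + Z * Z × ¬ (+ 2 ∣ Z)
  -- Three times the form is 3X² + (3Y + Z)² + 20Z². As -3 is not a square modulo 5, both X and 3Y +
  -- Z are divisible by 5; being even, they are divisible by 10.
  divide-by-20 : ∀ M → (∃[ X ] ∃[ Y ] ∃[ Z ] + 4 * (+ 5 * M) ≡ X * X + + 3 * (Y * Y) + + 2 * (Y * Z) + + 7 * (Z * Z) ×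
      (+ 2 ∣ X) × (+ 2 ∣ + 3 * Y + Z) × ¬ (+ 2 ∣ Z)) → ScaledBy3 M
  divide-by-20 M (X , Y , Z , eq , 2∣X , 2∣V , Z-odd) = go (anisotropic-∣ 5 3 (from-yes (anisotropic? 5 3)) X V
      (divides (+ 12 * M - + 4 * (Z * Z)) (trans (e₁ X Y Z) (trans (cong (λ u → + 3 * u - + 20 * (Z * Z)) (sym eq))
          (e₂ M Z)))))
    where
    V = + 3 * Y + Z
    e₁ : ∀ X Y Z → + 3 * (X * X) + (+ 3 * Y + Z) * (+ 3 * Y + Z) ≡ + 3 * (X * X + + 3 * (Y * Y) + + 2 * (Y * Z) + + 7 *
        (Z * Z)) - + 20 * (Z * Z)
    e₁ = solve-∀
    e₂ : ∀ M Z → + 3 * (+ 4 * (+ 5 * M)) - + 20 * (Z * Z) ≡ (+ 12 * M - + 4 * (Z * Z)) * + 5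
    e₂ = solve-∀
    e₃ : ∀ M → + 20 * (+ 3 * M) ≡ + 3 * (+ 4 * (+ 5 * M))
    e₃ = solve-∀
    e₄ : ∀ X Y Z → + 3 * (X * X + + 3 * (Y * Y) + + 2 * (Y * Z) + + 7 * (Z * Z)) ≡ + 3 * (X * X) + (+ 3 * Y + Z) *
        (+ 3 * Y + Z) + + 20 * (Z * Z)
    e₄ = solve-∀
    e₅ : ∀ x u Z → + 3 * (x * + 10 * (x * + 10)) + u * + 10 * (u * + 10) + + 20 * (Z * Z) ≡ + 20 * (+ 15 * (x * x)
        + + 5 * (u * u) + Z * Z)
    e₅ = solve-∀
    2,5 : Coprime 2 5
    2,5 = from-yes (coprime? 2 5)
    go : (+ 5 ∣ X) × (+ 5 ∣ V) → ScaledBy3 M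
    go (5∣X , 5∣V) = let divides x X≡ = coprime-*-∣ 2,5 2∣X 5∣X; divides u V≡ = coprime-*-∣ 2,5 2∣V 5∣V in x , u , Z
              , *-cancelˡ-≡ (+ 20) (+ 3 * M) _
      (trans (e₃ M) (trans (cong (+ 3 *_) eq) (trans (e₄ X Y Z) (trans (cong₂ (λ a b → + 3 * (a * a) + b * b + + 20 *
          (Z * Z)) X≡ V≡) (e₅ x u Z))))) , Z-odd

  module _ (t : ℕ) where
    open Three t using (h; M)

    -- These are the nonzero squares modulo 7, and reciprocity reverses the sign because 7 and M are
    -- both 3 modulo 4.
    J-7 : M % 7 ≡ 1 ⊎ M % 7 ≡ 2 ⊎ M % 7 ≡ 4 → J h 7 ≡ -1ℤ
    J-7 res = begin
      J h 7              ≡⟨ *-identityʳ (J h 7) ⟨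
      J h 7 * 1ℤ         ≡⟨ cong (J h 7 *_) J3M ⟨
      J h 7 * J 3 M      ≡⟨ reciprocity h 3 (Coprimality.sym (7-coprime)) ⟩
      ∏ h (λ _ → -1ℤ)    ≡⟨ ∏-odd t (inj₂ refl) ⟩
      -1ℤ ∎
      where
      open ≡-Reasoning
      at : ∀ r → M % 7 ≡ r → J 3 r ≡ 1ℤ → Coprime r 7 → J 3 M ≡ 1ℤ × Coprime 7 M
      at r eq Jr cr = trans (J-cong 3 M r cr M≈r) Jr , Coprimality.sym (Coprime-resp-≈ (≈-sym M≈r) cr)
        where
        M≈r : + M ≈ + r [ + 7 ]
        M≈r = ≈-trans (≈-sym (%-≈ M 7)) (≈-reflexive (cong +_ eq))
      both : J 3 M ≡ 1ℤ × Coprime 7 M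
      both = [ (λ e → at 1 e refl (from-yes (coprime? 1 7))) , [ (λ e → at 2 e refl (from-yes (coprime? 2 7))) ,
          (λ e → at 4 e refl (from-yes (coprime? 4 7))) ]′ ]′ res
      J3M = proj₁ both
      7-coprime : Coprime 7 M
      7-coprime = proj₂ both

    -- These are the nonsquares modulo 5, and reciprocity keeps the sign because 5 ≡ 1 mod 4.
    J-5 : M % 5 ≡ 2 ⊎ M % 5 ≡ 3 → J h 5 ≡ -1ℤ
    J-5 res = begin
      J h 5                     ≡⟨ *-identityʳ (J h 5) ⟨
      J h 5 * (-1ℤ * -1ℤ)       ≡⟨ *-assoc (J h 5) -1ℤ -1ℤ ⟨
      J h 5 * -1ℤ * -1ℤ         ≡⟨ cong (λ z → J h 5 * z * -1ℤ) (proj₁ both) ⟨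
      J h 5 * J 2 M * -1ℤ       ≡⟨ cong (_* -1ℤ) (trans (reciprocity h 2 (Coprimality.sym 5-coprime))
          (∏-1 h (λ _ _ → refl))) ⟩
      -1ℤ ∎
      where
      open ≡-Reasoning
      at : ∀ r → M % 5 ≡ r → J 2 r ≡ -1ℤ → Coprime r 5 → J 2 M ≡ -1ℤ × Coprime 5 M
      at r eq Jr cr = trans (J-cong 2 M r cr M≈r) Jr , Coprimality.sym (Coprime-resp-≈ (≈-sym M≈r) cr)
        where
        M≈r : + M ≈ + r [ + 5 ]
        M≈r = ≈-trans (≈-sym (%-≈ M 5)) (≈-reflexive (cong +_ eq))
      both : J 2 M ≡ -1ℤ × Coprime 5 M
      both = [ (λ e → at 2 e refl (from-yes (coprime? 2 5))) , (λ e → at 3 e refl (from-yes (coprime? 3 5))) ]′ res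
      5-coprime : Coprime 5 M
      5-coprime = proj₂ both

    represent-4M : M % 7 ≡ 1 ⊎ M % 7 ≡ 2 ⊎ M % 7 ≡ 4 → ∃[ X ] ∃[ W ] ∃[ Z ] + 4 * + M ≡ + 7 * (X * X) + + 7 * (W * W)
        + Z * Z
    represent-4M res = divide-by-7 (+ M) (represent-7 (reduced-tail (+<+ (s≤s z≤n)) ≤-refl (ternary-form t 7 (s≤s z≤n)
        (prime-coprime-double M (from-yes (prime? 7)) (from-no (7 ℕ.∣? 2)) (residue≢0⇒∤ nonzero)) (J-7 res))))
      where
      nonzero : M % 7 ≢ 0
      nonzero z = [ (λ e → contradiction (trans (sym z) e) (λ ())) , [ (λ e → contradiction (trans (sym z) e) (λ ())) ,
          (λ e → contradiction (trans (sym z) e) (λ ())) ]′ ]′ res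
    represent-3M : M % 5 ≡ 2 ⊎ M % 5 ≡ 3 → ∃[ X ] ∃[ U ] ∃[ Z ] + 3 * + M ≡ + 15 * (X * X) + + 5 * (U * U) + Z * Z × ¬
        (+ 2 ∣ Z)
    represent-3M res = divide-by-20 (+ M) (represent-5 (reduced-tail (+<+ (s≤s z≤n))
        (+≤+ (s≤s (s≤s (s≤s (s≤s (s≤s z≤n)))))) (ternary-form t 5 (s≤s z≤n)
        (prime-coprime-double M (from-yes (prime? 5)) (from-no (5 ℕ.∣? 2)) (residue≢0⇒∤ nonzero)) (J-5 res))) odd-value)
      where
      nonzero : M % 5 ≢ 0
      nonzero z = [ (λ e → contradiction (trans (sym z) e) (λ ())) , (λ e → contradiction (trans (sym z) e) (λ ())) ]′
          res
      odd-value : ¬ (+ 2 ∣ + 5 * + M)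
      odd-value = odd-not-even (+ 2 + + 5 * + h) (trans (cong (+ 5 *_) (cong (λ z → 1ℤ + z) (pos-+ h h))) (e (+ h)))
        where e : ∀ h → + 5 * (1ℤ + (h + h)) ≡ 1ℤ + + 2 * (+ 2 + + 5 * h)
              e = solve-∀

-- Nonnegativity of the coordinates.

module CauchyArgument where

  open import Data.Integer hiding (suc; _/_; _%_)
  open import Data.Integer.Properties
  open import Data.Integer.Divisibility.Signed
  open import Data.Integer.Tactic.RingSolver using (solve-∀)
  open TernaryForms using (0≤*; 0≤sq; from-diff)

  pentagonal-step : ∀ m → suc m ℕ.* (3 ℕ.* suc m ℕ.∸ 1) ≡ m ℕ.* (3 ℕ.* m ℕ.∸ 1) ℕ.+ (1 ℕ.+ 3 ℕ.* m) ℕ.* 2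
  pentagonal-step zero    = refl
  pentagonal-step (suc m) = e m
    where e : ∀ m → suc (suc m) ℕ.* (suc m ℕ.+ 2 ℕ.* suc (suc m)) ≡ suc m ℕ.* (m ℕ.+ 2 ℕ.* suc m) ℕ.+
              (1 ℕ.+ 3 ℕ.* suc m) ℕ.* 2
          e = ℕ.solve-∀

  p5-suc : ∀ m → p5 (suc m) ≡ p5 m ℕ.+ (1 ℕ.+ 3 ℕ.* m)
  p5-suc m = trans (cong (ℕ._/ 2) (pentagonal-step m)) (trans (ℕ.+-distrib-/-∣ʳ (m ℕ.* (3 ℕ.* m ℕ.∸ 1))
      (ℕ.n∣m*n (1 ℕ.+ 3 ℕ.* m)))
    (cong (p5 m ℕ.+_) (ℕ.m*n/n≡m (1 ℕ.+ 3 ℕ.* m) 2)))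

  p5-double : ∀ m → 2 ℕ.* p5 m ℕ.+ m ≡ 3 ℕ.* (m ℕ.* m)
  p5-double zero    = refl
  p5-double (suc m) = trans (cong (λ x → 2 ℕ.* x ℕ.+ suc m) (p5-suc m)) (trans (e₁ (p5 m) m)
      (trans (cong (ℕ._+ (3 ℕ.+ 6 ℕ.* m)) (p5-double m)) (e₂ m)))
    where
    e₁ : ∀ x m → 2 ℕ.* (x ℕ.+ (1 ℕ.+ 3 ℕ.* m)) ℕ.+ suc m ≡ 2 ℕ.* x ℕ.+ m ℕ.+ (3 ℕ.+ 6 ℕ.* m)
    e₁ = ℕ.solve-∀
    e₂ : ∀ m → 3 ℕ.* (m ℕ.* m) ℕ.+ (3 ℕ.+ 6 ℕ.* m) ≡ 3 ℕ.* (suc m ℕ.* suc m)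
    e₂ = ℕ.solve-∀

  module _ (D : ℕ) where

    linear quadratic : ℤ → ℤ → ℤ → ℤ → ℤ
    linear    w x y z = w + x + + 2 * y + + D * z
    quadratic w x y z = w * w + x * x + + 2 * (y * y) + + D * (z * z)

    quadratic≥0 : ∀ w x y z → 0ℤ ≤ quadratic w x y z
    quadratic≥0 w x y z = +-mono-≤ (+-mono-≤ (+-mono-≤ (0≤sq w) (0≤sq x)) (0≤* {+ 2} (+≤+ z≤n) (0≤sq y)))
        (0≤* {+ D} (+≤+ z≤n) (0≤sq z))

    -- Cauchy's argument: t is a coordinate of weight c and s is the surplus in the Cauchy–Schwarz
    -- inequality for the other three coordinates, whose weights add up to K.
    coordinate≥0 : ∀ {K c a b t s} → 0ℤ ≤ K → 1ℤ ≤ c → K + c ≡ + 4 + + D → 0ℤ ≤ a → 0ℤ ≤ b → 0ℤ ≤ s →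
                   K * (a - c * (t * t)) ≡ (b - c * t) * (b - c * t) + s →
                   (+ 3 + + D) * a < b * b + + 2 * b + (+ 4 + + D) → 0ℤ ≤ t
    coordinate≥0 {K} {c} {a} {b} {t} {s} 0≤K 1≤c K+c≡ 0≤a 0≤b 0≤s eq lt with 0ℤ ≤? t
    ... | yes h = h
    ... | no ¬h = contradiction lt (≤⇒≯ (from-diff {c = rest} rest≥0 identity))
      where
      u = - t - 1ℤ
      u≥0 : 0ℤ ≤ u
      u≥0 = i≤j⇒0≤j-i {1ℤ} { - t} (lemma (≰⇒> ¬h))
        where lemma : ∀ {t} → t < 0ℤ → 1ℤ ≤ - t
              lemma { + n} (+<+ ())
              lemma { -[1+ n ]} _ = +≤+ (s≤s z≤n)
      v = c - 1ℤ
      v≥0 : 0ℤ ≤ v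
      v≥0 = i≤j⇒0≤j-i 1≤c
      -- With t = -(1+u) and c = 1+v all terms of the difference are visibly nonnegative.
      rest = v * a + s + + 2 * b * (v + u + u * v) + (K + c) * (v * ((1ℤ + u) * (1ℤ + u)) + (+ 2 * u + u * u))
      rest≥0 : 0ℤ ≤ rest
      rest≥0 = +-mono-≤ (+-mono-≤ (+-mono-≤ (0≤* v≥0 0≤a) 0≤s) (0≤* (0≤* {+ 2} (+≤+ z≤n) 0≤b)
          (+-mono-≤ (+-mono-≤ v≥0 u≥0) (0≤* u≥0 v≥0))))
        (0≤* (+-mono-≤ 0≤K (≤-trans (+≤+ z≤n) 1≤c)) (+-mono-≤ (0≤* v≥0 (0≤sq (1ℤ + u)))
            (+-mono-≤ (0≤* {+ 2} (+≤+ z≤n) u≥0) (0≤sq u))))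
      e₁ : ∀ K c a b t s → (K + c - 1ℤ) * a - (b * b + + 2 * b + (K + c))
           ≡ K * (a - c * (t * t)) - ((b - c * t) * (b - c * t) + s) + ((c - 1ℤ) * a + s + + 2 * b * (c - 1ℤ
               + (- t - 1ℤ) + (- t - 1ℤ) * (c - 1ℤ))
               + (K + c) * ((c - 1ℤ) * ((1ℤ + (- t - 1ℤ)) * (1ℤ + (- t - 1ℤ))) + (+ 2 * (- t - 1ℤ) + (- t - 1ℤ) * (- t
                   - 1ℤ))))
      e₁ = solve-∀
      e₂ : ∀ D a → (+ 3 + D) * a ≡ (+ 4 + D - 1ℤ) * a
      e₂ = solve-∀
      e₃ : ∀ x y → x - x + y ≡ y
      e₃ = solve-∀
      identity : (+ 3 + + D) * a - (b * b + + 2 * b + (+ 4 + + D)) ≡ rest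
      identity = begin
        (+ 3 + + D) * a - (b * b + + 2 * b + (+ 4 + + D))      ≡⟨ cong (_- (b * b + + 2 * b + (+ 4 + + D))) (e₂ (+ D) a)
            ⟩
        (+ 4 + + D - 1ℤ) * a - (b * b + + 2 * b + (+ 4 + + D)) ≡⟨ cong (λ S → (S - 1ℤ) * a - (b * b + + 2 * b + S))
            (sym K+c≡) ⟩
        (K + c - 1ℤ) * a - (b * b + + 2 * b + (K + c))         ≡⟨ e₁ K c a b t s ⟩
        K * (a - c * (t * t)) - ((b - c * t) * (b - c * t) + s) + rest
          ≡⟨ cong (λ z → z - ((b - c * t) * (b - c * t) + s) + rest) eq ⟩
        (b - c * t) * (b - c * t) + s - ((b - c * t) * (b - c * t) + s) + rest ≡⟨ e₃ ((b - c * t) * (b - c * t) + s)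
            rest ⟩
        rest ∎
        where open ≡-Reasoning

    module _ (1≤D : 1 ℕ.≤ D) {w x y z : ℤ} where
      private
        a = quadratic w x y z
        b = linear w x y z

      -- For each coordinate, Lagrange's identity writes the surplus as a weighted sum of squared
      -- differences of the other three.
      all≥0 : 0ℤ ≤ b → (+ 3 + + D) * a < b * b + + 2 * b + (+ 4 + + D) → 0ℤ ≤ w × 0ℤ ≤ x × 0ℤ ≤ y × 0ℤ ≤ z
      all≥0 0≤b lt =
        coordinate≥0 {+ 3 + + D} {1ℤ} (+≤+ z≤n) ≤-refl (e₁ (+ D)) 0≤a 0≤b
          (+-mono-≤ (+-mono-≤ (2* (x - y)) (D* (x - z))) (0≤* {+ 2} (+≤+ z≤n) (D* (y - z)))) (e₂ (+ D) w x y z) lt ,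
        coordinate≥0 {+ 3 + + D} {1ℤ} (+≤+ z≤n) ≤-refl (e₁ (+ D)) 0≤a 0≤b
          (+-mono-≤ (+-mono-≤ (2* (w - y)) (D* (w - z))) (0≤* {+ 2} (+≤+ z≤n) (D* (y - z)))) (e₃ (+ D) w x y z) lt ,
        coordinate≥0 {+ 2 + + D} {+ 2} (+≤+ z≤n) (+≤+ (s≤s z≤n)) (e₄ (+ D)) 0≤a 0≤b
          (+-mono-≤ (+-mono-≤ (0≤sq (w - x)) (D* (w - z))) (D* (x - z))) (e₅ (+ D) w x y z) lt ,
        coordinate≥0 {+ 4} {+ D} (+≤+ z≤n) (+≤+ 1≤D) refl 0≤a 0≤b
          (+-mono-≤ (+-mono-≤ (0≤sq (w - x)) (2* (w - y))) (2* (x - y))) (e₆ (+ D) w x y z) lt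
        where
        0≤a = quadratic≥0 w x y z
        2* : ∀ u → 0ℤ ≤ + 2 * (u * u)
        2* u = 0≤* {+ 2} (+≤+ z≤n) (0≤sq u)
        D* : ∀ u → 0ℤ ≤ + D * (u * u)
        D* u = 0≤* {+ D} (+≤+ z≤n) (0≤sq u)
        e₁ : ∀ D → + 3 + D + 1ℤ ≡ + 4 + D
        e₁ = solve-∀
        e₄ : ∀ D → + 2 + D + + 2 ≡ + 4 + D
        e₄ = solve-∀
        e₂ : ∀ D w x y z → (+ 3 + D) * (w * w + x * x + + 2 * (y * y) + D * (z * z) - 1ℤ * (w * w))
             ≡ (w + x + + 2 * y + D * z - 1ℤ * w) * (w + x + + 2 * y + D * z - 1ℤ * w)
               + (+ 2 * ((x - y) * (x - y)) + D * ((x - z) * (x - z)) + + 2 * (D * ((y - z) * (y - z))))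
        e₂ = solve-∀
        e₃ : ∀ D w x y z → (+ 3 + D) * (w * w + x * x + + 2 * (y * y) + D * (z * z) - 1ℤ * (x * x))
             ≡ (w + x + + 2 * y + D * z - 1ℤ * x) * (w + x + + 2 * y + D * z - 1ℤ * x)
               + (+ 2 * ((w - y) * (w - y)) + D * ((w - z) * (w - z)) + + 2 * (D * ((y - z) * (y - z))))
        e₃ = solve-∀
        e₅ : ∀ D w x y z → (+ 2 + D) * (w * w + x * x + + 2 * (y * y) + D * (z * z) - + 2 * (y * y))
             ≡ (w + x + + 2 * y + D * z - + 2 * y) * (w + x + + 2 * y + D * z - + 2 * y)
               + ((w - x) * (w - x) + D * ((w - z) * (w - z)) + D * ((x - z) * (x - z)))
        e₅ = solve-∀
        e₆ : ∀ D w x y z → + 4 * (w * w + x * x + + 2 * (y * y) + D * (z * z) - D * (z * z))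
             ≡ (w + x + + 2 * y + D * z - D * z) * (w + x + + 2 * y + D * z - D * z)
               + ((w - x) * (w - x) + + 2 * ((w - y) * (w - y)) + + 2 * ((x - y) * (x - y)))
        e₆ = solve-∀

    Representation : ℕ → Set
    Representation n = ∃[ w ] ∃[ x ] ∃[ y ] ∃[ z ] n ≡ p5 w ℕ.+ p5 x ℕ.+ 2 ℕ.* p5 y ℕ.+ D ℕ.* p5 z

    represent-ℕ : ∀ n w x y z → + 3 * quadratic (+ w) (+ x) (+ y) (+ z) ≡ + 2 * + n + linear (+ w) (+ x) (+ y) (+ z)
        → Representation n
    represent-ℕ n w x y z eq = w , x , y , z , ℕ.*-cancelˡ-≡ n total 2 (ℕ.+-cancelʳ-≡ L (2 ℕ.* n) (2 ℕ.* total)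
        (trans (sym (+-injective (trans pos-Q (trans eq (sym pos-n))))) (sym doubled)))
      where
      total = p5 w ℕ.+ p5 x ℕ.+ 2 ℕ.* p5 y ℕ.+ D ℕ.* p5 z
      L = w ℕ.+ x ℕ.+ 2 ℕ.* y ℕ.+ D ℕ.* z
      Q = w ℕ.* w ℕ.+ x ℕ.* x ℕ.+ 2 ℕ.* (y ℕ.* y) ℕ.+ D ℕ.* (z ℕ.* z)
      e₁ : ∀ pw px py pz w x y z D → 2 ℕ.* (pw ℕ.+ px ℕ.+ 2 ℕ.* py ℕ.+ D ℕ.* pz) ℕ.+ (w ℕ.+ x ℕ.+ 2 ℕ.* y ℕ.+ D ℕ.* z)
           ≡ (2 ℕ.* pw ℕ.+ w) ℕ.+ (2 ℕ.* px ℕ.+ x) ℕ.+ 2 ℕ.* (2 ℕ.* py ℕ.+ y) ℕ.+ D ℕ.* (2 ℕ.* pz ℕ.+ z)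
      e₁ = ℕ.solve-∀
      e₂ : ∀ w x y z D → 3 ℕ.* w ℕ.+ 3 ℕ.* x ℕ.+ 2 ℕ.* (3 ℕ.* y) ℕ.+ D ℕ.* (3 ℕ.* z) ≡ 3 ℕ.* (w ℕ.+ x ℕ.+ 2 ℕ.* y ℕ.+ D
          ℕ.* z)
      e₂ = ℕ.solve-∀
      doubled : 2 ℕ.* total ℕ.+ L ≡ 3 ℕ.* Q
      doubled = trans (e₁ (p5 w) (p5 x) (p5 y) (p5 z) w x y z D) (trans (cong₂ (λ u v → u ℕ.+ D ℕ.* v)
        (cong₂ (λ u v → u ℕ.+ 2 ℕ.* v) (cong₂ ℕ._+_ (p5-double w) (p5-double x)) (p5-double y)) (p5-double z))
        (e₂ (w ℕ.* w) (x ℕ.* x) (y ℕ.* y) (z ℕ.* z) D))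
      pos-sum : ∀ a b c d → + (a ℕ.+ b ℕ.+ 2 ℕ.* c ℕ.+ D ℕ.* d) ≡ + a + + b + + 2 * + c + + D * + d
      pos-sum a b c d = trans (pos-+ (a ℕ.+ b ℕ.+ 2 ℕ.* c) (D ℕ.* d)) (cong₂ _+_ (trans (pos-+ (a ℕ.+ b) (2 ℕ.* c))
          (cong₂ _+_ (pos-+ a b) (pos-* 2 c))) (pos-* D d))
      pos-Q : + (3 ℕ.* Q) ≡ + 3 * quadratic (+ w) (+ x) (+ y) (+ z)
      pos-Q = trans (pos-* 3 Q) (cong (+ 3 *_) (trans (pos-sum (w ℕ.* w) (x ℕ.* x) (y ℕ.* y) (z ℕ.* z))
        (cong₂ (λ u v → u + + D * v) (cong₂ (λ u v → u + + 2 * v) (cong₂ _+_ (pos-* w w) (pos-* x x)) (pos-* y y))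
            (pos-* z z))))
      pos-n : + (2 ℕ.* n ℕ.+ L) ≡ + 2 * + n + linear (+ w) (+ x) (+ y) (+ z)
      pos-n = trans (pos-+ (2 ℕ.* n) L) (cong₂ _+_ (pos-* 2 n) (pos-sum w x y z))

    assemble : ∀ n w x y z → 0ℤ ≤ w × 0ℤ ≤ x × 0ℤ ≤ y × 0ℤ ≤ z →
               + 3 * quadratic w x y z ≡ + 2 * + n + linear w x y z → Representation n
    assemble n (+ w) (+ x) (+ y) (+ z) _ eq = represent-ℕ n w x y z eq

-- From ternary representations to solutions, D = 3.

module WeightThree where

  open import Data.Integer hiding (suc; _/_; _%_)
  open import Data.Integer.Properties
  open import Data.Integer.Divisibility.Signed
  open import Data.Integer.Tactic.RingSolver using (solve-∀)
  open import Data.Integer.DivMod using (_%ℕ_; n%ℕd<d)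
  open Congruences
  open ResidueSymbol using (odd)
  open EulerCriterion using (euclid)
  open NormLikeNumbers using (coprime-*-∣)

  open ReducedForms using (odd-not-even; parity)
  open HyperbolaMethod using (%-≈)
  open TernaryRepresentations
  open CauchyArgument

  choose-sign : ∀ {q} → (∀ x y → + q ∣ x * y → (+ q ∣ x) ⊎ (+ q ∣ y)) → ∀ x y → + q ∣ x * x - y * y →
                ∃[ y′ ] y′ * y′ ≡ y * y × (+ q ∣ x - y′)
  choose-sign {q} prime x y d with prime (x - y) (x + y) (subst (+ q ∣_) (e x y) d)
    where e : ∀ x y → x * x - y * y ≡ (x - y) * (x + y)
          e = solve-∀
  ... | inj₁ h = y , refl , h
  ... | inj₂ h = - y , e₁ y , subst (+ q ∣_) (e₂ x y) h
    where
    e₁ : ∀ y → - y * - y ≡ y * y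
    e₁ = solve-∀
    e₂ : ∀ x y → x + y ≡ x - - y
    e₂ = solve-∀

  euclid₂ : ∀ x y → + 2 ∣ x * y → (+ 2 ∣ x) ⊎ (+ 2 ∣ y)
  euclid₂ = euclid (from-yes (prime? 2))

  euclid₃ : ∀ x y → + 3 ∣ x * y → (+ 3 ∣ x) ⊎ (+ 3 ∣ y)
  euclid₃ = euclid (from-yes (prime? 3))

  euclid₅ : ∀ x y → + 5 ∣ x * y → (+ 5 ∣ x) ⊎ (+ 5 ∣ y)
  euclid₅ = euclid (from-yes (prime? 5))

  euclid₇ : ∀ x y → + 7 ∣ x * y → (+ 7 ∣ x) ⊎ (+ 7 ∣ y)
  euclid₇ = euclid (from-yes (prime? 7))

  squares-mod-3 : ∀ {r} → r ℕ.< 3 → ∀ {s} → s ℕ.< 3 → ∀ {u} → u ℕ.< 3 →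
                  3 ℕ.∣ r ℕ.* r ℕ.+ s ℕ.* s ℕ.+ u ℕ.* u → 3 ℕ.∣ r ℕ.* r ℕ.+ 2 ℕ.* (s ℕ.* s)
  squares-mod-3 = from-yes (ℕ.allUpTo? (λ r → ℕ.allUpTo? (λ s → ℕ.allUpTo? (λ u →
    (3 ℕ.∣? r ℕ.* r ℕ.+ s ℕ.* s ℕ.+ u ℕ.* u) →-dec (3 ℕ.∣? r ℕ.* r ℕ.+ 2 ℕ.* (s ℕ.* s))) 3) 3) 3)

  -- Squares are 0 or 1 modulo 3, so three of them with sum divisible by 3 are all congruent.
  equal-squares-mod-3 : ∀ x y z → + 3 ∣ x * x + y * y + z * z → + 3 ∣ x * x - y * y
  equal-squares-mod-3 x y z d = ≈0⇒∣ (≈-trans (≈-reflexive (e₁ x y)) (≈-+ table′ (∣⇒≈0 (divides (- (y * y)) (e₂ y)))))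
    where
    r = x %ℕ 3
    s = y %ℕ 3
    u = z %ℕ 3
    e₁ : ∀ x y → x * x - y * y ≡ x * x + + 2 * (y * y) + - (+ 3 * (y * y))
    e₁ = solve-∀
    e₂ : ∀ y → - (+ 3 * (y * y)) ≡ - (y * y) * + 3
    e₂ = solve-∀
    sq : ∀ x → x * x ≈ + ((x %ℕ 3) ℕ.* (x %ℕ 3)) [ + 3 ]
    sq x = ≈-trans (≈-* (%ℕ-≈ x 3) (%ℕ-≈ x 3)) (≈-reflexive (sym (pos-* (x %ℕ 3) (x %ℕ 3))))
    small : 3 ℕ.∣ r ℕ.* r ℕ.+ s ℕ.* s ℕ.+ u ℕ.* u
    small = ∣⇒∣ℕ (≈-∣ (≈-trans (≈-+ (≈-+ (sq x) (sq y)) (sq z)) (≈-reflexive (sym (trans (pos-+ (r ℕ.* r ℕ.+ s ℕ.* s)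
        (u ℕ.* u)) (cong (_+ + (u ℕ.* u)) (pos-+ (r ℕ.* r) (s ℕ.* s))))))) d)
    table : 3 ℕ.∣ r ℕ.* r ℕ.+ 2 ℕ.* (s ℕ.* s)
    table = squares-mod-3 (n%ℕd<d x 3) (n%ℕd<d y 3) (n%ℕd<d z 3) small
    table′ : x * x + + 2 * (y * y) ≈ 0ℤ [ + 3 ]
    table′ = ≈-trans (≈-+ (sq x) (≈-*ˡ (+ 2) (sq y)))
        (≈-trans (≈-reflexive (sym (trans (pos-+ (r ℕ.* r) (2 ℕ.* (s ℕ.* s))) (cong (λ v → + (r ℕ.* r) + v)
        (pos-* 2 (s ℕ.* s))))))
               (∣⇒≈0 (∣ℕ⇒∣ table)))

  -- The congruence says M ≡ 2b² modulo 7, and 2 is a square.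
  residues-7 : ∀ {r} → r ℕ.< 7 → ∀ {s} → s ℕ.< 7 → 7 ℕ.∣ 2 ℕ.* r ℕ.+ 3 ℕ.* (s ℕ.* s) → s ≢ 0 → r ≡ 1 ⊎ r ≡ 2 ⊎ r ≡ 4
  residues-7 = from-yes (ℕ.allUpTo? (λ r → ℕ.allUpTo? (λ s → (7 ℕ.∣? 2 ℕ.* r ℕ.+ 3 ℕ.* (s ℕ.* s)) →-dec (¬? (s ℕ.≟ 0)
    →-dec ((r ℕ.≟ 1) ⊎-dec ((r ℕ.≟ 2) ⊎-dec (r ℕ.≟ 4))))) 7) 7)

  -- The congruence says M ≡ 3b² modulo 5, and 3 is not a square.
  residues-5 : ∀ {r} → r ℕ.< 5 → ∀ {s} → s ℕ.< 5 → 5 ℕ.∣ 3 ℕ.* r ℕ.+ 1 ℕ.* (s ℕ.* s) → s ≢ 0 → r ≡ 2 ⊎ r ≡ 3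
  residues-5 = from-yes (ℕ.allUpTo? (λ r → ℕ.allUpTo? (λ s → (5 ℕ.∣? 3 ℕ.* r ℕ.+ 1 ℕ.* (s ℕ.* s)) →-dec (¬? (s ℕ.≟ 0)
    →-dec ((r ℕ.≟ 2) ⊎-dec (r ℕ.≟ 3)))) 5) 5)

  reduce-residues : ∀ q i j M b .{{_ : ℕ.NonZero q}} → q ℕ.∣ i ℕ.* M ℕ.+ j ℕ.* (b ℕ.* b) → q ℕ.∣ i ℕ.* (M % q) ℕ.+ j ℕ.*
      (b % q ℕ.* (b % q))
  reduce-residues q i j M b d = ∣⇒∣ℕ (subst (+ q ∣_) (sym (pos-eq i j (M % q) (b % q)))
    (≈-∣ (≈-+ (≈-*ˡ (+ i) (≈-sym (%-≈ M q))) (≈-*ˡ (+ j) (≈-* (≈-sym (%-≈ b q)) (≈-sym (%-≈ b q))))) (subst (+ q ∣_)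
        (pos-eq i j M b) (∣ℕ⇒∣ d))))
    where
    pos-eq : ∀ i j M b → + (i ℕ.* M ℕ.+ j ℕ.* (b ℕ.* b)) ≡ + i * + M + + j * (+ b * + b)
    pos-eq i j M b = trans (pos-+ (i ℕ.* M) (j ℕ.* (b ℕ.* b))) (cong₂ _+_ (pos-* i M) (trans (pos-* j (b ℕ.* b))
        (cong (+ j *_) (pos-* b b))))

  -- If X and W were both odd, the right side would be 2 + Z² modulo 4, which is never 0. Half of
  -- the even one becomes Q.
  split-even : ∀ M X W Z → + 4 * M ≡ + 7 * (X * X) + + 7 * (W * W) + Z * Z →
               ∃[ F ] ∃[ E ] ∃[ Q ] + 4 * M ≡ F * F + + 7 * (E * E) + + 28 * (Q * Q)
  split-even M X W Z eq with parity X | parity W | parity Z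
  ... | inj₁ (i , refl) | _ | _ = Z , W , i , trans eq (e i W Z)
    where e : ∀ i W Z → + 7 * (+ 2 * i * (+ 2 * i)) + + 7 * (W * W) + Z * Z ≡ Z * Z + + 7 * (W * W) + + 28 * (i * i)
          e = solve-∀
  ... | inj₂ _ | inj₁ (j , refl) | _ = Z , X , j , trans eq (e X j Z)
    where e : ∀ X j Z → + 7 * (X * X) + + 7 * (+ 2 * j * (+ 2 * j)) + Z * Z ≡ Z * Z + + 7 * (X * X) + + 28 * (j * j)
          e = solve-∀
  ... | inj₂ (i , refl) | inj₂ (j , refl) | inj₁ (l , refl) = contradiction
      (divides (M - + 7 * (i * i + i + j * j + j) - l * l) (*-cancelˡ-≡ (+ 2) (+ 7) _ (trans (e₁ i j l)
          (trans (cong (λ u → u - + 28 * (i * i + i + j * j + j) - + 4 * (l * l)) (sym eq)) (e₂ M i j l)))))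
      (odd-not-even (+ 3) refl)
    where
    e₁ : ∀ i j l → + 2 * + 7 ≡ (+ 7 * ((1ℤ + + 2 * i) * (1ℤ + + 2 * i)) + + 7 * ((1ℤ + + 2 * j) * (1ℤ + + 2 * j))
        + + 2 * l * (+ 2 * l)) - + 28 * (i * i + i + j * j + j) - + 4 * (l * l)
    e₁ = solve-∀
    e₂ : ∀ M i j l → + 4 * M - + 28 * (i * i + i + j * j + j) - + 4 * (l * l)
        ≡ + 2 * ((M - + 7 * (i * i + i + j * j + j) - l * l) * + 2)
    e₂ = solve-∀
  ... | inj₂ (i , refl) | inj₂ (j , refl) | inj₂ (l , refl) = contradiction
      (divides (+ 2 * M) (e₂ M)) (odd-not-even (+ 7 + + 14 * (i * i + i + j * j + j) + + 2 * (l + l * l))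
          (trans eq (e₁ i j l)))
    where
    e₁ : ∀ i j l → + 7 * ((1ℤ + + 2 * i) * (1ℤ + + 2 * i)) + + 7 * ((1ℤ + + 2 * j) * (1ℤ + + 2 * j)) + (1ℤ + + 2 * l) *
        (1ℤ + + 2 * l)
         ≡ 1ℤ + + 2 * (+ 7 + + 14 * (i * i + i + j * j + j) + + 2 * (l + l * l))
    e₁ = solve-∀
    e₂ : ∀ M → + 4 * M ≡ + 2 * M * + 2
    e₂ = solve-∀

  -- Here b = w + x + 2y + 3z, F = b - 7x, E = b - x - 6z and Q = w - y; the congruences that make
  -- w, x, y, z integral can be met by changing the signs of F, E and Q.
  solve-3 : ∀ (n b : ℕ) (M : ℤ) → + 2 * M ≡ + 14 * + n + + 7 * + b - + 3 * (+ b * + b) → + 3 ∣ M → + 4 * + n < + b * + b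
      + + 7 →
            (∃[ F ] ∃[ E ] ∃[ Q ] + 4 * M ≡ F * F + + 7 * (E * E) + + 28 * (Q * Q)) → Representation 3 n
  solve-3 n b₀ M M≡ 3∣M bound (F₀ , E₀ , Q₀ , eq₀) = build F F²≡ 7∣ (choose-sign euclid₃ F E₀ dE) (choose-sign euclid₃ F
      Q₀ dQ)
    where
    b = + b₀
    7∣₀ : + 7 ∣ b * b - F₀ * F₀
    7∣₀ = divides (b * b + E₀ * E₀ + + 4 * (Q₀ * Q₀) - (+ 4 * + n + + 2 * b)) (trans (e₁ b F₀ E₀ Q₀)
        (trans (cong (λ u → b * b + + 7 * (E₀ * E₀) + + 28 * (Q₀ * Q₀) - u) (trans (sym eq₀) (trans (e₂ M)
        (cong (+ 2 *_) M≡)))) (e₃ b (+ n) E₀ Q₀)))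
      where
      e₁ : ∀ b F E Q → b * b - F * F ≡ b * b + + 7 * (E * E) + + 28 * (Q * Q) - (F * F + + 7 * (E * E) + + 28 * (Q * Q))
      e₁ = solve-∀
      e₂ : ∀ M → + 4 * M ≡ + 2 * (+ 2 * M)
      e₂ = solve-∀
      e₃ : ∀ b n E Q → b * b + + 7 * (E * E) + + 28 * (Q * Q) - + 2 * (+ 14 * n + + 7 * b - + 3 * (b * b)) ≡
          (b * b + E * E + + 4 * (Q * Q) - (+ 4 * n + + 2 * b)) * + 7
      e₃ = solve-∀
    signed = choose-sign euclid₇ b F₀ 7∣₀
    F = proj₁ signed
    F²≡ : + 4 * M ≡ F * F + + 7 * (E₀ * E₀) + + 28 * (Q₀ * Q₀)
    F²≡ = trans eq₀ (cong (λ u → u + + 7 * (E₀ * E₀) + + 28 * (Q₀ * Q₀)) (sym (proj₁ (proj₂ signed))))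
    7∣ : + 7 ∣ b - F
    7∣ = proj₂ (proj₂ signed)
    3∣sum : + 3 ∣ F * F + E₀ * E₀ + Q₀ * Q₀
    3∣sum = subst (+ 3 ∣_) (trans (cong (λ u → u - (+ 2 * (E₀ * E₀) + + 9 * (Q₀ * Q₀)) * + 3) F²≡) (e F E₀ Q₀))
              (∣m∣n⇒∣m-n (∣n⇒∣m*n (+ 4) 3∣M) (divides (+ 2 * (E₀ * E₀) + + 9 * (Q₀ * Q₀)) refl))
      where e : ∀ F E Q → F * F + + 7 * (E * E) + + 28 * (Q * Q) - (+ 2 * (E * E) + + 9 * (Q * Q)) * + 3 ≡ F * F + E * E
                + Q * Q
            e = solve-∀
    dE = equal-squares-mod-3 F E₀ Q₀ 3∣sum
    dQ = equal-squares-mod-3 F Q₀ E₀ (subst (+ 3 ∣_) (e (F * F) (E₀ * E₀) (Q₀ * Q₀)) 3∣sum)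
      where e : ∀ x y z → x + y + z ≡ x + z + y
            e = solve-∀
    build : ∀ F → + 4 * M ≡ F * F + + 7 * (E₀ * E₀) + + 28 * (Q₀ * Q₀) → + 7 ∣ b - F →
            (∃[ E ] E * E ≡ E₀ * E₀ × (+ 3 ∣ F - E)) → (∃[ Q ] Q * Q ≡ Q₀ * Q₀ × (+ 3 ∣ F - Q)) → Representation 3 n
    build F eqF (divides x x≡) (E , E² , 3∣E) (Q , Q² , 3∣Q) = finish (coprime-*-∣ (from-yes (coprime? 2 3)) 2∣F-E 3∣E)
        3∣E-Q
      where
      eq : + 4 * M ≡ F * F + + 7 * (E * E) + + 28 * (Q * Q)
      eq = trans eqF (cong₂ (λ u v → F * F + + 7 * u + + 28 * v) (sym E²) (sym Q²))
      3∣E-Q : + 3 ∣ E - Q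
      3∣E-Q = subst (+ 3 ∣_) (e F E Q) (∣m∣n⇒∣m-n 3∣Q 3∣E)
        where e : ∀ F E Q → F - Q - (F - E) ≡ E - Q
              e = solve-∀
      2∣F-E : + 2 ∣ F - E
      2∣F-E = [ (λ h → h) , (λ h → subst (+ 2 ∣_) (e₃ F E) (∣m∣n⇒∣m-n h (divides E refl))) ]′
        (euclid₂ (F - E) (F + E) (divides (+ 2 * M - + 4 * (E * E) - + 14 * (Q * Q)) (trans (e₁ F E Q)
            (trans (cong (λ u → u - + 8 * (E * E) - + 28 * (Q * Q)) (sym eq)) (e₂ M E Q)))))
        where
        e₁ : ∀ F E Q → (F - E) * (F + E) ≡ F * F + + 7 * (E * E) + + 28 * (Q * Q) - + 8 * (E * E) - + 28 * (Q * Q)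
        e₁ = solve-∀
        e₂ : ∀ M E Q → + 4 * M - + 8 * (E * E) - + 28 * (Q * Q) ≡ (+ 2 * M - + 4 * (E * E) - + 14 * (Q * Q)) * + 2
        e₂ = solve-∀
        e₃ : ∀ F E → F + E - E * + 2 ≡ F - E
        e₃ = solve-∀
      finish : + 6 ∣ F - E → + 3 ∣ E - Q → Representation 3 n
      finish (divides s s≡) (divides v v≡) = assemble 3 n (z + v + Q) x (z + v) z
          (all≥0 3 (s≤s z≤n) {z + v + Q} {x} {z + v} {z} (subst (0ℤ ≤_) (sym linear≡) (+≤+ z≤n)) bounded) (trans three-a
              (cong (λ u → + 2 * + n + u) (sym linear≡)))
        where
        z = s + x
        A = quadratic 3 (z + v + Q) x (z + v) z
        Q≡ : Q ≡ E - v * + 3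
        Q≡ = trans (e Q E) (cong (λ u → E - u) v≡)
          where e : ∀ Q E → Q ≡ E - (E - Q)
                e = solve-∀
        F≡ : F ≡ E + s * + 6
        F≡ = trans (e F E) (cong (λ u → E + u) s≡)
          where e : ∀ F E → F ≡ E + (F - E)
                e = solve-∀
        b≡ : b ≡ E + s * + 6 + x * + 7
        b≡ = trans (e b F) (cong₂ _+_ F≡ x≡)
          where e : ∀ b F → b ≡ F + (b - F)
                e = solve-∀
        linear≡ : linear 3 (z + v + Q) x (z + v) z ≡ b
        linear≡ = trans (cong (λ u → linear 3 (z + v + u) x (z + v) z) Q≡) (trans (e s x v E) (sym b≡))
          where e : ∀ s x v E → s + x + v + (E - v * + 3) + x + + 2 * (s + x + v) + + 3 * (s + x) ≡ E + s * + 6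
                    + x * + 7
                e = solve-∀
        42A : + 42 * A ≡ + 6 * (b * b) + + 4 * M
        42A = trans (cong (λ u → + 42 * quadratic 3 (z + v + u) x (z + v) z) Q≡) (trans (e s x v E)
                (cong₂ (λ u w → + 6 * (u * u) + w) (sym b≡) (trans (cong₂ (λ f q → f * f + + 7 * (E * E) + + 28 *
                    (q * q)) (sym F≡) (sym Q≡)) (sym eq))))
          where e : ∀ s x v E → + 42 * ((s + x + v + (E - v * + 3)) * (s + x + v + (E - v * + 3)) + x * x + + 2 *
                    ((s + x + v) * (s + x + v)) + + 3 * ((s + x) * (s + x)))
                    ≡ + 6 * ((E + s * + 6 + x * + 7) * (E + s * + 6 + x * + 7)) + ((E + s * + 6) * (E + s * + 6) + + 7 *
                        (E * E) + + 28 * ((E - v * + 3) * (E - v * + 3)))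
                e = solve-∀
        three-a : + 3 * A ≡ + 2 * + n + b
        three-a = *-cancelˡ-≡ (+ 14) (+ 3 * A) (+ 2 * + n + b) (trans (e₁ A) (trans 42A (trans (e₂ b M)
            (trans (cong (λ u → + 6 * (b * b) + + 2 * u) M≡) (e₃ (+ n) b)))))
          where
          e₁ : ∀ A → + 14 * (+ 3 * A) ≡ + 42 * A
          e₁ = solve-∀
          e₂ : ∀ b M → + 6 * (b * b) + + 4 * M ≡ + 6 * (b * b) + + 2 * (+ 2 * M)
          e₂ = solve-∀
          e₃ : ∀ n b → + 6 * (b * b) + + 2 * (+ 14 * n + + 7 * b - + 3 * (b * b)) ≡ + 14 * (+ 2 * n + b)
          e₃ = solve-∀
        bounded : (+ 3 + + 3) * A < linear 3 (z + v + Q) x (z + v) z * linear 3 (z + v + Q) x (z + v) z + + 2 * linear 3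
            (z + v + Q) x (z + v) z + (+ 4 + + 3)
        bounded = subst (λ u → + 6 * A < u * u + + 2 * u + + 7) (sym linear≡)
          (subst (_< b * b + + 2 * b + + 7) (sym (trans (e₁ A) (trans (cong (+ 2 *_) three-a) (e₂ (+ n) b))))
            (subst (+ 4 * + n + + 2 * b <_) (e₃ b) (+-monoˡ-< (+ 2 * b) bound)))
          where
          e₁ : ∀ A → + 6 * A ≡ + 2 * (+ 3 * A)
          e₁ = solve-∀
          e₂ : ∀ n b → + 2 * (+ 2 * n + b) ≡ + 4 * n + + 2 * b
          e₂ = solve-∀
          e₃ : ∀ b → b * b + + 7 + + 2 * b ≡ b * b + + 2 * b + + 7
          e₃ = solve-∀

  case-3 : ∀ n b t → + 2 * + odd (odd t) ≡ + 14 * + n + + 7 * + b - + 3 * (+ b * + b) → + 3 ∣ + b + + 2 * + n → ¬ 7 ℕ.∣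
      b →
           + 4 * + n < + b * + b + + 7 → Representation 3 n
  case-3 n b t M≡ 3∣ 7∤b bound = solve-3 n b (+ M) M≡ 3∣M bound (let X , W , Z , eq = represent-4M t res in split-even
      (+ M) X W Z eq)
    where
    M = odd (odd t)
    3∣M : + 3 ∣ + M
    3∣M = [ (λ h → contradiction (∣⇒∣ℕ h) (from-no (3 ℕ.∣? 2))) , (λ h → h) ]′ (euclid₃ (+ 2) (+ M) (subst (+ 3 ∣_)
        (sym (trans M≡ (e (+ n) (+ b))))
            (∣m∣n⇒∣m+n (divides (+ 4 * + n + + 2 * + b - + b * + b) refl) 3∣)))
      where e : ∀ n b → + 14 * n + + 7 * b - + 3 * (b * b) ≡ (+ 4 * n + + 2 * b - b * b) * + 3 + (b + + 2 * n)
            e = solve-∀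
    7∣ : 7 ℕ.∣ 2 ℕ.* M ℕ.+ 3 ℕ.* (b ℕ.* b)
    7∣ = ∣⇒∣ℕ (divides (+ 2 * + n + + b) (trans (trans (pos-+ (2 ℕ.* M) (3 ℕ.* (b ℕ.* b)))
        (cong₂ _+_ (trans (pos-* 2 M) M≡) (trans (pos-* 3 (b ℕ.* b)) (cong (+ 3 *_) (pos-* b b))))) (e (+ n) (+ b))))
      where e : ∀ n b → + 14 * n + + 7 * b - + 3 * (b * b) + + 3 * (b * b) ≡ (+ 2 * n + b) * + 7
            e = solve-∀
    res : M % 7 ≡ 1 ⊎ M % 7 ≡ 2 ⊎ M % 7 ≡ 4
    res = residues-7 (ℕ.m%n<n M 7) (ℕ.m%n<n b 7) (reduce-residues 7 2 3 M b 7∣) (λ e → 7∤b (ℕ.m%n≡0⇒n∣m b 7 e))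

-- From ternary representations to solutions, D = 6.

module WeightSix where

  open import Data.Integer hiding (suc; _/_; _%_)
  open import Data.Integer.Properties
  open import Data.Integer.Divisibility.Signed
  open import Data.Integer.Tactic.RingSolver using (solve-∀)
  open Congruences
  open ResidueSymbol using (odd)
  open NormLikeNumbers using (coprime-*-∣)
  open ReducedForms using (odd-not-even; parity)
  open TernaryRepresentations
  open CauchyArgument
  open WeightThree

  -- The divisibility by 4 is what permits writing U = 4q - X with an integer q.
  Balanced : ℤ → ℤ → Set
  Balanced X U = ∃[ X′ ] ∃[ U′ ] + 15 * (X′ * X′) + + 5 * (U′ * U′) ≡ + 15 * (X * X) + + 5 * (U * U) × (+ 4 ∣ X′ + U′)

  -- For odd X and U one of U + X and U - X is divisible by 4, so at most the sign of X has to
  -- change.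
  balance-odd : ∀ i j → Balanced (1ℤ + + 2 * i) (1ℤ + + 2 * j)
  balance-odd i j = [ (λ (k , eq) → - (1ℤ + + 2 * i) , 1ℤ + + 2 * j , e₁ (1ℤ + + 2 * i) (1ℤ + + 2 * j) , divides (k - i)
      (trans (e₂ i j) (trans (cong (λ u → + 2 * (u - + 2 * i)) eq) (e₃ i k)))) ,
                      (λ (k , eq) → 1ℤ + + 2 * i , 1ℤ + + 2 * j , refl , divides (1ℤ + k) (trans (e₄ i j)
                          (trans (cong (λ u → + 2 * (1ℤ + u)) eq) (e₅ k)))) ]′ (parity (i + j))
    where
    e₁ : ∀ x u → + 15 * (- x * - x) + + 5 * (u * u) ≡ + 15 * (x * x) + + 5 * (u * u)
    e₁ = solve-∀
    e₂ : ∀ i j → - (1ℤ + + 2 * i) + (1ℤ + + 2 * j) ≡ + 2 * (i + j - + 2 * i)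
    e₂ = solve-∀
    e₃ : ∀ i k → + 2 * (+ 2 * k - + 2 * i) ≡ (k - i) * + 4
    e₃ = solve-∀
    e₄ : ∀ i j → 1ℤ + + 2 * i + (1ℤ + + 2 * j) ≡ + 2 * (1ℤ + (i + j))
    e₄ = solve-∀
    e₅ : ∀ k → + 2 * (1ℤ + (1ℤ + + 2 * k)) ≡ (1ℤ + k) * + 4
    e₅ = solve-∀

  -- If X ≡ U + 2 mod 4 are both even, a rotation by 60° in the hexagonal lattice 3X² + U² makes them odd.
  balance : ∀ X U → + 2 ∣ X + U → Balanced X U
  balance X U 2∣ with parity X | parity U
  ... | inj₂ (i , refl) | inj₂ (j , refl) = balance-odd i j
  ... | inj₁ (i , refl) | inj₂ (j , refl) = contradiction 2∣ (odd-not-even (i + j) (e i j))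
    where e : ∀ i j → + 2 * i + (1ℤ + + 2 * j) ≡ 1ℤ + + 2 * (i + j)
          e = solve-∀
  ... | inj₂ (i , refl) | inj₁ (j , refl) = contradiction 2∣ (odd-not-even (i + j) (e i j))
    where e : ∀ i j → 1ℤ + + 2 * i + + 2 * j ≡ 1ℤ + + 2 * (i + j)
          e = solve-∀
  ... | inj₁ (i , refl) | inj₁ (j , refl) with parity (i + j)
  ...   | inj₁ (k , eq) = + 2 * i , + 2 * j , refl , divides k (trans (e₁ i j) (trans (cong (+ 2 *_) eq) (e₂ k)))
    where
    e₁ : ∀ i j → + 2 * i + + 2 * j ≡ + 2 * (i + j)
    e₁ = solve-∀
    e₂ : ∀ k → + 2 * (+ 2 * k) ≡ k * + 4
    e₂ = solve-∀
  ...   | inj₂ (k , eq) = transfer (balance-odd k (k - + 2 * i))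
    where
    transfer : Balanced (1ℤ + + 2 * k) (1ℤ + + 2 * (k - + 2 * i)) → Balanced (+ 2 * i) (+ 2 * j)
    transfer (X′ , U′ , q , d) = X′ , U′ , trans q (trans (e₃ k i)
        (trans (cong (λ u → + 15 * (u * u) + + 5 * ((u - + 4 * i) * (u - + 4 * i))) (sym eq)) (e₄ i j))) , d
     where
      e₃ : ∀ k i → + 15 * ((1ℤ + + 2 * k) * (1ℤ + + 2 * k)) + + 5 * ((1ℤ + + 2 * (k - + 2 * i)) * (1ℤ + + 2 *
          (k - + 2 * i)))
           ≡ + 15 * ((1ℤ + + 2 * k) * (1ℤ + + 2 * k)) + + 5 * ((1ℤ + + 2 * k - + 4 * i) * (1ℤ + + 2 * k - + 4 * i))
      e₃ = solve-∀
      e₄ : ∀ i j → + 15 * ((i + j) * (i + j)) + + 5 * ((i + j - + 4 * i) * (i + j - + 4 * i))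
          ≡ + 15 * (+ 2 * i * (+ 2 * i)) + + 5 * (+ 2 * j * (+ 2 * j))
      e₄ = solve-∀

  module Solve6 (n b₀ : ℕ) (M : ℤ) (M≡ : + 9 * M ≡ + 20 * + n + + 10 * + b₀ - + 3 * (+ b₀ * + b₀))
                (bound : + 6 * + n + + b₀ < + b₀ * + b₀ + + 10) where
    b = + b₀

    -- The last equation is 3M = 15X² + 5U² + Z² with U = 4q - X and Z = U + 3c, and c, q, X are the
    -- coordinates of (w, x, y, z) - z₀ (1, 1, 1, 1) up to a unimodular change of basis.
    finish : ∀ z₀ c q X → b ≡ c + + 3 * X - + 2 * q + z₀ * + 10 →
             + 3 * M ≡ + 15 * (X * X) + + 5 * ((+ 4 * q - X) * (+ 4 * q - X)) + (+ 4 * q - X + + 3 * c) * (+ 4 * q - X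
                 + + 3 * c) →
             Representation 6 n
    finish z₀ c q X b≡ eq = assemble 6 n w x y z₀
        (all≥0 6 (s≤s z≤n) {w} {x} {y} {z₀} (subst (0ℤ ≤_) (sym linear≡) (+≤+ z≤n)) bounded) (trans three-a
            (cong (λ u → + 2 * + n + u) (sym linear≡)))
      where
      w = z₀ + c + q
      x = z₀ + X - + 3 * q
      y = z₀ + X
      A = quadratic 6 w x y z₀
      linear≡ : linear 6 w x y z₀ ≡ b
      linear≡ = trans (e z₀ c q X) (sym b≡)
        where e : ∀ z c q X → z + c + q + (z + X - + 3 * q) + + 2 * (z + X) + + 6 * z ≡ c + + 3 * X - + 2 * q + z * + 10
              e = solve-∀
      10A : + 10 * A ≡ b * b + + 3 * M
      10A = trans (e z₀ c q X) (cong₂ (λ u v → u * u + v) (sym b≡) (sym eq))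
        where e : ∀ z c q X → + 10 * ((z + c + q) * (z + c + q) + (z + X - + 3 * q) * (z + X - + 3 * q) + + 2 *
                  ((z + X) * (z + X)) + + 6 * (z * z))
                  ≡ (c + + 3 * X - + 2 * q + z * + 10) * (c + + 3 * X - + 2 * q + z * + 10)
                    + (+ 15 * (X * X) + + 5 * ((+ 4 * q - X) * (+ 4 * q - X)) + (+ 4 * q - X + + 3 * c) * (+ 4 * q - X
                        + + 3 * c))
              e = solve-∀
      three-a : + 3 * A ≡ + 2 * + n + b
      three-a = *-cancelˡ-≡ (+ 10) (+ 3 * A) (+ 2 * + n + b) (trans (e₁ A) (trans (cong (+ 3 *_) 10A) (trans (e₂ b M)
          (trans (cong (λ u → + 3 * (b * b) + u) M≡) (e₃ (+ n) b)))))
        where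
        e₁ : ∀ A → + 10 * (+ 3 * A) ≡ + 3 * (+ 10 * A)
        e₁ = solve-∀
        e₂ : ∀ b M → + 3 * (b * b + + 3 * M) ≡ + 3 * (b * b) + + 9 * M
        e₂ = solve-∀
        e₃ : ∀ n b → + 3 * (b * b) + (+ 20 * n + + 10 * b - + 3 * (b * b)) ≡ + 10 * (+ 2 * n + b)
        e₃ = solve-∀
      bounded : (+ 3 + + 6) * A < linear 6 w x y z₀ * linear 6 w x y z₀ + + 2 * linear 6 w x y z₀ + (+ 4 + + 6)
      bounded = subst (λ u → + 9 * A < u * u + + 2 * u + + 10) (sym linear≡)
        (subst (_< b * b + + 2 * b + + 10) (sym (trans (e₁ A) (trans (cong (+ 3 *_) three-a) (e₂ (+ n) b))))
          (subst (+ 6 * + n + b + + 2 * b <_) (e₃ b) (+-monoˡ-< (+ 2 * b) bound)))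
        where
        e₁ : ∀ A → + 9 * A ≡ + 3 * (+ 3 * A)
        e₁ = solve-∀
        e₂ : ∀ n b → + 3 * (+ 2 * n + b) ≡ + 6 * n + b + + 2 * b
        e₂ = solve-∀
        e₃ : ∀ b → b * b + + 10 + + 2 * b ≡ b * b + + 2 * b + + 10
        e₃ = solve-∀

    Odd : ℤ → Set
    Odd x = ∃[ k ] x ≡ 1ℤ + + 2 * k

    with-class : Odd b → ∀ c q X → + 2 ∣ 1ℤ + (+ 4 * q - X + + 3 * c) →
                 + 3 * M ≡ + 15 * (X * X) + + 5 * ((+ 4 * q - X) * (+ 4 * q - X)) + (+ 4 * q - X + + 3 * c) * (+ 4 * q
                     - X + + 3 * c) →
                 + 5 ∣ b - (c + + 3 * X - + 2 * q) → Representation 6 n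
    with-class (k , b≡) c q X Z-odd eq 5∣ = use (coprime-*-∣ (from-yes (coprime? 2 5)) 2∣ 5∣)
      where
      use : + 10 ∣ b - (c + + 3 * X - + 2 * q) → Representation 6 n
      use (divides z z≡) = finish z c q X (trans (e₀ b (c + + 3 * X - + 2 * q)) (cong (λ u → c + + 3 * X - + 2 * q + u)
          z≡)) eq
        where
        e₀ : ∀ b A → b ≡ A + (b - A)
        e₀ = solve-∀
      A = c + + 3 * X - + 2 * q
      e : ∀ k c q X → (k - + 2 * c - X - q) * + 2 + (1ℤ + (+ 4 * q - X + + 3 * c)) ≡ 1ℤ + + 2 * k - (c + + 3 * X
          - + 2 * q)
      e = solve-∀
      2∣ : + 2 ∣ b - A
      2∣ = subst (+ 2 ∣_) (trans (e k c q X) (cong (_- A) (sym b≡))) (∣m∣n⇒∣m+n (divides (k - + 2 * c - X - q) refl)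
          Z-odd)

    -- X + U is even because M and Z are odd, so the pair can be balanced. Modulo 3 the equation
    -- gives U² ≡ Z², which settles the sign of Z and defines c. Modulo 5 it gives b² ≡ A² for A = c
    -- + 3X - 2q, and negating c, q and X together turns b ≡ -A into b ≡ A.
    solve-6 : Odd b → (∃[ X ] ∃[ U ] ∃[ Z ] + 3 * M ≡ + 15 * (X * X) + + 5 * (U * U) + Z * Z × ¬ (+ 2 ∣ Z)) → + 2 ∣ 1ℤ
        + M → Representation 6 n
    solve-6 b-odd (X₀ , U₀ , Z₀ , eq₀ , Z₀-odd) M-odd = step (balance X₀ U₀ 2∣X+U)
      where
      Z₀-form : Odd Z₀
      Z₀-form = [ (λ (k , eq) → contradiction (divides k (trans eq (*-comm (+ 2) k))) Z₀-odd) , (λ o → o) ]′ (parity Z₀)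
      2∣X+U : + 2 ∣ X₀ + U₀
      2∣X+U = subst (+ 2 ∣_) (trans (cong (λ u → u - Z₀ * Z₀ - (+ 7 * (X₀ * X₀) + + 2 * (U₀ * U₀)) * + 2
          - (X₀ * X₀ - X₀) - (U₀ * U₀ - U₀)) eq₀) (e₁ X₀ U₀ Z₀))
          (∣m∣n⇒∣m-n (∣m∣n⇒∣m-n (∣m∣n⇒∣m-n 2∣3M-Z² (divides (+ 7 * (X₀ * X₀) + + 2 * (U₀ * U₀)) refl)) (2∣x²-x X₀))
              (2∣x²-x U₀))
        where
        e₁ : ∀ X U Z → + 15 * (X * X) + + 5 * (U * U) + Z * Z - Z * Z - (+ 7 * (X * X) + + 2 * (U * U)) * + 2
            - (X * X - X) - (U * U - U) ≡ X + U
        e₁ = solve-∀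
        e₂ : ∀ M Z → + 3 * (1ℤ + M) - (Z * Z - Z) - (1ℤ + Z) - 1ℤ * + 2 ≡ + 3 * M - Z * Z
        e₂ = solve-∀
        e₃ : ∀ k → 1ℤ + (1ℤ + + 2 * k) ≡ (1ℤ + k) * + 2
        e₃ = solve-∀
        2∣x²-x : ∀ x → + 2 ∣ x * x - x
        2∣x²-x x with parity x
        ... | inj₁ (k , refl) = divides (+ 2 * (k * k) - k) (e k)
          where e : ∀ k → + 2 * k * (+ 2 * k) - + 2 * k ≡ (+ 2 * (k * k) - k) * + 2
                e = solve-∀
        ... | inj₂ (k , refl) = divides (+ 2 * (k * k) + k) (e k)
          where e : ∀ k → (1ℤ + + 2 * k) * (1ℤ + + 2 * k) - (1ℤ + + 2 * k) ≡ (+ 2 * (k * k) + k) * + 2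
                e = solve-∀
        2∣3M-Z² : + 2 ∣ + 3 * M - Z₀ * Z₀
        2∣3M-Z² = subst (+ 2 ∣_) (e₂ M Z₀) (∣m∣n⇒∣m-n (∣m∣n⇒∣m-n (∣m∣n⇒∣m-n (∣n⇒∣m*n (+ 3) M-odd) (2∣x²-x Z₀))
                    (divides (1ℤ + proj₁ Z₀-form) (trans (cong (λ u → 1ℤ + u) (proj₂ Z₀-form)) (e₃ (proj₁ Z₀-form)))))
                        (divides 1ℤ refl))
      step : Balanced X₀ U₀ → Representation 6 n
      step (X , U , q≡ , divides q X+U≡) = go (choose-sign euclid₃ U Z₀ 3∣)
        where
        eq₁ : + 3 * M ≡ + 15 * (X * X) + + 5 * (U * U) + Z₀ * Z₀
        eq₁ = trans eq₀ (cong (_+ Z₀ * Z₀) (sym q≡))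
        3∣ : + 3 ∣ U * U - Z₀ * Z₀
        3∣ = divides (+ 2 * (U * U) + + 5 * (X * X) - M) (trans (e₁ X U Z₀)
            (trans (cong (λ u → + 6 * (U * U) + + 15 * (X * X) - u) (sym eq₁)) (e₂ X U M)))
          where
          e₁ : ∀ X U Z → U * U - Z * Z ≡ + 6 * (U * U) + + 15 * (X * X) - (+ 15 * (X * X) + + 5 * (U * U) + Z * Z)
          e₁ = solve-∀
          e₂ : ∀ X U M → + 6 * (U * U) + + 15 * (X * X) - + 3 * M ≡ (+ 2 * (U * U) + + 5 * (X * X) - M) * + 3
          e₂ = solve-∀
        U≡ : U ≡ + 4 * q - X
        U≡ = trans (e X U) (trans (cong (_- X) X+U≡) (cong (_- X) (*-comm q (+ 4))))
          where e : ∀ X U → U ≡ X + U - X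
                e = solve-∀
        go : (∃[ Z ] Z * Z ≡ Z₀ * Z₀ × (+ 3 ∣ U - Z)) → Representation 6 n
        go (Z , Z² , divides c′ c≡) = [ (λ h → with-class b-odd c q X Z-odd eq h) ,
            (λ h → with-class b-odd (- c) (- q) (- X) (subst (+ 2 ∣_) (e₁ c q X) (∣m∣n⇒∣m-n Z-odd
                (divides (+ 4 * q - X + + 3 * c) refl)))
              (trans eq (e₂ c q X)) (subst (+ 5 ∣_) (e₃ b c q X) h)) ]′ (euclid₅ (b - A) (b + A) 5∣)
          where
          c = - c′
          A = c + + 3 * X - + 2 * q
          Z≡ : Z ≡ + 4 * q - X + + 3 * c
          Z≡ = trans (e Z U) (trans (cong₂ _-_ U≡ c≡) (e′ q X c′))
            where
            e : ∀ Z U → Z ≡ U - (U - Z)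
            e = solve-∀
            e′ : ∀ q X c → + 4 * q - X - c * + 3 ≡ + 4 * q - X + + 3 * (- c)
            e′ = solve-∀
          Z-odd : + 2 ∣ 1ℤ + (+ 4 * q - X + + 3 * c)
          Z-odd = subst (λ u → + 2 ∣ 1ℤ + u) Z≡ ([ (λ (k , ev) → contradiction ([ (λ h → h) , (λ h → h) ]′
              (euclid₂ Z₀ Z₀ (subst (+ 2 ∣_) Z² (∣n⇒∣m*n Z (divides k (trans ev (*-comm (+ 2) k))))))) Z₀-odd) ,
                    (λ (k , od) → divides (1ℤ + k) (trans (cong (λ u → 1ℤ + u) od) (e k))) ]′ (parity Z))
            where e : ∀ k → 1ℤ + (1ℤ + + 2 * k) ≡ (1ℤ + k) * + 2
                  e = solve-∀
          eq : + 3 * M ≡ + 15 * (X * X) + + 5 * ((+ 4 * q - X) * (+ 4 * q - X)) + (+ 4 * q - X + + 3 * c) * (+ 4 * q - X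
              + + 3 * c)
          eq = trans eq₁ (cong₂ (λ u v → + 15 * (X * X) + + 5 * (u * u) + v) U≡ (trans (sym Z²) (cong₂ _*_ Z≡ Z≡)))
          e₁ : ∀ c q X → 1ℤ + (+ 4 * q - X + + 3 * c) - (+ 4 * q - X + + 3 * c) * + 2 ≡ 1ℤ + (+ 4 * (- q) - (- X)
              + + 3 * (- c))
          e₁ = solve-∀
          e₂ : ∀ c q X → + 15 * (X * X) + + 5 * ((+ 4 * q - X) * (+ 4 * q - X)) + (+ 4 * q - X + + 3 * c) * (+ 4 * q - X
              + + 3 * c)
               ≡ + 15 * (- X * - X) + + 5 * ((+ 4 * (- q) - (- X)) * (+ 4 * (- q) - (- X))) + (+ 4 * (- q) - (- X)
                   + + 3 * (- c)) * (+ 4 * (- q) - (- X) + + 3 * (- c))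
          e₂ = solve-∀
          e₃ : ∀ b c q X → b + (c + + 3 * X - + 2 * q) ≡ b - (- c + + 3 * (- X) - + 2 * (- q))
          e₃ = solve-∀
          B = c - X - + 2 * q
          C = + 4 * q - X + c
          5∣ : + 5 ∣ (b - A) * (b + A)
          5∣ = [ (λ h → contradiction (∣⇒∣ℕ h) (from-no (5 ℕ.∣? 3))) , (λ h → h) ]′ (euclid₅ (+ 3) ((b - A) * (b + A))
                 (divides (+ 4 * + n + + 2 * b - + 3 * M + B * B + + 2 * (C * C))
                   (trans (e₄ (+ n) b c q X) (trans (cong₂ (λ u v → + 20 * + n + + 10 * b - u - + 2 * v + + 5 * (B * B)
                       + + 10 * (C * C)) (sym M≡) (sym eq)) (e₅ (+ n) b M (B * B) (C * C))))))
            where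
            e₄ : ∀ n b c q X → + 3 * ((b - (c + + 3 * X - + 2 * q)) * (b + (c + + 3 * X - + 2 * q)))
                 ≡ + 20 * n + + 10 * b - (+ 20 * n + + 10 * b - + 3 * (b * b))
                   - + 2 * (+ 15 * (X * X) + + 5 * ((+ 4 * q - X) * (+ 4 * q - X)) + (+ 4 * q - X + + 3 * c) * (+ 4 * q
                       - X + + 3 * c))
                   + + 5 * ((c - X - + 2 * q) * (c - X - + 2 * q)) + + 10 * ((+ 4 * q - X + c) * (+ 4 * q - X + c))
            e₄ = solve-∀
            e₅ : ∀ n b M B C → + 20 * n + + 10 * b - + 9 * M - + 2 * (+ 3 * M) + + 5 * B + + 10 * C ≡
                (+ 4 * n + + 2 * b - + 3 * M + B + + 2 * C) * + 5
            e₅ = solve-∀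

  case-6 : ∀ n b t → + 9 * + odd (odd t) ≡ + 20 * + n + + 10 * + b - + 3 * (+ b * + b) → (∃[ k ] + b ≡ 1ℤ + + 2 * k)
      → ¬ 5 ℕ.∣ b →
           + 6 * + n + + b < + b * + b + + 10 → Representation 6 n
  case-6 n b t M≡ b-odd 5∤b bound = Solve6.solve-6 n b (+ M) M≡ bound b-odd (represent-3M t res)
      (divides (+ 1 + + odd t) (trans (cong (λ u → 1ℤ + (1ℤ + u)) (pos-+ (odd t) (odd t))) (e₂ (+ odd t))))
    where
    M = odd (odd t)
    e₂ : ∀ h → 1ℤ + (1ℤ + (h + h)) ≡ (+ 1 + h) * + 2
    e₂ = solve-∀
    5∣ : 5 ℕ.∣ 3 ℕ.* M ℕ.+ 1 ℕ.* (b ℕ.* b)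
    5∣ = ∣⇒∣ℕ ([ (λ h → contradiction (∣⇒∣ℕ h) (from-no (5 ℕ.∣? 3))) , (λ h → h) ]′ (euclid₅ (+ 3)
        (+ (3 ℕ.* M ℕ.+ 1 ℕ.* (b ℕ.* b)))
           (divides (+ 4 * + n + + 2 * + b) (trans (cong (+ 3 *_) (trans (pos-+ (3 ℕ.* M) (1 ℕ.* (b ℕ.* b)))
               (cong₂ _+_ (pos-* 3 M) (trans (pos-* 1 (b ℕ.* b)) (cong (1ℤ *_) (pos-* b b))))))
             (trans (e₃ (+ M) (+ b)) (trans (cong (λ u → u + + 3 * (+ b * + b)) M≡) (e₄ (+ n) (+ b))))))))
      where
      e₃ : ∀ M b → + 3 * (+ 3 * M + 1ℤ * (b * b)) ≡ + 9 * M + + 3 * (b * b)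
      e₃ = solve-∀
      e₄ : ∀ n b → + 20 * n + + 10 * b - + 3 * (b * b) + + 3 * (b * b) ≡ (+ 4 * n + + 2 * b) * + 5
      e₄ = solve-∀
    res : M % 5 ≡ 2 ⊎ M % 5 ≡ 3
    res = residues-5 (ℕ.m%n<n M 5) (ℕ.m%n<n b 5) (reduce-residues 5 3 1 M b 5∣) (λ e → 5∤b (ℕ.m%n≡0⇒n∣m b 5 e))

-- Choice of b for large n.

module LargeNumbers where

  open import Data.Integer hiding (suc; _/_; _%_)
  open import Data.Integer.Properties
  open import Data.Integer.Divisibility.Signed
  open import Data.Integer.Tactic.RingSolver using (solve-∀)
  open Congruences
  open ResidueSymbol using (odd)
  open NormLikeNumbers using (coprime-*-∣)
  open HyperbolaMethod using (%-≈)
  open TernaryForms using (0≤*; from-diff-<; pos-factor)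
  open ReducedForms using (odd-not-even; parity)
  open CauchyArgument
  open WeightThree
  open WeightSix

  integer-sqrt : ∀ N → ∃[ r ] r ℕ.* r ℕ.≤ N × N ℕ.< suc r ℕ.* suc r
  integer-sqrt zero    = 0 , z≤n , s≤s z≤n
  integer-sqrt (suc N) = step (integer-sqrt N)
    where
    step : (∃[ r ] r ℕ.* r ℕ.≤ N × N ℕ.< suc r ℕ.* suc r) → ∃[ r ] r ℕ.* r ℕ.≤ suc N × suc N ℕ.< suc r ℕ.* suc r
    step (r , lo , hi) with suc r ℕ.* suc r ℕ.≤? suc N
    ... | yes le = suc r , le , ℕ.≤-<-trans hi (ℕ.*-mono-< (ℕ.n<1+n (suc r)) (ℕ.n<1+n (suc r)))
    ... | no ¬le = r , ℕ.m≤n⇒m≤1+n lo , ℕ.≰⇒> ¬le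

  sqrt≥ : ∀ {r N} s → N ℕ.< suc r ℕ.* suc r → s ℕ.* s ℕ.≤ N → s ℕ.≤ r
  sqrt≥ {r} s hi le = ℕ.≮⇒≥ (λ r<s → ℕ.<⇒≱ hi (ℕ.≤-trans (ℕ.*-mono-≤ r<s r<s) le))

  weaken : ∀ {x y m k} → m ∣ k → x ≈ y [ k ] → x ≈ y [ m ]
  weaken m∣k (cong-mod d) = cong-mod (∣-trans m∣k d)

  -- With β = b mod 168 and ν = n mod 12, these conditions on b make (2n + b) / 3 integral and
  -- M = (14n + 7b - 3b²) / 2 congruent to 3 modulo 4 and prime to 7.
  module Three-weights where

    Good : ℕ → ℕ → Set
    Good β ν = 3 ℕ.∣ β ℕ.+ 2 ℕ.* ν × 8 ℕ.∣ β ℕ.* β ℕ.+ 3 ℕ.* β ℕ.+ 2 ℕ.+ 6 ℕ.* ν × ¬ 7 ℕ.∣ β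

    good? : ∀ β ν → Dec (Good β ν)
    good? β ν = (3 ℕ.∣? β ℕ.+ 2 ℕ.* ν) ×-dec (8 ℕ.∣? β ℕ.* β ℕ.+ 3 ℕ.* β ℕ.+ 2 ℕ.+ 6 ℕ.* ν) ×-dec ¬? (7 ℕ.∣? β)

    abstract
      -- Here ρ is the residue of r = ⌊√(4n)⌋: whatever the residues are, some b with r < b ≤ r + 27
      -- is admissible. The modulus is 168 = 3·7·8, and n matters only modulo 3 and modulo 4.
      table : ∀ {ρ} → ρ ℕ.< 168 → ∀ {ν} → ν ℕ.< 12 → ∃[ j ] j ℕ.< 27 × Good (ρ ℕ.+ suc j) ν
      table = from-yes (ℕ.allUpTo? (λ ρ → ℕ.allUpTo? (λ ν → ℕ.anyUpTo? (λ j → good? (ρ ℕ.+ suc j) ν) 27) 12) 168)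

  -- With β = b mod 90 and ν = n mod 9, these conditions on b make (2n + b) / 3 integral and
  -- M = (20n + 10b - 3b²) / 9 an integer congruent to 3 modulo 4 and prime to 5.
  module Six-weights where

    Good : ℕ → ℕ → Set
    Good β ν = 2 ℕ.∣ suc β × 9 ℕ.∣ 2 ℕ.* ν ℕ.+ β ℕ.+ 6 ℕ.* (β ℕ.* β) × ¬ 5 ℕ.∣ β

    good? : ∀ β ν → Dec (Good β ν)
    good? β ν = (2 ℕ.∣? suc β) ×-dec (9 ℕ.∣? 2 ℕ.* ν ℕ.+ β ℕ.+ 6 ℕ.* (β ℕ.* β)) ×-dec ¬? (5 ℕ.∣? β)

    abstract
      -- The window begins at r + 2, with r = ⌊√(6n)⌋, because from there on 6n + b < b² + 10 is
      -- guaranteed.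
      table : ∀ {ρ} → ρ ℕ.< 90 → ∀ {ν} → ν ℕ.< 9 → ∃[ j ] j ℕ.< 36 × Good (ρ ℕ.+ suc (suc j)) ν
      table = from-yes (ℕ.allUpTo? (λ ρ → ℕ.allUpTo? (λ ν → ℕ.anyUpTo? (λ j → good? (ρ ℕ.+ suc (suc j)) ν) 36) 9) 90)

  nonneg-quotient : ∀ s m k → m ℕ.≤ k → 0ℤ < + m + + k * s → ∃[ t ] s ≡ + t
  nonneg-quotient (+ t)    m k m≤k lt = t , refl
  nonneg-quotient -[1+ n ] m k m≤k lt = contradiction lt (≤⇒≯ (≤-trans (+-mono-≤ (+≤+ m≤k) (*-monoˡ-≤-nonNeg
      (+ k) { -[1+ n ]} { -1ℤ} (-≤- z≤n))) (≤-reflexive (e (+ k)))))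
    where e : ∀ k → k + k * -1ℤ ≡ 0ℤ
          e = solve-∀

  odd-odd : ∀ t → + odd (odd t) ≡ + 3 + + 4 * + t
  odd-odd t = trans (cong +_ (e t)) (trans (pos-+ 3 (4 ℕ.* t)) (cong (λ z → + 3 + z) (pos-* 4 t)))
    where e : ∀ t → suc (suc (t ℕ.+ t) ℕ.+ suc (t ℕ.+ t)) ≡ 3 ℕ.+ 4 ℕ.* t
          e = ℕ.solve-∀

  shifted-≈ : ∀ r j k .{{_ : ℕ.NonZero k}} → + (r % k ℕ.+ j) ≈ + (r ℕ.+ j) [ + k ]
  shifted-≈ r j k = ≈-trans (≈-reflexive (pos-+ (r % k) j)) (≈-trans (≈-+ (%-≈ r k) (≈-refl {x = + j})) (≈-reflexive
      (sym (pos-+ r j))))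

  -- b must lie between 2√n and √(14n/3); for 2√n ≥ 350 this leaves room for 27 consecutive values.
  large-3 : ∀ n → 350 ℕ.* 350 ℕ.≤ 4 ℕ.* n → Representation 3 n
  large-3 n big = go (integer-sqrt (4 ℕ.* n))
    where
    open Three-weights
    go : (∃[ r ] r ℕ.* r ℕ.≤ 4 ℕ.* n × 4 ℕ.* n ℕ.< suc r ℕ.* suc r) → Representation 3 n
    go (r , lo , hi) = pick (table (ℕ.m%n<n r 168) (ℕ.m%n<n n 12))
      where
      350≤r : 350 ℕ.≤ r
      350≤r = sqrt≥ 350 hi big
      pick : (∃[ j ] j ℕ.< 27 × Good (r % 168 ℕ.+ suc j) (n % 12)) → Representation 3 n
      pick (j , j<27 , d₃ , d₈ , d₇) = with-t (nonneg-quotient s 6 8 (from-yes (6 ℕ.≤? 8)) (subst (0ℤ <_) V≡ V>0))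
        where
        j′ = suc j
        b = r ℕ.+ j′
        β = r % 168 ℕ.+ j′
        ν = n % 12
        β≈b : + β ≈ + b [ + 168 ]
        β≈b = shifted-≈ r j′ 168
        ν≈n : + ν ≈ + n [ + 12 ]
        ν≈n = %-≈ n 12
        V = + 14 * + n + + 7 * + b - + 3 * (+ b * + b)
        3∣ : + 3 ∣ + b + + 2 * + n
        3∣ = ≈-∣ (≈-+ (weaken (divides (+ 56) refl) β≈b) (≈-*ˡ (+ 2) (weaken (divides (+ 4) refl) ν≈n)))
               (subst (+ 3 ∣_) (trans (pos-+ β (2 ℕ.* ν)) (cong (λ u → + β + u) (pos-* 2 ν))) (∣ℕ⇒∣ d₃))
        7∤ : ¬ 7 ℕ.∣ b
        7∤ h = d₇ (∣⇒∣ℕ (≈-∣ (≈-sym (weaken (divides (+ 24) refl) β≈b)) (∣ℕ⇒∣ h)))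
        8∣ : + 8 ∣ + b * + b + + 3 * + b + + 2 + + 6 * + n
        8∣ = ≈-∣ (≈-+ (≈-+ (≈-+ (≈-* β≈₈b β≈₈b) (≈-*ˡ (+ 3) β≈₈b)) (≈-refl {x = + 2})) 6ν≈6n) (subst (+ 8 ∣_) pos-eq
            (∣ℕ⇒∣ d₈))
          where
          β≈₈b = weaken {m = + 8} (divides (+ 21) refl) β≈b
          6ν≈6n : + 6 * + ν ≈ + 6 * + n [ + 8 ]
          6ν≈6n = cong-mod (∣-trans (divides (+ 9) refl) (subst (+ 72 ∣_) (e (+ ν) (+ n)) (*-monoʳ-∣ (+ 6)
              (difference ν≈n))))
            where e : ∀ x y → + 6 * (x - y) ≡ + 6 * x - + 6 * y
                  e = solve-∀
          pos-eq : + (β ℕ.* β ℕ.+ 3 ℕ.* β ℕ.+ 2 ℕ.+ 6 ℕ.* ν) ≡ + β * + β + + 3 * + β + + 2 + + 6 * + ν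
          pos-eq = trans (pos-+ (β ℕ.* β ℕ.+ 3 ℕ.* β ℕ.+ 2) (6 ℕ.* ν)) (cong₂ _+_ (trans (pos-+ (β ℕ.* β ℕ.+ 3 ℕ.* β) 2)
            (cong (_+ + 2) (trans (pos-+ (β ℕ.* β) (3 ℕ.* β)) (cong₂ _+_ (pos-* β β) (pos-* 3 β))))) (pos-* 6 ν))
        8∣V-6 : + 8 ∣ V - + 6
        -- V is to be 2M, so V ≡ 6 mod 8 means M ≡ 3 mod 4; five times the condition of the table is
        -- congruent to V - 6.
        8∣V-6 = subst (+ 8 ∣_) (e (+ n) (+ b)) (∣m∣n⇒∣m-n (∣n⇒∣m*n (+ 5) 8∣) (divides (+ 2 * + n + + b + + b * + b
            + + 2) refl))
          where e : ∀ n b → + 5 * (b * b + + 3 * b + + 2 + + 6 * n) - (+ 2 * n + b + b * b + + 2) * + 8 ≡ + 14 * n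
                    + + 7 * b - + 3 * (b * b) - + 6
                e = solve-∀
        s = _∣_.quotient 8∣V-6
        V≡ : V ≡ + 6 + + 8 * s
        V≡ = trans (e₁ V) (cong (λ u → + 6 + u) (trans (_∣_.equality 8∣V-6) (*-comm s (+ 8))))
          where e₁ : ∀ v → v ≡ + 6 + (v - + 6)
                e₁ = solve-∀
        V>0 : 0ℤ < V
        -- Since r² ≤ 4n, 2V is at least r² + 14r - 12rj′ + 14j′ - 6j′². Splitting this at j′ = 27
        -- leaves (r + 40)(r - 350), terms that are nonnegative for j′ ≤ 27, and the constant 9626.
        V>0 = pos-factor {+ 2} (+<+ (s≤s z≤n)) (from-diff-< {0ℤ} {+ 2 * V} (+-mono-<-≤ {0ℤ} {+ 9626} (+<+ (s≤s z≤n))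
            rest≥0) (trans (cong (λ B → + 2 * (+ 14 * + n + + 7 * B - + 3 * (B * B)) - 0ℤ) (pos-+ r j′)) (e (+ n) (+ r)
            (+ j′))))
          where
          rest = + 7 * (+ 4 * + n - + r * + r) + ((+ r + + 40) * (+ r - + 350) + + 12 * + r * (+ 27 - + j′)
              + + 14 * + j′ + + 6 * ((+ 27 - + j′) * (+ 27 + + j′)))
          e : ∀ n r j → + 2 * (+ 14 * n + + 7 * (r + j) - + 3 * ((r + j) * (r + j))) - 0ℤ
              ≡ + 9626 + (+ 7 * (+ 4 * n - r * r) + ((r + + 40) * (r - + 350) + + 12 * r * (+ 27 - j) + + 14 * j + + 6 *
                  ((+ 27 - j) * (+ 27 + j))))
          e = solve-∀
          r≥ = i≤j⇒0≤j-i {+ 350} {+ r} (+≤+ 350≤r)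
          j≤ = i≤j⇒0≤j-i {+ j′} {+ 27} (+≤+ j<27)
          4n≥ : 0ℤ ≤ + 4 * + n - + r * + r
          4n≥ = i≤j⇒0≤j-i (subst₂ _≤_ (pos-* r r) (pos-* 4 n) (+≤+ lo))
          rest≥0 : 0ℤ ≤ rest
          rest≥0 = +-mono-≤ (0≤* {+ 7} (+≤+ z≤n) 4n≥) (+-mono-≤ (+-mono-≤ (+-mono-≤ (0≤* (+≤+ {0} {r ℕ.+ 40} z≤n) r≥)
              (0≤* (0≤* {+ 12} {+ r} (+≤+ z≤n) (+≤+ z≤n)) j≤))
                     (0≤* {+ 14} {+ j′} (+≤+ z≤n) (+≤+ z≤n))) (0≤* {+ 6} (+≤+ z≤n) (0≤* j≤ (+≤+ {0} {27 ℕ.+ j′} z≤n))))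
        bound : + 4 * + n < + b * + b + + 7
        bound = subst₂ _<_ (pos-* 4 n) (trans (pos-+ (b ℕ.* b) 7) (cong (_+ + 7) (pos-* b b)))
            (+<+ (ℕ.<-≤-trans hi (ℕ.≤-trans (ℕ.*-mono-≤ r<b r<b) (ℕ.m≤m+n (b ℕ.* b) 7))))
          where
          r<b : suc r ℕ.≤ b
          r<b = ℕ.≤-trans (ℕ.≤-reflexive (ℕ.+-comm 1 r)) (ℕ.+-monoʳ-≤ r (s≤s z≤n))
        with-t : (∃[ t ] s ≡ + t) → Representation 3 n
        with-t (t , s≡) = case-3 n b t (trans (cong (+ 2 *_) (odd-odd t)) (trans (e (+ t))
            (sym (trans V≡ (cong (λ u → + 6 + + 8 * u) s≡))))) 3∣ 7∤ bound
          where e : ∀ t → + 2 * (+ 3 + + 4 * t) ≡ + 6 + + 8 * t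
                e = solve-∀

  -- b must lie between √(6n) + 1 and √(20n/3); for √(6n) ≥ 660 this leaves room for 36 consecutive values.
  large-6 : ∀ n → 660 ℕ.* 660 ℕ.≤ 6 ℕ.* n → Representation 6 n
  large-6 n big = go (integer-sqrt (6 ℕ.* n))
    where
    open Six-weights
    go : (∃[ r ] r ℕ.* r ℕ.≤ 6 ℕ.* n × 6 ℕ.* n ℕ.< suc r ℕ.* suc r) → Representation 6 n
    go (r , lo , hi) = pick (table (ℕ.m%n<n r 90) (ℕ.m%n<n n 9))
      where
      660≤r : 660 ℕ.≤ r
      660≤r = sqrt≥ 660 hi big
      pick : (∃[ j ] j ℕ.< 36 × Good (r % 90 ℕ.+ suc (suc j)) (n % 9)) → Representation 6 n
      pick (j , j<36 , d₂ , d₉ , d₅) = with-t (nonneg-quotient s 27 36 (from-yes (27 ℕ.≤? 36)) (subst (0ℤ <_) V≡ V>0))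
        where
        j′ = suc (suc j)
        b = r ℕ.+ j′
        β = r % 90 ℕ.+ j′
        ν = n % 9
        β≈b : + β ≈ + b [ + 90 ]
        β≈b = shifted-≈ r j′ 90
        ν≈n : + ν ≈ + n [ + 9 ]
        ν≈n = %-≈ n 9
        V = + 20 * + n + + 10 * + b - + 3 * (+ b * + b)
        5∤ : ¬ 5 ℕ.∣ b
        5∤ h = d₅ (∣⇒∣ℕ (≈-∣ (≈-sym (weaken (divides (+ 18) refl) β≈b)) (∣ℕ⇒∣ h)))
        2∣1+b : + 2 ∣ 1ℤ + + b
        2∣1+b = ≈-∣ (≈-+ (≈-refl {x = 1ℤ}) (weaken (divides (+ 45) refl) β≈b)) (∣ℕ⇒∣ d₂)
        b-odd : ∃[ k ] + b ≡ 1ℤ + + 2 * k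
        b-odd = [ (λ (k , eq) → contradiction 2∣1+b (odd-not-even k (cong (λ u → 1ℤ + u) eq))) , (λ o → o) ]′
            (parity (+ b))
        9∣ : + 9 ∣ + 2 * + n + + b + + 6 * (+ b * + b)
        9∣ = ≈-∣ (≈-+ (≈-+ (≈-*ˡ (+ 2) ν≈n) β≈₉b) (≈-*ˡ (+ 6) (≈-* β≈₉b β≈₉b))) (subst (+ 9 ∣_) pos-eq (∣ℕ⇒∣ d₉))
          where
          β≈₉b = weaken {m = + 9} (divides (+ 10) refl) β≈b
          pos-eq : + (2 ℕ.* ν ℕ.+ β ℕ.+ 6 ℕ.* (β ℕ.* β)) ≡ + 2 * + ν + + β + + 6 * (+ β * + β)
          pos-eq = trans (pos-+ (2 ℕ.* ν ℕ.+ β) (6 ℕ.* (β ℕ.* β))) (cong₂ _+_ (trans (pos-+ (2 ℕ.* ν) β) (cong (_+ + β)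
              (pos-* 2 ν)))
                     (trans (pos-* 6 (β ℕ.* β)) (cong (+ 6 *_) (pos-* β β))))
        4∣V-27 : + 4 ∣ V - + 27
        -- V is to be 9M with M ≡ 3 mod 4. For odd b, V ≡ 2 - 3 ≡ 27 mod 4 for every n.
        4∣V-27 = let k , eq = b-odd in divides (+ 5 * + n - + 5 + + 2 * k - + 3 * (k * k))
                  (trans (cong (λ B → + 20 * + n + + 10 * B - + 3 * (B * B) - + 27) eq) (e (+ n) k))
          where e : ∀ n k → + 20 * n + + 10 * (1ℤ + + 2 * k) - + 3 * ((1ℤ + + 2 * k) * (1ℤ + + 2 * k)) - + 27 ≡
                    (+ 5 * n - + 5 + + 2 * k - + 3 * (k * k)) * + 4
                e = solve-∀
        9∣V-27 : + 9 ∣ V - + 27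
        9∣V-27 = subst (+ 9 ∣_) (e (+ n) (+ b)) (∣m∣n⇒∣m-n (∣n⇒∣m*n (+ 10) 9∣) (divides (+ 7 * (+ b * + b) + + 3) refl))
          where e : ∀ n b → + 10 * (+ 2 * n + b + + 6 * (b * b)) - (+ 7 * (b * b) + + 3) * + 9 ≡ + 20 * n + + 10 * b
                    - + 3 * (b * b) - + 27
                e = solve-∀
        36∣V-27 : + 36 ∣ V - + 27
        36∣V-27 = coprime-*-∣ (from-yes (coprime? 4 9)) 4∣V-27 9∣V-27
        s = _∣_.quotient 36∣V-27
        V≡ : V ≡ + 27 + + 36 * s
        V≡ = trans (e₁ V) (cong (λ u → + 27 + u) (trans (_∣_.equality 36∣V-27) (*-comm s (+ 36))))
          where e₁ : ∀ v → v ≡ + 27 + (v - + 27)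
                e₁ = solve-∀
        V>0 : 0ℤ < V
        -- Now r² ≤ 6n, and splitting at j′ = 37, the last b of the window, leaves (r + 24)(r -
        -- 660), further nonnegative terms and the constant 3519.
        V>0 = pos-factor {+ 3} (+<+ (s≤s z≤n)) (from-diff-< {0ℤ} {+ 3 * V} (+-mono-<-≤ {0ℤ} {+ 3519} (+<+ (s≤s z≤n))
            rest≥0) (trans (cong (λ B → + 3 * (+ 20 * + n + + 10 * B - + 3 * (B * B)) - 0ℤ) (pos-+ r j′)) (e (+ n) (+ r)
            (+ j′))))
          where
          rest = + 10 * (+ 6 * + n - + r * + r) + ((+ r + + 24) * (+ r - + 660) + + 18 * + r * (+ 37 - + j′)
              + + 30 * + j′ + + 9 * ((+ 37 - + j′) * (+ 37 + + j′)))
          e : ∀ n r j → + 3 * (+ 20 * n + + 10 * (r + j) - + 3 * ((r + j) * (r + j))) - 0ℤ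
              ≡ + 3519 + (+ 10 * (+ 6 * n - r * r) + ((r + + 24) * (r - + 660) + + 18 * r * (+ 37 - j) + + 30 * j
                  + + 9 * ((+ 37 - j) * (+ 37 + j))))
          e = solve-∀
          r≥ = i≤j⇒0≤j-i {+ 660} {+ r} (+≤+ 660≤r)
          j≤ = i≤j⇒0≤j-i {+ j′} {+ 37} (+≤+ (s≤s j<36))
          6n≥ : 0ℤ ≤ + 6 * + n - + r * + r
          6n≥ = i≤j⇒0≤j-i (subst₂ _≤_ (pos-* r r) (pos-* 6 n) (+≤+ lo))
          rest≥0 : 0ℤ ≤ rest
          rest≥0 = +-mono-≤ (0≤* {+ 10} (+≤+ z≤n) 6n≥) (+-mono-≤ (+-mono-≤ (+-mono-≤ (0≤* (+≤+ {0} {r ℕ.+ 24} z≤n) r≥)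
              (0≤* (0≤* {+ 18} {+ r} (+≤+ z≤n) (+≤+ z≤n)) j≤))
                     (0≤* {+ 30} {+ j′} (+≤+ z≤n) (+≤+ z≤n))) (0≤* {+ 9} (+≤+ z≤n) (0≤* j≤ (+≤+ {0} {37 ℕ.+ j′} z≤n))))
        bound : + 6 * + n + + b < + b * + b + + 10
        bound = subst₂ _<_ (trans (pos-+ (6 ℕ.* n) b) (cong (_+ + b) (pos-* 6 n))) (trans (pos-+ (b ℕ.* b) 10)
            (cong (_+ + 10) (pos-* b b)))
                  (+<+ (ℕ.<-≤-trans (ℕ.+-monoˡ-< b hi) (ℕ.≤-trans (ℕ.≤-trans (ℕ.m≤m+n (suc r ℕ.* suc r ℕ.+ b)
                      (suc r ℕ.+ j ℕ.* (r ℕ.+ r ℕ.+ 3 ℕ.+ j))) (ℕ.≤-reflexive (e r j))) (ℕ.m≤m+n (b ℕ.* b) 10))))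
          where e : ∀ r j → suc r ℕ.* suc r ℕ.+ (r ℕ.+ suc (suc j)) ℕ.+ (suc r ℕ.+ j ℕ.* (r ℕ.+ r ℕ.+ 3 ℕ.+ j)) ≡
                    (r ℕ.+ suc (suc j)) ℕ.* (r ℕ.+ suc (suc j))
                e = ℕ.solve-∀
        with-t : (∃[ t ] s ≡ + t) → Representation 6 n
        with-t (t , s≡) = case-6 n b t (trans (cong (+ 9 *_) (odd-odd t)) (trans (e (+ t))
            (sym (trans V≡ (cong (λ u → + 27 + + 36 * u) s≡))))) b-odd 5∤ bound
          where e : ∀ t → + 9 * (+ 3 + + 4 * t) ≡ + 27 + + 36 * t
                e = solve-∀

-- Verification of the small cases.

module SmallNumbers where

  open import Data.Nat using (_+_; _*_; _≤_; _<_; _<?_)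
  open import Data.Nat.Properties
  open import Data.Nat.Tactic.RingSolver using (solve-∀)
  open CauchyArgument using (Representation; p5-suc)

  ∧-true : ∀ {a b} → a ∧ b ≡ true → a ≡ true × b ≡ true
  ∧-true {true} eq = refl , eq

  ∨-true : ∀ {a b} → a ∨ b ≡ true → a ≡ true ⊎ b ≡ true
  ∨-true {true}  eq = inj₁ refl
  ∨-true {false} eq = inj₂ eq

  -- A list of truth values is the characteristic function of a finite set. Beyond its end nothing
  -- belongs to the set, so cutting a list short can lose elements but never add false ones.
  member : ℕ → List Bool → Bool
  member _       []       = false
  member zero    (b ∷ _)  = b
  member (suc i) (_ ∷ bs) = member i bs

  member-drop : ∀ d i bs → member i (drop d bs) ≡ member (d + i) bs
  member-drop zero    i       bs       = refl
  member-drop (suc d) zero    []       = refl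
  member-drop (suc d) (suc i) []       = refl
  member-drop (suc d) i       (_ ∷ bs) = member-drop d i bs

  member-replicate : ∀ n i → member i (replicate n false) ≢ true
  member-replicate (suc n) (suc i) eq = member-replicate n i eq

  translate : ℕ → List Bool → List Bool → List Bool
  translate _       _         []        = []
  translate zero    []        set       = set
  translate zero    (b ∷ src) (a ∷ set) = (a ∨ b) ∷ translate zero src set
  translate (suc d) src       (a ∷ set) = a ∷ translate d src set

  translate-sound : ∀ d src set i → member i (translate d src set) ≡ true →
                    member i set ≡ true ⊎ ∃[ j ] i ≡ d + j × member j src ≡ true
  translate-sound zero    []        (a ∷ set) i       eq = inj₁ eq
  translate-sound zero    (b ∷ src) (a ∷ set) zero    eq = [ inj₁ , (λ h → inj₂ (0 , refl , h)) ]′ (∨-true eq)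
  translate-sound zero    (b ∷ src) (a ∷ set) (suc i) eq with translate-sound zero src set i eq
  ... | inj₁ h            = inj₁ h
  ... | inj₂ (j , e , h)  = inj₂ (suc j , cong suc e , h)
  translate-sound (suc d) src       (a ∷ set) zero    eq = inj₁ eq
  translate-sound (suc d) src       (a ∷ set) (suc i) eq with translate-sound d src set i eq
  ... | inj₁ h            = inj₁ h
  ... | inj₂ (j , e , h)  = inj₂ (j , cong suc e , h)

  add-multiples : ℕ → ℕ → List Bool → ℕ → List Bool
  add-multiples c zero    src len = replicate len false
  add-multiples c (suc k) src len = translate (c * p5 k) src (add-multiples c k src len)

  add-multiples-sound : ∀ c k src len i → member i (add-multiples c k src len) ≡ true →
                        ∃[ m ] ∃[ j ] i ≡ c * p5 m + j × member j src ≡ true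
  add-multiples-sound c zero    src len i eq = contradiction eq (member-replicate len i)
  add-multiples-sound c (suc k) src len i eq with translate-sound (c * p5 k) src (add-multiples c k src len) i eq
  ... | inj₁ h           = add-multiples-sound c k src len i h
  ... | inj₂ (j , e , h) = k , j , e , h

  -- The variable x is left out: it will be taken close to the largest admissible value, so the rest
  -- of n is small and a short table in the other three variables is enough.
  ternary : ℕ → ℕ → ℕ → List Bool
  ternary D k len = add-multiples D k (add-multiples 2 k (add-multiples 1 k (true ∷ []) len) len) len

  ternary-sound : ∀ D k len i → member i (ternary D k len) ≡ true → ∃[ w ] ∃[ y ] ∃[ z ] i ≡ p5 w + 2 * p5 y + D * p5 z
  ternary-sound D k len i h with add-multiples-sound D k _ len i h
  ... | z , j , refl , h₁ with add-multiples-sound 2 k _ len j h₁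
  ...   | y , l , refl , h₂ with add-multiples-sound 1 k (true ∷ []) len l h₂
  ...     | w , zero , refl , _ = w , y , z , e (p5 w) (p5 y) (p5 z) D
    where e : ∀ w y z D → D * z + (2 * y + (1 * w + 0)) ≡ w + 2 * y + D * z
          e = solve-∀
  ...     | w , suc m , refl , ()

  -- The four shifted tables are traversed in step, so that a block takes a single pass. A table
  -- that ends too early counts as failure.
  union-covers : ℕ → List Bool → List Bool → List Bool → List Bool → Bool
  union-covers zero    _        _        _        _        = true
  union-covers (suc n) (a ∷ as) (b ∷ bs) (c ∷ cs) (d ∷ ds) = (a ∨ (b ∨ (c ∨ d))) ∧ union-covers n as bs cs ds
  union-covers (suc n) _        _        _        _        = false

  union-covers-sound : ∀ n as bs cs ds → union-covers n as bs cs ds ≡ true → ∀ i → i < n →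
    member i as ≡ true ⊎ member i bs ≡ true ⊎ member i cs ≡ true ⊎ member i ds ≡ true
  union-covers-sound (suc n) (a ∷ as) (b ∷ bs) (c ∷ cs) (d ∷ ds) eq zero _ with ∧-true eq
  ... | h , _ = [ inj₁ , (λ h′ → inj₂ ([ inj₁ , (λ h″ → inj₂ (∨-true h″)) ]′ (∨-true h′))) ]′ (∨-true h)
  union-covers-sound (suc n) (a ∷ as) (b ∷ bs) (c ∷ cs) (d ∷ ds) eq (suc i) (s≤s i<n) with ∧-true eq
  ... | _ , h = union-covers-sound n as bs cs ds h i i<n

  gap : ℕ → ℕ → ℕ
  gap X i = p5 X ∸ p5 (X ∸ i)

  -- Every number in [p₅(X), p₅(X+1)) is p₅(X - i) plus an element of the table with i ≤ 3.
  block : List Bool → ℕ → Bool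
  block table X = union-covers (1 + 3 * X) table (drop (gap X 1) table) (drop (gap X 2) table) (drop (gap X 3) table)

  blocks : List Bool → ℕ → Bool
  blocks table zero    = true
  blocks table (suc X) = block table X ∧ blocks table X

  p5-mono : ∀ {m n} → m ≤ n → p5 m ≤ p5 n
  p5-mono {m} {n} m≤n = subst (λ k → p5 m ≤ p5 k) (m+[n∸m]≡n m≤n) (go (n ∸ m))
    where
    go : ∀ k → p5 m ≤ p5 (m + k)
    go zero    = ≤-reflexive (cong p5 (sym (+-identityʳ m)))
    go (suc k) = ≤-trans (go k) (≤-trans (m≤m+n (p5 (m + k)) _) (≤-reflexive (trans (sym (p5-suc (m + k)))
        (cong p5 (sym (+-suc m k))))))

  module _ (D k len : ℕ) where
    private table = ternary D k len

    Rep : ℕ → Set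
    Rep = Representation D

    from-table : ∀ X i s → member (gap X i + s) table ≡ true → Rep (p5 X + s)
    from-table X i s h with ternary-sound D k len (gap X i + s) h
    ... | w , y , z , eq = w , X ∸ i , y , z , (begin
      p5 X + s                               ≡⟨ cong (_+ s) (sym (m+[n∸m]≡n (p5-mono (m∸n≤m X i)))) ⟩
      p5 (X ∸ i) + gap X i + s               ≡⟨ +-assoc (p5 (X ∸ i)) (gap X i) s ⟩
      p5 (X ∸ i) + (gap X i + s)             ≡⟨ cong (p5 (X ∸ i) +_) eq ⟩
      p5 (X ∸ i) + (p5 w + 2 * p5 y + D * p5 z) ≡⟨ e (p5 (X ∸ i)) (p5 w) (2 * p5 y) (D * p5 z) ⟩
      p5 w + p5 (X ∸ i) + 2 * p5 y + D * p5 z ∎)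
      where
      open ≡-Reasoning
      e : ∀ x w y z → x + (w + y + z) ≡ w + x + y + z
      e = solve-∀

    blocks-sound : ∀ X → blocks table X ≡ true → ∀ n → n < p5 X → Rep n
    blocks-sound (suc X) eq n n< with ∧-true eq | n <? p5 X
    ... | _ , rest | yes lt = blocks-sound X rest n lt
    ... | here , _ | no ¬lt = subst Rep (m+[n∸m]≡n p≤n) (use (union-covers-sound (1 + 3 * X) table
          (drop (gap X 1) table) (drop (gap X 2) table) (drop (gap X 3) table) here s s<))
      where
      p≤n = ≮⇒≥ ¬lt
      s = n ∸ p5 X
      s< : s < 1 + 3 * X
      s< = +-cancelˡ-< (p5 X) s (1 + 3 * X) (subst₂ _<_ (sym (m+[n∸m]≡n p≤n)) (p5-suc X) n<)
      dropped : ∀ i → member s (drop (gap X i) table) ≡ true → Rep (p5 X + s)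
      dropped i h = from-table X i s (trans (sym (member-drop (gap X i) s table)) h)
      use : _ → Rep (p5 X + s)
      use (inj₁ h)               = from-table X 0 s (trans (cong (λ d → member (d + s) table) (n∸n≡0 (p5 X))) h)
      use (inj₂ (inj₁ h))        = dropped 1 h
      use (inj₂ (inj₂ (inj₁ h))) = dropped 2 h
      use (inj₂ (inj₂ (inj₂ h))) = dropped 3 h

-- Conclusion for both weights.

open import Data.Nat using (_+_; _*_; _≤_; _≤?_)
open CauchyArgument using (Representation)
open LargeNumbers using (large-3; large-6)
open SmallNumbers using (blocks; ternary; blocks-sound)

-- Needed is n < 350²/4 = 30625 ≤ p₅(144). The last block, X = 143, reads the table up to p₅(143) -
-- p₅(140) + 430 = 1702 entries, and p₅(39) already exceeds the length 1800.
blocks-3 : blocks (ternary 3 40 1800) 144 ≡ true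
blocks-3 = refl

-- Needed is n < 660²/6 = 72600 ≤ p₅(221). The last block, X = 220, reads p₅(220) - p₅(217) + 661 =
-- 2626 entries, and p₅(44) exceeds 2700.
blocks-6 : blocks (ternary 6 45 2700) 221 ≡ true
blocks-6 = refl

represent-3 : ∀ n → Representation 3 n
represent-3 n = go (350 * 350 ≤? 4 * n)
  where
  go : Dec (350 * 350 ≤ 4 * n) → Representation 3 n
  go (yes big)  = large-3 n big
  go (no small) = blocks-sound 3 40 1800 144 blocks-3 n
    (ℕ.<-≤-trans (ℕ.*-cancelˡ-< 4 n 30625 (ℕ.≰⇒> small)) (from-yes (30625 ≤? p5 144)))

represent-6 : ∀ n → Representation 6 n
represent-6 n = go (660 * 660 ≤? 6 * n)
  where
  go : Dec (660 * 660 ≤ 6 * n) → Representation 6 n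
  go (yes big)  = large-6 n big
  go (no small) = blocks-sound 6 45 2700 221 blocks-6 n
    (ℕ.<-≤-trans (ℕ.*-cancelˡ-< 6 n 72600 (ℕ.≰⇒> small)) (from-yes (72600 ≤? p5 221)))

theorem1p3 : (δ : ℕ) → (δ ≡ 1 ⊎ δ ≡ 2) → (n : ℕ) →
    ∃[ w ] ∃[ x ] ∃[ y ] ∃[ z ] n ≡ p5 w + p5 x + 2 * p5 y + 3 * δ * p5 z
theorem1p3 .1 (inj₁ refl) n = represent-3 n
theorem1p3 .2 (inj₂ refl) n = represent-6 n
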